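{- $\mathbf{Sym}^{(\ell)}$ is free (as an associative algebra) over the set $\{S_{\mathbf{n}} : \mathbf{n}\in\mathbb{N}^\ell,\ |\mathbf{n}|>0\}$, so that a linear basis is given by the elements $$S^{\mathbf{I}}=S_{\mathbf{i}_1}\cdots S_{\mathbf{i}_m},$$ where $\mathbf{I}$ runs over all vector compositions and $\mathbf{i}_1,\ldots,\mathbf{i}_m$ are the columns of $\mathbf{I}$. Moreover, $\mathbf{Sym}^{(\ell)}$ is a Hopf subalgebra of $\mathbf{FQSym}^{(\ell)}$, and the coproduct of the generators is given by $$\Delta S_{\mathbf{n}}=\sum_{\mathbf{i}+\mathbf{j}=\mathbf{n}}S_{\mathbf{i}}\otimes S_{\mathbf{j}},$$ where the sum $\mathbf{i}+\mathbf{j}$ is taken in $\mathbb{N}^\ell$. In particular, $\mathbf{Sym}^{(\ell)}$ is cocommutative.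
   Context: Let $C$ be a set of $\ell$ colors. A colored permutation of size $n$ is a pair $(\sigma,u)$ with $\sigma\in\mathfrak{S}_n$, $u\in C^n$. $\mathbf{FQSym}^{(\ell)}$ is the graded connected Hopf algebra with basis $\mathbf{G}_{\sigma,u}$ indexed by colored permutations, with $$\mathbf{G}_{\sigma',u'}\mathbf{G}_{\sigma'',u''}=\sum_{\sigma\in\sigma'*\sigma''}\mathbf{G}_{\sigma,u'\cdot u''},\qquad \Delta\mathbf{G}_{\sigma,u}=\sum_{(\sigma,u)\in(\sigma',u')\Cup(\sigma'',u'')}\mathbf{G}_{\sigma',u'}\otimes\mathbf{G}_{\sigma'',u''}.$$ Here $\sigma'*\sigma''$ (convolution, $\sigma'\in\mathfrak S_p$, $\sigma''\in\mathfrak S_q$) is the set of $\tau\in\mathfrak{S}_{p+q}$ such that the standardizations of the words formed by the first $p$ and the last $q$ letters of $\tau$ are $\sigma'$ and $\sigma''$ (the standardization of a word is the permutation with the same inversions); $u'\cdot u''$ is concatenation; and $(\sigma',u')\Cup(\sigma'',u'')$ is the shifted shuffle, i.e. the shuffle of the words of biletters $(\sigma',u')$ and $(\sigma''[p],u'')$, where $\sigma''[p]$ is $\sigma''$ with $p=|\sigma'|$ added to each letter (colors follow their letters). $\mathbf{G}$ indexed by the empty colored permutation is $1$. An $\ell$-partite number is a vector $\mathbf{n}=(n_i)_{i\in C}\in\mathbb{N}^\ell$, of weight $|\mathbf{n}|=\sum_i n_i$. A vector composition is a matrix $\mathbf{I}$ of nonnegative integers with $\ell$ rows, with any finite number $m\ge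 0$ of columns and with no zero column. For $\mathbf{n}\in\mathbb{N}^\ell$ with $|\mathbf{n}|=n$, $$S_{\mathbf{n}}=\sum_{u\in C^n;\ |u|_i=n_i\ \forall i}\mathbf{G}_{12\cdots n,\,u},\qquad S_{\mathbf{0}}=1,$$ where $|u|_i$ is the number of occurrences of color $i$ in $u$. $\mathbf{Sym}^{(\ell)}$ is the subalgebra of $\mathbf{FQSym}^{(\ell)}$ generated by all the $S_{\mathbf{n}}$. -}

module Defs where

open import Algebra.Bundles using (CommutativeRing; Ring)
open import Algebra.Bundles.Raw using (RawRing)
open import Algebra.Module.Bundles.Raw using (RawLeftModule)
open import Algebra.Module.Morphism.Structures using (module LeftModuleMorphisms)
open import Algebra.Morphism.Structures using (module RingMorphisms)
open import Data.Bool.Base using (if_then_else_)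
open import Data.Fin.Base as Fin using (Fin; toℕ; _↑ˡ_; _↑ʳ_)
open import Data.Fin.Permutation using (Permutation′; _⟨$⟩ʳ_; insert)
  renaming (id to idₚ)
import Data.Fin.Properties as Finₚ
open import Data.List.Base as List using (List; []; _∷_)
import Data.List.Properties as Listₚ
open import Data.List.Relation.Ternary.Interleaving.Propositional
  using (Interleaving; []; consˡ; consʳ)
open import Data.List.Relation.Ternary.Interleaving using (_∷ˡ_; _∷ʳ_)
open import Data.List.Relation.Unary.All using (All)
open import Data.Nat.Base using (ℕ; zero; suc; _+_; _∸_; _<_)
import Data.Nat.Properties as ℕₚ
open import Data.Product.Base as Product using (∃; _×_; _,_; proj₁; proj₂; uncurry)
import Data.Product.Properties as Productₚ
open import Data.Product.Relation.Binary.Pointwise.NonDependent using (×-decSetoid)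
open import Data.Sum.Base using (_⊎_; inj₁; inj₂; [_,_]′)
open import Data.Vec.Base as Vec using (Vec; []; _∷_)
import Data.Vec.Properties as Vecₚ
open import Function.Bundles using (_⇔_; mk⇔; Equivalence)
open import Level using (Level; _⊔_; 0ℓ) renaming (suc to lsuc)
open import Relation.Binary.Bundles using (DecSetoid)
import Relation.Binary.Construct.On as On
open import Relation.Binary.Definitions using (DecidableEquality)
open import Relation.Binary.PropositionalEquality using (_≡_; _≢_; refl)
import Relation.Binary.PropositionalEquality as ≡
open import Relation.Nullary.Decidable
  using (Dec; yes; no; does; map′; _→-dec_; _×-dec_; _⊎-dec_)

-- σ is identified with the word σ(0) … σ(n-1).  Letters and positions
-- are counted from 0 instead of 1.

permutations : ∀ n → List (Permutation′ n)
permutations zero    = idₚ ∷ []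
permutations (suc n) =
  List.cartesianProductWith (insert Fin.zero) (List.allFin (suc n)) (permutations n)

-- For words without repeated letters, "v is the standardization of w"
-- means that v is a permutation with the same inversions as w.

SameInversions : ∀ {k m n} → (Fin k → Fin m) → (Fin k → Fin n) → Set
SameInversions v w = ∀ i j → i Fin.< j → (v j Fin.< v i) ⇔ (w j Fin.< w i)

sameInversions? : ∀ {k m n} (v : Fin k → Fin m) (w : Fin k → Fin n) →
                  Dec (SameInversions v w)
sameInversions? v w = Finₚ.all? λ i → Finₚ.all? λ j →
  (i Finₚ.<? j) →-dec
  map′ (uncurry mk⇔) (λ e → Equivalence.to e , Equivalence.from e)
    (((v j Finₚ.<? v i) →-dec (w j Finₚ.<? w i)) ×-dec
     ((w j Finₚ.<? w i) →-dec (v j Finₚ.<? v i)))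

_∈_*_ : ∀ {p q} → Permutation′ (p + q) → Permutation′ p → Permutation′ q → Set
_∈_*_ {p} {q} τ σ′ σ″ =
  SameInversions (σ′ ⟨$⟩ʳ_) (λ i → τ ⟨$⟩ʳ (i ↑ˡ q)) ×
  SameInversions (σ″ ⟨$⟩ʳ_) (λ j → τ ⟨$⟩ʳ (p ↑ʳ j))

_∈?_*_ : ∀ {p q} (τ : Permutation′ (p + q)) (σ′ : Permutation′ p) (σ″ : Permutation′ q) →
         Dec (τ ∈ σ′ * σ″)
τ ∈? σ′ * σ″ = sameInversions? _ _ ×-dec sameInversions? _ _

convolution : ∀ {p q} → Permutation′ p → Permutation′ q → List (Permutation′ (p + q))
convolution {p} {q} σ′ σ″ = List.filter (_∈? σ′ * σ″) (permutations (p + q))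

-- The set of colors is Fin ℓ.

record ColoredPermutation (ℓ : ℕ) : Set where
  constructor ⟨_,_⟩
  field
    {size} : ℕ
    perm   : Permutation′ size
    colors : Vec (Fin ℓ) size

open ColoredPermutation public

Biletter : ℕ → Set
Biletter ℓ = ℕ × Fin ℓ

_≟ᵇ_ : ∀ {ℓ} → DecidableEquality (Biletter ℓ)
_≟ᵇ_ = Productₚ.≡-dec ℕₚ._≟_ Finₚ._≟_

biword : ∀ {ℓ} → ColoredPermutation ℓ → List (Biletter ℓ)
biword w = List.tabulate λ i → toℕ (perm w ⟨$⟩ʳ i) , Vec.lookup (colors w) i

-- A library permutation carries functions and proofs, so ≡ is too fine
-- for it.  The biword has length n and determines σ and u.

coloredPermutationDecSetoid : ℕ → DecSetoid 0ℓ 0ℓ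
coloredPermutationDecSetoid ℓ =
  On.decSetoid (≡.decSetoid (Listₚ.≡-dec (_≟ᵇ_ {ℓ}))) biword

words : ∀ {ℓ} n → List (Vec (Fin ℓ) n)
words zero    = [] ∷ []
words (suc n) = List.cartesianProductWith _∷_ (List.allFin _) (words n)

coloredPermutations : ∀ {ℓ} n → List (ColoredPermutation ℓ)
coloredPermutations n = List.cartesianProductWith ⟨_,_⟩ (permutations n) (words n)

interleaving? : ∀ {A : Set} → DecidableEquality A →
                (as bs cs : List A) → Dec (Interleaving as bs cs)
interleaving? _≟_ []       []       []       = yes []
interleaving? _≟_ (a ∷ as) bs       []       = no λ ()
interleaving? _≟_ []       (b ∷ bs) []       = no λ ()
interleaving? {A} _≟_ as bs (c ∷ cs) =
  map′ [ fromˡ as , fromʳ bs ]′ split (left? as ⊎-dec right? bs)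
  where
  Left Right : List A → Set
  Left as′  = ∃ λ as₁ → as′ ≡ c ∷ as₁ × Interleaving as₁ bs cs
  Right bs′ = ∃ λ bs₁ → bs′ ≡ c ∷ bs₁ × Interleaving as bs₁ cs

  left? : ∀ as′ → Dec (Left as′)
  left? []        = no λ ()
  left? (a ∷ as₁) = map′ (λ { (refl , s) → as₁ , refl , s }) (λ { (_ , refl , s) → refl , s })
                         ((a ≟ c) ×-dec interleaving? _≟_ as₁ bs cs)

  right? : ∀ bs′ → Dec (Right bs′)
  right? []        = no λ ()
  right? (b ∷ bs₁) = map′ (λ { (refl , s) → bs₁ , refl , s }) (λ { (_ , refl , s) → refl , s })
                          ((b ≟ c) ×-dec interleaving? _≟_ as bs₁ cs)

  fromˡ : ∀ as′ → Left as′ → Interleaving as′ bs (c ∷ cs)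
  fromˡ _ (_ , refl , s) = consˡ s

  fromʳ : ∀ bs′ → Right bs′ → Interleaving as bs′ (c ∷ cs)
  fromʳ _ (_ , refl , s) = consʳ s

  split : Interleaving as bs (c ∷ cs) → Left as ⊎ Right bs
  split (refl ∷ˡ s) = inj₁ (_ , refl , s)
  split (refl ∷ʳ s) = inj₂ (_ , refl , s)

shift : ∀ {ℓ} → ℕ → List (Biletter ℓ) → List (Biletter ℓ)
shift p = List.map (Product.map₁ (p +_))

_∈_⋓_ : ∀ {ℓ} → ColoredPermutation ℓ → ColoredPermutation ℓ → ColoredPermutation ℓ → Set
w ∈ w′ ⋓ w″ = Interleaving (biword w′) (shift (size w′) (biword w″)) (biword w)

_∈?_⋓_ : ∀ {ℓ} (w w′ w″ : ColoredPermutation ℓ) → Dec (w ∈ w′ ⋓ w″)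
w ∈? w′ ⋓ w″ = interleaving? _≟ᵇ_ _ _ _

-- All pairs (w′ , w″) with w ∈ w′ ⋓ w″; their sizes add up to that of w.

unshuffles : ∀ {ℓ} → ColoredPermutation ℓ →
             List (ColoredPermutation ℓ × ColoredPermutation ℓ)
unshuffles w = List.filter (λ (w′ , w″) → w ∈? w′ ⋓ w″)
  (List.concatMap
    (λ p → List.cartesianProduct (coloredPermutations p) (coloredPermutations (size w ∸ p)))
    (List.upTo (suc (size w))))

Partite : ℕ → Set
Partite ℓ = Vec ℕ ℓ

∣_∣ : ∀ {ℓ} → Partite ℓ → ℕ
∣ n ∣ = Vec.sum n

HasContent : ∀ {ℓ m} → Partite ℓ → Vec (Fin ℓ) m → Set
HasContent n u = ∀ i → Vec.count (i Finₚ.≟_) u ≡ Vec.lookup n i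

hasContent? : ∀ {ℓ m} (n : Partite ℓ) (u : Vec (Fin ℓ) m) → Dec (HasContent n u)
hasContent? n u = Finₚ.all? λ i → Vec.count (i Finₚ.≟_) u ℕₚ.≟ Vec.lookup n i

-- All pairs (i , j) with i + j = n in ℕ^ℓ, each once.

decompositions : ∀ {ℓ} → Partite ℓ → List (Partite ℓ × Partite ℓ)
decompositions []      = ([] , []) ∷ []
decompositions (m ∷ n) =
  List.cartesianProductWith (λ k (i , j) → k ∷ i , (m ∸ k) ∷ j)
    (List.upTo (suc m)) (decompositions n)

-- A matrix with ℓ rows, given as the list of its columns.

record VectorComposition (ℓ : ℕ) : Set where
  field
    columns : List (Partite ℓ)
    nonzero : All (_≢ Vec.replicate ℓ 0) columns

open VectorComposition public

vectorCompositionDecSetoid : ℕ → DecSetoid 0ℓ 0ℓ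
vectorCompositionDecSetoid ℓ =
  On.decSetoid (≡.decSetoid (Listₚ.≡-dec (Vecₚ.≡-dec ℕₚ._≟_))) (columns {ℓ})

-- Free modules: finite formal linear combinations of elements of a
-- decidable setoid, two of them being equal when every basis element
-- has the same coefficient in both.

module FreeModule {c e} (K : CommutativeRing c e) where

  open CommutativeRing K hiding (_+_)
  private module K = CommutativeRing K

  Lin : ∀ {b} → Set b → Set (c ⊔ b)
  Lin B = List (Carrier × B)

  basis : ∀ {b} {B : Set b} → B → Lin B
  basis x = (1# , x) ∷ []

  infixr 7 _•_
  _•_ : ∀ {b} {B : Set b} → Carrier → Lin B → Lin B
  k • x = List.map (Product.map₁ (k *_)) x

  ∑ : ∀ {a b} {A : Set a} {B : Set b} → List A → (A → Lin B) → Lin B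
  ∑ xs f = List.concatMap f xs

  extend : ∀ {a b} {A : Set a} {B : Set b} → (A → Lin B) → Lin A → Lin B
  extend f x = ∑ x λ (k , a) → k • f a

  extend₂ : ∀ {a b d} {A : Set a} {B : Set b} {D : Set d} →
            (A → B → Lin D) → Lin A → Lin B → Lin D
  extend₂ f x y = extend (λ a → extend (f a) y) x

  -- The tensor product of the free modules on A and on B is the free
  -- module on A × B.

  infixr 7 _⊗_
  _⊗_ : ∀ {a b} {A : Set a} {B : Set b} → Lin A → Lin B → Lin (A × B)
  _⊗_ = extend₂ λ a b → basis (a , b)

  flip⊗ : ∀ {a b} {A : Set a} {B : Set b} → Lin (A × B) → Lin (B × A)
  flip⊗ = extend λ (a , b) → basis (b , a)

  module _ {b r} (B : DecSetoid b r) where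

    private module B = DecSetoid B

    coeff : Lin B.Carrier → B.Carrier → Carrier
    coeff []            y = 0#
    coeff ((k , x) ∷ l) y = (if does (x B.≟ y) then k else 0#) K.+ coeff l y

    freeModule : RawLeftModule Carrier (c ⊔ b) (e ⊔ b)
    freeModule = record
      { Carrierᴹ = Lin B.Carrier
      ; _≈ᴹ_     = λ l m → ∀ y → coeff l y ≈ coeff m y
      ; _+ᴹ_     = List._++_
      ; _*ₗ_     = _•_
      ; 0ᴹ       = []
      ; -ᴹ_      = (- 1#) •_
      }

-- A unital associative K-algebra, as a ring with a homomorphism from K
-- to its centre: the scalar action of k is multiplication by ι k.

record AssociativeAlgebra {c e} (K : CommutativeRing c e) (a b : Level) :
                          Set (c ⊔ e ⊔ lsuc (a ⊔ b)) where
  field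
    ring : Ring a b

  open Ring ring public
  private module K = CommutativeRing K

  field
    ι                    : K.Carrier → Carrier
    ι-isRingHomomorphism : RingMorphisms.IsRingHomomorphism K.rawRing rawRing ι
    ι-central            : ∀ k x → ι k * x ≈ x * ι k

module ColoredAlgebra {c e} (K : CommutativeRing c e) (ℓ : ℕ) where

  private module K = CommutativeRing K
  open FreeModule K public

  FQSymᴹ : RawLeftModule K.Carrier c e
  FQSymᴹ = freeModule (coloredPermutationDecSetoid ℓ)

  FQSym⊗FQSymᴹ : RawLeftModule K.Carrier c e
  FQSym⊗FQSymᴹ =
    freeModule (×-decSetoid (coloredPermutationDecSetoid ℓ) (coloredPermutationDecSetoid ℓ))

  open RawLeftModule FQSymᴹ public
    using () renaming (Carrierᴹ to FQSym; _≈ᴹ_ to infix 4 _≈_)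
  open RawLeftModule FQSym⊗FQSymᴹ public
    using () renaming (Carrierᴹ to FQSym⊗FQSym; _≈ᴹ_ to infix 4 _≈⊗_)

  G : ColoredPermutation ℓ → FQSym
  G = basis

  ∅ : ColoredPermutation ℓ
  ∅ = ⟨ idₚ {0} , [] ⟩

  𝟙 : FQSym
  𝟙 = G ∅

  infixl 7 _·_
  _·_ : FQSym → FQSym → FQSym
  _·_ = extend₂ λ w′ w″ →
    ∑ (convolution (perm w′) (perm w″)) λ σ → G ⟨ σ , colors w′ Vec.++ colors w″ ⟩

  Δ : FQSym → FQSym⊗FQSym
  Δ = extend λ w → ∑ (unshuffles w) λ (w′ , w″) → G w′ ⊗ G w″

  -- FQSym is graded connected, so the counit is the projection onto
  -- its component of degree 0, which is spanned by 𝟙.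

  ε : FQSym → K.Carrier
  ε x = coeff (coloredPermutationDecSetoid ℓ) x ∅

  record IsAntipode (A : FQSym → FQSym) : Set (c ⊔ e) where
    field
      linear   : LeftModuleMorphisms.IsLeftModuleHomomorphism FQSymᴹ FQSymᴹ A
      inverseˡ : ∀ x → extend (λ (w′ , w″) → A (G w′) · G w″) (Δ x) ≈ ε x • 𝟙
      inverseʳ : ∀ x → extend (λ (w′ , w″) → G w′ · A (G w″)) (Δ x) ≈ ε x • 𝟙

  S : Partite ℓ → FQSym
  S n = ∑ (List.filter (hasContent? n) (words ∣ n ∣)) λ u → G ⟨ idₚ , u ⟩

  S^ : VectorComposition ℓ → FQSym
  S^ I = List.foldr (λ i x → S i · x) 𝟙 (columns I)

  infix 4 _∈Sym
  data _∈Sym : FQSym → Set (c ⊔ e) where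
    S∈   : ∀ n → S n ∈Sym
    𝟙∈   : 𝟙 ∈Sym
    0∈   : [] ∈Sym
    +∈   : ∀ {x y} → x ∈Sym → y ∈Sym → x List.++ y ∈Sym
    •∈   : ∀ k {x} → x ∈Sym → k • x ∈Sym
    ·∈   : ∀ {x y} → x ∈Sym → y ∈Sym → x · y ∈Sym
    resp : ∀ {x y} → x ≈ y → x ∈Sym → y ∈Sym

  Sym : Set (c ⊔ e)
  Sym = ∃ _∈Sym

  Sym-rawRing : RawRing (c ⊔ e) e
  Sym-rawRing = record
    { Carrier = Sym
    ; _≈_     = λ x y → proj₁ x ≈ proj₁ y
    ; _+_     = λ (x , x∈) (y , y∈) → x List.++ y , +∈ x∈ y∈
    ; _*_     = λ (x , x∈) (y , y∈) → x · y , ·∈ x∈ y∈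
    ; -_      = λ (x , x∈) → (K.- K.1#) • x , •∈ (K.- K.1#) x∈
    ; 0#      = [] , 0∈
    ; 1#      = 𝟙 , 𝟙∈
    }

  record IsAlgebraHomomorphism {a b} (A : AssociativeAlgebra K a b)
                               (φ : Sym → AssociativeAlgebra.Carrier A) :
                               Set (c ⊔ e ⊔ b) where
    private module A = AssociativeAlgebra A
    field
      isRingHomomorphism : RingMorphisms.IsRingHomomorphism Sym-rawRing A.rawRing φ
      •-homo             : ∀ k x (x∈ : x ∈Sym) → φ (k • x , •∈ k x∈) A.≈ A.ι k A.* φ (x , x∈)

  -- Universal property of the free associative algebra, against test
  -- algebras whose carrier and equality live at levels a and b.

  SymIsFree : ∀ a b → Set (c ⊔ e ⊔ lsuc (a ⊔ b))
  SymIsFree a b =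
    (A : AssociativeAlgebra K a b) → let module A = AssociativeAlgebra A in
    (f : (n : Partite ℓ) → 0 < ∣ n ∣ → A.Carrier) →
    let Extends = λ (φ : Sym → A.Carrier) →
          IsAlgebraHomomorphism A φ × (∀ n (n>0 : 0 < ∣ n ∣) → φ (S n , S∈ n) A.≈ f n n>0)
    in ∃ λ φ → Extends φ × (∀ ψ → Extends ψ → ∀ x → ψ x A.≈ φ x)

  record IsLinearBasisOfSym {i r} (I : DecSetoid i r) (v : DecSetoid.Carrier I → FQSym) :
                            Set (c ⊔ e ⊔ i) where
    open RawLeftModule (freeModule I) using () renaming (_≈ᴹ_ to _≈ᴵ_)
    field
      member      : ∀ j → v j ∈Sym
      independent : ∀ x → extend v x ≈ [] → x ≈ᴵ []
      spanning    : ∀ y → y ∈Sym → ∃ λ x → y ≈ extend v x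

  -- Sym ⊗ Sym is viewed inside FQSym ⊗ FQSym.  FQSym has exactly one
  -- antipode, so quantifying over A only names it.

  record SymIsHopfSubalgebra : Set (c ⊔ e) where
    field
      Δ-closed        : ∀ x → x ∈Sym → ∃ λ (l : List (Sym × Sym)) →
                        Δ x ≈⊗ ∑ l λ ((y , _) , (z , _)) → y ⊗ z
      antipode-closed : ∀ A → IsAntipode A → ∀ x → x ∈Sym → A x ∈Sym

{-# OPTIONS --safe #-}
module Submission where

-- A word with distinct letters standardizes to a colored permutation, so an element x of
-- FQSym extends to a function ⟦ x ⟧ on such words that depends only on the colors and on the
-- relative order of the letters.  In terms of these functions the product of FQSym is dual to
-- deconcatenation and its coproduct is dual to the shuffle of a word with a higher one, and the
-- two are compatible.  Moreover ⟦ S n ⟧ is the indicator of the increasing words of content n;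
-- the only increasing shuffle of v with a higher word u is v u, which gives Δ (S n), and then
-- Δ (S^ I) as the sum of all S^ A ⊗ S^ B with A + B = I.  Finally S^ I is the indicator of the
-- concatenations of increasing words with contents I, which makes the family (S^ I)
-- unitriangular with respect to descent sets, hence linearly independent.

open import Defs
open import Algebra.Bundles using (CommutativeRing; Ring)
open import Algebra.Module.Morphism.Structures using (module LeftModuleMorphisms)
open import Algebra.Morphism.Construct.Identity using (isRingHomomorphism)
open import Algebra.Morphism.Structures using (module RingMorphisms)
import Algebra.Properties.CommutativeMonoid.Sum as CommutativeMonoidSum
import Algebra.Properties.CommutativeSemigroup as CommutativeSemigroupProperties
import Algebra.Properties.Ring as RingProperties
import Algebra.Solver.CommutativeMonoid as CommutativeMonoidSolver
open import Data.Bool.Base using (Bool; true; false; not; if_then_else_; T)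
import Data.Bool.Properties as Boolₚ
open import Data.Empty using (⊥)
open import Data.Fin.Base as Fin using (Fin; toℕ; fromℕ<; punchIn; _↑ˡ_; _↑ʳ_)
open import Data.Fin.Permutation as Permutation using (Permutation′; _⟨$⟩ʳ_; _⟨$⟩ˡ_; insert)
  renaming (id to idₚ)
import Data.Fin.Properties as Finₚ
open import Data.List.Base as List
  using (List; []; _∷_; _++_; map; concatMap; cartesianProductWith; cartesianProduct;
         filter; tabulate; length; zipWith; take; drop)
import Data.List.Properties as Listₚ
open import Data.List.Membership.Propositional using (_∈_)
open import Data.List.Membership.Propositional.Properties
  using (∈-allFin; ∈-map⁺; ∈-map⁻; ∈-++⁺ˡ; ∈-++⁺ʳ; ∈-++⁻; ∈-upTo⁺; ∈-upTo⁻; ∈-filter⁻;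
         ∈-cartesianProductWith⁻)
open import Data.List.Relation.Binary.Permutation.Propositional as Perm using (_↭_)
import Data.List.Relation.Binary.Permutation.Propositional.Properties as Permₚ
import Data.List.Relation.Binary.Permutation.Setoid.Properties as SetoidPermₚ
open import Data.List.Relation.Ternary.Interleaving.Propositional
  using (Interleaving; []; consˡ; consʳ; toPermutation)
open import Data.List.Relation.Unary.All as All using (All; []; _∷_)
import Data.List.Relation.Unary.All.Properties as Allₚ
open import Data.List.Relation.Unary.AllPairs as AllPairs using (AllPairs; []; _∷_; allPairs?)
import Data.List.Relation.Unary.AllPairs.Properties as AllPairsₚ
open import Data.List.Relation.Unary.Any using (here; there)
open import Data.List.Relation.Unary.Unique.Propositional using (Unique)
import Data.List.Relation.Unary.Unique.Propositional.Properties as Uniqueₚ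
open import Data.Nat.Base as ℕ using (ℕ; zero; suc; _∸_; _≤_; _<_; z≤n; s≤s; s≤s⁻¹)
import Data.Nat.Properties as ℕₚ
open import Data.Product.Base as Product using (∃; _×_; _,_; proj₁; proj₂)
import Data.Product.Properties as Productₚ
open import Data.Product.Relation.Binary.Pointwise.NonDependent using (×-decSetoid)
open import Data.Sum.Base using (_⊎_; inj₁; inj₂)
open import Data.Unit.Base using (⊤; tt)
open import Data.Vec.Base as Vec using (Vec; []; _∷_)
import Data.Vec.Properties as Vecₚ
open import Function.Base using (_∘_; id)
open import Function.Bundles using (_⇔_; mk⇔)
open import Function.Definitions using (Injective)
open import Level using (_⊔_)
open import Relation.Binary.Bundles using (DecSetoid)
open import Relation.Binary.Definitions using (Decidable; tri<; tri≈; tri>)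
open import Relation.Binary.PropositionalEquality as ≡ using (_≡_; _≢_; _≗_)
import Relation.Binary.Reasoning.Setoid as SetoidReasoning
open import Relation.Nullary using (¬_; Dec; yes; no; does; contradiction; ¬?)
open import Relation.Nullary.Decidable using (does-⇔; dec-true; dec-false; _×-dec_)

-- The detour through words is forced by the product: a factor of a permutation is not a
-- permutation, and standardizing it at every cut would have to be tracked through all products and
-- shuffles. Comparing words only by the relative order of their letters avoids this, since factors
-- and shifted copies of words with distinct letters are again such words. Each enumeration behind a
-- structure constant then has at most one relevant entry, so sums collapse to single terms.
--
-- The ring `K` is arbitrary, so independence has to come from values 1 and 0 on test words, not
-- from a dimension count. Freeness then follows from the basis: S^I times S^J is S^ of the
-- concatenation, and unique expansions identify Sym with the free algebra on the nonzero columns.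
--
-- The antipode enters as an arbitrary solution `A` of its equations. At S^I the left equation
-- contains A (S^I) in one term only, and all other terms involve `A` at smaller weight, so closure
-- is an induction on weight.

module Combinatorics where

  open CommutativeMonoidSum ℕₚ.+-0-commutativeMonoid using (sum; sum-permute)
  open ≡ using (refl; sym; trans; cong; cong₂; subst; module ≡-Reasoning)
  open import Data.Nat.Base using (_+_; _<ᵇ_)

  -- Enumerations with exactly one matching entry

  -- Expresses that an enumeration is complete and without repetition. A predicate takes the place
  -- of an element because permutations are compared only through their words, never by `≡`.
  data Once {a p} {A : Set a} (P : A → Set p) : List A → Set (a ⊔ p) where
    here  : ∀ {x xs} → P x → All (¬_ ∘ P) xs → Once P (x ∷ xs)
    there : ∀ {x xs} → ¬ P x → Once P xs → Once P (x ∷ xs)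

  module _ {a p} {A : Set a} {P : A → Set p} where

    once-∃ : ∀ {xs} → Once P xs → ∃ P
    once-∃ (here px _) = _ , px
    once-∃ (there _ o) = once-∃ o

    once-⇔ : ∀ {q} {Q : A → Set q} {xs} → (∀ {x} → P x → Q x) → (∀ {x} → Q x → P x) →
             Once P xs → Once Q xs
    once-⇔ to from (here px ¬p) = here (to px) (All.map (_∘ from) ¬p)
    once-⇔ to from (there ¬p o) = there (¬p ∘ from) (once-⇔ to from o)

    once-++ˡ : ∀ {xs ys} → Once P xs → All (¬_ ∘ P) ys → Once P (xs ++ ys)
    once-++ˡ (here px ¬p) ¬q = here px (Allₚ.++⁺ ¬p ¬q)
    once-++ˡ (there ¬p o) ¬q = there ¬p (once-++ˡ o ¬q)

    once-++ʳ : ∀ {xs ys} → All (¬_ ∘ P) xs → Once P ys → Once P (xs ++ ys)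
    once-++ʳ []        o = o
    once-++ʳ (¬p ∷ ¬q) o = there ¬p (once-++ʳ ¬q o)

    once-map : ∀ {b} {B : Set b} {f : B → A} {xs} → Once (P ∘ f) xs → Once P (map f xs)
    once-map (here px ¬p) = here px (Allₚ.map⁺ ¬p)
    once-map (there ¬p o) = there ¬p (once-map o)

    once-concatMap : ∀ {b q} {B : Set b} {Q : B → Set q} {f : B → List A} {xs} → Once Q xs →
                     (∀ {x} → Q x → Once P (f x)) → (∀ {x} → ¬ Q x → All (¬_ ∘ P) (f x)) →
                     Once P (concatMap f xs)
    once-concatMap {f = f} (here qx ¬q) yes! no! =
      once-++ˡ (yes! qx) (Allₚ.concat⁺ (Allₚ.map⁺ (All.map no! ¬q)))
    once-concatMap (there ¬q o) yes! no! = once-++ʳ (no! ¬q) (once-concatMap o yes! no!)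

  module _ {a b c} {A : Set a} {B : Set b} {C : Set c} (f : A → B → C) where

    all-cartesianProductWith : ∀ {p q r} {P : A → Set p} {Q : B → Set q} {R : C → Set r} →
      (∀ {x y} → P x → Q y → R (f x y)) → ∀ {xs ys} → All P xs → All Q ys →
      All R (cartesianProductWith f xs ys)
    all-cartesianProductWith h []         qs = []
    all-cartesianProductWith h (px ∷ ps) qs =
      Allₚ.++⁺ (Allₚ.map⁺ (All.map (h px) qs)) (all-cartesianProductWith h ps qs)

    once-cartesianProductWith : ∀ {p q r} {P : A → Set p} {Q : B → Set q} {R : C → Set r} →
      (∀ {x y} → P x → Q y → R (f x y)) → (∀ {x y} → R (f x y) → P x × Q y) →
      ∀ {xs ys} → Once P xs → Once Q ys → Once R (cartesianProductWith f xs ys)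
    once-cartesianProductWith to from {ys = ys} (here px ¬p) o =
      once-++ˡ (once-map (once-⇔ (to px) (proj₂ ∘ from) o))
        (all-cartesianProductWith (λ ¬px _ → ¬px ∘ proj₁ ∘ from) ¬p (All.tabulate {xs = ys} λ z → z))
    once-cartesianProductWith to from {ys = ys} (there ¬p os) o =
      once-++ʳ (Allₚ.map⁺ (All.tabulate {xs = ys} λ _ → ¬p ∘ proj₁ ∘ from))
        (once-cartesianProductWith to from os o)

  unique⇒once : ∀ {a} {A : Set a} {x : A} {xs} → Unique xs → x ∈ xs → Once (x ≡_) xs
  unique⇒once (x∉xs ∷ _) (here refl) = here refl x∉xs
  unique⇒once (x∉xs ∷ u) (there x∈xs) =
    there (λ { refl → All.lookup x∉xs x∈xs refl }) (unique⇒once u x∈xs)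

  -- Relative order of letters: shapes, ranks and standardization

  <ᵇ-true : ∀ {m n} → m < n → (m <ᵇ n) ≡ true
  <ᵇ-true {m} {n} = dec-true (m ℕₚ.<? n)

  <ᵇ-false : ∀ {m n} → n ≤ m → (m <ᵇ n) ≡ false
  <ᵇ-false {m} {n} n≤m = dec-false (m ℕₚ.<? n) (ℕₚ.≤⇒≯ n≤m)

  <ᵇ⁻ : ∀ {m n} → (m <ᵇ n) ≡ true → m < n
  <ᵇ⁻ {m} {n} eq = ℕₚ.<ᵇ⇒< m n (subst T (sym eq) tt)

  <ᵇ-⇔ : ∀ {m n o p} → m < n ⇔ o < p → (m <ᵇ n) ≡ (o <ᵇ p)
  <ᵇ-⇔ e = does-⇔ e (_ ℕₚ.<? _) (_ ℕₚ.<? _)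

  <ᵇ-⇔⁻ : ∀ {m n o p} → (m <ᵇ n) ≡ (o <ᵇ p) → m < n ⇔ o < p
  <ᵇ-⇔⁻ eq = mk⇔ (λ lt → <ᵇ⁻ (trans (sym eq) (<ᵇ-true lt))) (λ lt → <ᵇ⁻ (trans eq (<ᵇ-true lt)))

  <ᵇ-flip : ∀ {m n} → m ≢ n → (n <ᵇ m) ≡ not (m <ᵇ n)
  <ᵇ-flip {m} {n} m≢n with ℕₚ.<-cmp m n
  ... | tri< lt _ _ rewrite <ᵇ-true lt = <ᵇ-false (ℕₚ.<⇒≤ lt)
  ... | tri≈ _ eq _ = contradiction eq m≢n
  ... | tri> _ _ gt rewrite <ᵇ-false (ℕₚ.<⇒≤ gt) = <ᵇ-true gt

  -- Both directions are recorded so that the shape determines the ranks even when letters repeat.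
  side : ℕ → ℕ → Bool × Bool
  side a x = (x <ᵇ a) , (a <ᵇ x)

  -- Two words have the same shape when their letters compare in the same
  -- way at every pair of positions; for words without repeated letters,
  -- when they have the same standardization.
  shape : List ℕ → List (List (Bool × Bool))
  shape []      = []
  shape (a ∷ l) = map (side a) l ∷ shape l

  map-++-injective : ∀ {A B : Set} {f g : A → B} l₁ m₁ {l₂ m₂} → length l₁ ≡ length m₁ →
                     map f (l₁ ++ l₂) ≡ map g (m₁ ++ m₂) → map f l₁ ≡ map g m₁
  map-++-injective []       []       len eq = refl
  map-++-injective (x ∷ l₁) (y ∷ m₁) len eq =
    cong₂ _∷_ (Listₚ.∷-injectiveˡ eq)
      (map-++-injective l₁ m₁ (ℕₚ.suc-injective len) (Listₚ.∷-injectiveʳ eq))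

  -- Comparisons across the two blocks are discarded. This loss is what makes the convolution a sum
  -- over many permutations and its dual a plain cut.
  shape-++ : ∀ l₁ m₁ {l₂ m₂} → length l₁ ≡ length m₁ → shape (l₁ ++ l₂) ≡ shape (m₁ ++ m₂) →
             shape l₁ ≡ shape m₁ × shape l₂ ≡ shape m₂
  shape-++ []       []       len eq = refl , eq
  shape-++ (x ∷ l₁) (y ∷ m₁) len eq =
    Product.map₁
      (cong₂ _∷_ (map-++-injective l₁ m₁ (ℕₚ.suc-injective len) (Listₚ.∷-injectiveˡ eq)))
      (shape-++ l₁ m₁ (ℕₚ.suc-injective len) (Listₚ.∷-injectiveʳ eq))

  shape-map : ∀ (f : ℕ → ℕ) → (∀ x y → (f x <ᵇ f y) ≡ (x <ᵇ y)) → ∀ l → shape (map f l) ≡ shape l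
  shape-map f mono []      = refl
  shape-map f mono (a ∷ l) = cong₂ _∷_
    (trans (sym (Listₚ.map-∘ l)) (Listₚ.map-cong (λ x → cong₂ _,_ (mono x a) (mono a x)) l))
    (shape-map f mono l)

  indicator : Bool → ℕ
  indicator b = if b then 1 else 0

  trues : List Bool → ℕ
  trues []       = 0
  trues (b ∷ bs) = indicator b + trues bs

  rank : ℕ → List ℕ → ℕ
  rank x l = trues (map (_<ᵇ x) l)

  -- For distinct letters this is the one-line word of the standardization, counted from 0.
  ranks : List ℕ → List ℕ
  ranks l = map (λ x → rank x l) l

  map-zipWith : ∀ {A B C D : Set} (f : B → C → D) (g : A → B) (h : A → C) l →
                map (λ x → f (g x) (h x)) l ≡ zipWith f (map g l) (map h l)
  map-zipWith f g h []      = refl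
  map-zipWith f g h (x ∷ l) = cong (_ ∷_) (map-zipWith f g h l)

  indicator-irrefl : ∀ a → indicator (a <ᵇ a) ≡ 0
  indicator-irrefl a = cong indicator (<ᵇ-false (ℕₚ.≤-refl {a}))

  -- The rank of a letter counts the smaller letters to its left and to its right, and the shape
  -- contains both kinds of comparison.
  shape⇒ranks : ∀ l m → shape l ≡ shape m → ranks l ≡ ranks m
  shape⇒ranks []      []      eq = refl
  shape⇒ranks (a ∷ l) (b ∷ m) eq = cong₂ _∷_
    (cong₂ _+_ (trans (indicator-irrefl a) (sym (indicator-irrefl b)))
      (begin
        trues (map (_<ᵇ a) l)               ≡⟨ cong trues (Listₚ.map-∘ l) ⟩
        trues (map proj₁ (map (side a) l))  ≡⟨ cong (trues ∘ map proj₁) sides ⟩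
        trues (map proj₁ (map (side b) m))  ≡⟨ cong trues (Listₚ.map-∘ m) ⟨
        trues (map (_<ᵇ b) m)               ∎))
    (begin
      -- A letter `x` of the tail counts the head `a` exactly when the second entry of its side is
      -- true.
      map (λ x → indicator (a <ᵇ x) + rank x l) l  ≡⟨ map-zipWith f (side a) _ l ⟩
      zipWith f (map (side a) l) (ranks l)         ≡⟨ cong₂ (zipWith f) sides (shape⇒ranks l m (Listₚ.∷-injectiveʳ eq)) ⟩
      zipWith f (map (side b) m) (ranks m)         ≡⟨ map-zipWith f (side b) _ m ⟨
      map (λ x → indicator (b <ᵇ x) + rank x m) m  ∎)
    where
    open ≡-Reasoning
    sides = Listₚ.∷-injectiveˡ eq
    f : Bool × Bool → ℕ → ℕ
    f s r = indicator (proj₂ s) + r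

  indicator-mono : ∀ z {x y} → x ≤ y → indicator (z <ᵇ x) ≤ indicator (z <ᵇ y)
  indicator-mono z {x} {y} x≤y with z <ᵇ x in eq
  ... | false = z≤n
  ... | true rewrite <ᵇ-true (ℕₚ.<-≤-trans (<ᵇ⁻ {z} {x} eq) x≤y) = s≤s z≤n

  rank-mono : ∀ {x y} l → x ≤ y → rank x l ≤ rank y l
  rank-mono []      x≤y = z≤n
  rank-mono (z ∷ l) x≤y = ℕₚ.+-mono-≤ (indicator-mono z x≤y) (rank-mono l x≤y)

  -- The strict inequality comes from `x` itself, which is counted for `y` but not for `x`.
  rank-mono-< : ∀ {x y l} → x ∈ l → x < y → rank x l < rank y l
  rank-mono-< {x} {l = _ ∷ l} (here refl) x<y
    rewrite <ᵇ-true x<y | <ᵇ-false (ℕₚ.≤-refl {x}) = s≤s (rank-mono l (ℕₚ.<⇒≤ x<y))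
  rank-mono-< {l = z ∷ _} (there x∈l) x<y =
    ℕₚ.+-mono-≤-< (indicator-mono z (ℕₚ.<⇒≤ x<y)) (rank-mono-< x∈l x<y)

  rank-<ᵇ : ∀ {x y l} → x ∈ l → (rank x l <ᵇ rank y l) ≡ (x <ᵇ y)
  rank-<ᵇ {x} {y} {l} x∈l = <ᵇ-⇔ {rank x l} {rank y l} {x} {y} (mk⇔ (λ lt → ℕₚ.≰⇒> (ℕₚ.<⇒≱ lt ∘ rank-mono l)) (rank-mono-< x∈l))

  indicator-≤1 : ∀ b → indicator b ≤ 1
  indicator-≤1 true  = s≤s z≤n
  indicator-≤1 false = z≤n

  rank-≤-length : ∀ x l → rank x l ≤ length l
  rank-≤-length x []      = z≤n
  rank-≤-length x (y ∷ l) = ℕₚ.+-mono-≤ (indicator-≤1 (y <ᵇ x)) (rank-≤-length x l)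

  oneLine : ∀ {n} → Permutation′ n → List ℕ
  oneLine σ = tabulate λ i → toℕ (σ ⟨$⟩ʳ i)

  ⟨$⟩ʳ-injective : ∀ {n} (σ : Permutation′ n) → Injective _≡_ _≡_ (σ ⟨$⟩ʳ_)
  ⟨$⟩ʳ-injective σ eq = trans (sym (Permutation.inverseˡ σ)) (trans (cong (σ ⟨$⟩ˡ_) eq) (Permutation.inverseˡ σ))

  unique-oneLine : ∀ {n} (σ : Permutation′ n) → Unique (oneLine σ)
  unique-oneLine σ = Uniqueₚ.tabulate⁺ (⟨$⟩ʳ-injective σ ∘ Finₚ.toℕ-injective)

  rank-tabulate : ∀ x {n} (f : Fin n → ℕ) → rank x (tabulate f) ≡ sum (λ i → indicator (f i <ᵇ x))
  rank-tabulate x {zero}  f = refl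
  rank-tabulate x {suc n} f = cong (indicator (f Fin.zero <ᵇ x) +_) (rank-tabulate x (f ∘ Fin.suc))

  sum-indicator : ∀ {n x} → x ≤ n → sum {n} (λ i → indicator (toℕ i <ᵇ x)) ≡ x
  sum-indicator {zero}  z≤n       = refl
  sum-indicator {suc n} z≤n       = sum-indicator {n} z≤n
  sum-indicator {suc n} (s≤s x≤n) = cong suc (sum-indicator x≤n)

  -- A permutation only reorders the letters below `n`, of which exactly `x` are smaller than `x`.
  rank-oneLine : ∀ {n} (σ : Permutation′ n) {x} → x ≤ n → rank x (oneLine σ) ≡ x
  rank-oneLine {n} σ {x} x≤n = begin
    rank x (oneLine σ)                                ≡⟨ rank-tabulate x (λ i → toℕ (σ ⟨$⟩ʳ i)) ⟩
    sum (λ i → indicator (toℕ (σ ⟨$⟩ʳ i) <ᵇ x))       ≡⟨ sum-permute (λ i → indicator (toℕ i <ᵇ x)) σ ⟨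
    sum {n} (λ i → indicator (toℕ i <ᵇ x))            ≡⟨ sum-indicator {n} x≤n ⟩
    x                                                 ∎
    where open ≡-Reasoning

  -- Among words with distinct letters, these are the ones equal to their own standardization. On
  -- them the shape is a complete invariant.
  Ranked : List ℕ → Set
  Ranked l = ranks l ≡ l

  ranked-oneLine : ∀ {n} (σ : Permutation′ n) → Ranked (oneLine σ)
  ranked-oneLine σ = trans (Listₚ.map-tabulate _ _)
    (Listₚ.tabulate-cong λ i → rank-oneLine σ (ℕₚ.<⇒≤ (Finₚ.toℕ<n (σ ⟨$⟩ʳ i))))

  shape-injective : ∀ {l m} → Ranked l → Ranked m → shape l ≡ shape m → l ≡ m
  shape-injective {l} {m} rl rm eq = trans (sym rl) (trans (shape⇒ranks l m eq) rm)

  punch : ℕ → ℕ → ℕ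
  punch j x = if x <ᵇ j then x else suc x

  toℕ-punchIn : ∀ {n} (j : Fin (suc n)) i → toℕ (punchIn j i) ≡ punch (toℕ j) (toℕ i)
  toℕ-punchIn Fin.zero    i           = refl
  toℕ-punchIn (Fin.suc j) Fin.zero    = refl
  toℕ-punchIn (Fin.suc j) (Fin.suc i) with toℕ i <ᵇ toℕ j | toℕ-punchIn j i
  ... | true  | eq = cong suc eq
  ... | false | eq = cong suc eq

  punch-mono : ∀ j x y → (punch j x <ᵇ punch j y) ≡ (x <ᵇ y)
  punch-mono j x y with x <ᵇ j in eqx | y <ᵇ j in eqy
  ... | true  | true  = refl
  ... | false | false = refl
  ... | true  | false = trans (<ᵇ-true (ℕₚ.m≤n⇒m≤1+n x<y)) (sym (<ᵇ-true x<y))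
    where
    x<y : x < y
    x<y = ℕₚ.<-≤-trans (<ᵇ⁻ {x} {j} eqx)
            (ℕₚ.≮⇒≥ λ y<j → contradiction (trans (sym (<ᵇ-true y<j)) eqy) λ ())
  ... | false | true  = trans (<ᵇ-false (ℕₚ.m≤n⇒m≤1+n (ℕₚ.<⇒≤ y<x))) (sym (<ᵇ-false (ℕₚ.<⇒≤ y<x)))
    where
    y<x : y < x
    y<x = ℕₚ.<-≤-trans (<ᵇ⁻ {y} {j} eqy)
            (ℕₚ.≮⇒≥ λ x<j → contradiction (trans (sym (<ᵇ-true x<j)) eqx) λ ())

  side-punch : ∀ j x → side j (punch j x) ≡ ((x <ᵇ j) , not (x <ᵇ j))
  side-punch j x with x <ᵇ j in eq
  ... | true  = cong₂ _,_ eq (<ᵇ-false (ℕₚ.<⇒≤ (<ᵇ⁻ {x} {j} eq)))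
  ... | false = cong₂ _,_ (<ᵇ-false (ℕₚ.m≤n⇒m≤1+n j≤x)) (<ᵇ-true (s≤s j≤x))
    where
    j≤x : j ≤ x
    j≤x = ℕₚ.≮⇒≥ λ x<j → contradiction (trans (sym (<ᵇ-true x<j)) eq) λ ()

  oneLine-insert : ∀ {n} (j : Fin (suc n)) (σ : Permutation′ n) →
                   oneLine (insert Fin.zero j σ) ≡ toℕ j ∷ map (punch (toℕ j)) (oneLine σ)
  oneLine-insert j σ = cong (toℕ j ∷_)
    (trans (Listₚ.tabulate-cong λ i → toℕ-punchIn j (σ ⟨$⟩ʳ i)) (sym (Listₚ.map-tabulate _ _)))

  map-cong-∈ : ∀ {A B : Set} {f g : A → B} l → (∀ {x} → x ∈ l → f x ≡ g x) → map f l ≡ map g l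
  map-cong-∈ []      h = refl
  map-cong-∈ (x ∷ l) h = cong₂ _∷_ (h (here refl)) (map-cong-∈ l (h ∘ there))

  private
    complement : Bool → Bool × Bool
    complement b = b , not b

    -- Distinct letters make the two comparisons of a side complementary, so the first letter
    -- contributes only the list telling which later letters are smaller.
    shape-insert : ∀ {n} (j : Fin (suc n)) (σ : Permutation′ n) →
      shape (oneLine (insert Fin.zero j σ)) ≡
      map complement (map (_<ᵇ toℕ j) (oneLine σ)) ∷ shape (oneLine σ)
    shape-insert j σ = trans (cong shape (oneLine-insert j σ)) (cong₂ _∷_
      (trans (sym (Listₚ.map-∘ (oneLine σ)))
        (trans (Listₚ.map-cong (side-punch (toℕ j)) (oneLine σ)) (Listₚ.map-∘ (oneLine σ))))
      (shape-map _ (punch-mono (toℕ j)) (oneLine σ)))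

    shape-unique : ∀ {x l} → All (x ≢_) l →
      shape (x ∷ l) ≡ map complement (map (_<ᵇ x) l) ∷ shape l
    shape-unique {x} {l} x∉l = cong (_∷ shape l) (trans
      (map-cong-∈ l λ {y} y∈l → cong ((y <ᵇ x) ,_) (<ᵇ-flip (All.lookup x∉l y∈l ∘ sym)))
      (Listₚ.map-∘ l))

  -- The unique permutation with the shape of l is the standardization of l.
  once-standardization : ∀ n l → Unique l → length l ≡ n →
    Once (λ (σ : Permutation′ n) → shape (oneLine σ) ≡ shape l) (permutations n)
  once-standardization zero    []      u       len = here refl []
  -- The first letter is forced to be the rank of `x` in `l`, and what remains must standardize `l`.
  once-standardization (suc n) (x ∷ l) (x∉l ∷ u) len = once-cartesianProductWith (insert Fin.zero)
    (λ {j} {σ} j≡ eq → trans (shape-insert j σ) (trans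
      (cong₂ (λ r s → map complement r ∷ s) (compare j σ j≡ eq) eq) (sym (shape-unique x∉l))))
    (λ {j} {σ} eq → let eq′ = trans (sym (shape-insert j σ)) (trans eq (shape-unique x∉l)) in
      -- `j` is recovered from its comparisons with the letters of `σ`, because exactly `toℕ j` of
      -- these are smaller.
      Finₚ.toℕ-injective (trans (Finₚ.toℕ-fromℕ< r<) (rank-determines j σ (begin
        map (_<ᵇ toℕ j) (oneLine σ)                              ≡⟨ uncomplement (map (_<ᵇ toℕ j) (oneLine σ)) ⟩
        map proj₁ (map complement (map (_<ᵇ toℕ j) (oneLine σ))) ≡⟨ cong (map proj₁) (Listₚ.∷-injectiveˡ eq′) ⟩
        map proj₁ (map complement (map (_<ᵇ x) l))               ≡⟨ uncomplement (map (_<ᵇ x) l) ⟨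
        map (_<ᵇ x) l                                            ∎)))
      , Listₚ.∷-injectiveʳ eq′)
    (unique⇒once (Uniqueₚ.allFin⁺ (suc n)) (∈-allFin (fromℕ< r<)))
    (once-standardization n l u (ℕₚ.suc-injective len))
    where
    open ≡-Reasoning
    r< : rank x l < suc n
    r< = s≤s (subst (rank x l ≤_) (ℕₚ.suc-injective len) (rank-≤-length x l))

    uncomplement : ∀ bs → bs ≡ map proj₁ (map complement bs)
    uncomplement bs = trans (sym (Listₚ.map-id bs)) (Listₚ.map-∘ bs)

    compare : ∀ j σ → fromℕ< r< ≡ j → shape (oneLine σ) ≡ shape l →
              map (_<ᵇ toℕ j) (oneLine σ) ≡ map (_<ᵇ x) l
    compare j σ refl eq = begin
      map (_<ᵇ toℕ (fromℕ< r<)) (oneLine σ)  ≡⟨ cong (λ r → map (_<ᵇ r) (oneLine σ)) (Finₚ.toℕ-fromℕ< r<) ⟩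
      map (_<ᵇ rank x l) (oneLine σ)         ≡⟨ cong (map _) (trans (sym (ranked-oneLine σ)) (shape⇒ranks _ _ eq)) ⟩
      map (_<ᵇ rank x l) (ranks l)           ≡⟨ Listₚ.map-∘ l ⟨
      map (λ y → rank y l <ᵇ rank x l) l     ≡⟨ map-cong-∈ l (λ {y} y∈l → rank-<ᵇ {y} {x} y∈l) ⟩
      map (_<ᵇ x) l                          ∎

    rank-determines : ∀ (j : Fin (suc n)) (σ : Permutation′ n) →
                      map (_<ᵇ toℕ j) (oneLine σ) ≡ map (_<ᵇ x) l → rank x l ≡ toℕ j
    rank-determines j σ eq = trans (sym (cong trues eq)) (rank-oneLine σ (s≤s⁻¹ (Finₚ.toℕ<n j)))

  tabulate-injective : ∀ {A : Set} {n} {f g : Fin n → A} → tabulate f ≡ tabulate g → f ≗ g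
  tabulate-injective eq Fin.zero    = Listₚ.∷-injectiveˡ eq
  tabulate-injective eq (Fin.suc i) = tabulate-injective (Listₚ.∷-injectiveʳ eq) i

  -- Inversions compare in one direction only. Injectivity excludes ties, so the failure of one
  -- strict comparison is the opposite one, which the shape also records.
  sameInversions⇒shape : ∀ {k m n} {f : Fin k → Fin m} {g : Fin k → Fin n} →
    Injective _≡_ _≡_ f → Injective _≡_ _≡_ g → SameInversions f g →
    shape (tabulate (toℕ ∘ f)) ≡ shape (tabulate (toℕ ∘ g))
  sameInversions⇒shape {zero}  fi gi inv = refl
  sameInversions⇒shape {suc k} {f = f} {g} fi gi inv = cong₂ _∷_
    (trans (Listₚ.map-tabulate _ _) (trans (Listₚ.tabulate-cong sides) (sym (Listₚ.map-tabulate _ _))))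
    (sameInversions⇒shape (Finₚ.suc-injective ∘ fi) (Finₚ.suc-injective ∘ gi)
      λ i j i<j → inv (Fin.suc i) (Fin.suc j) (s≤s i<j))
    where
    apart : ∀ {n} {h : Fin (suc k) → Fin n} → Injective _≡_ _≡_ h → ∀ i →
            toℕ (h (Fin.suc i)) ≢ toℕ (h Fin.zero)
    apart hi i eq with hi (Finₚ.toℕ-injective eq)
    ... | ()

    sides : ∀ i → side (toℕ (f Fin.zero)) (toℕ (f (Fin.suc i))) ≡ side (toℕ (g Fin.zero)) (toℕ (g (Fin.suc i)))
    sides i = cong₂ _,_ lt (trans (<ᵇ-flip (apart fi i)) (trans (cong not lt) (sym (<ᵇ-flip (apart gi i)))))
      where lt = <ᵇ-⇔ (inv Fin.zero (Fin.suc i) (s≤s z≤n))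

  shape⇒sameInversions : ∀ {k m n} {f : Fin k → Fin m} {g : Fin k → Fin n} →
    shape (tabulate (toℕ ∘ f)) ≡ shape (tabulate (toℕ ∘ g)) → SameInversions f g
  shape⇒sameInversions eq Fin.zero    (Fin.suc j) _   = <ᵇ-⇔⁻ (cong proj₁ (tabulate-injective
    (trans (sym (Listₚ.map-tabulate _ _)) (trans (Listₚ.∷-injectiveˡ eq) (Listₚ.map-tabulate _ _))) j))
  shape⇒sameInversions eq (Fin.suc i) (Fin.suc j) i<j =
    shape⇒sameInversions (Listₚ.∷-injectiveʳ eq) i j (s≤s⁻¹ i<j)

  ++-injective : ∀ {A : Set} (xs ys : List A) {xs′ ys′} → length xs ≡ length ys →
                 xs ++ xs′ ≡ ys ++ ys′ → xs ≡ ys × xs′ ≡ ys′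
  ++-injective []       []       len eq = refl , eq
  ++-injective (x ∷ xs) (y ∷ ys) len eq = Product.map₁ (cong₂ _∷_ (Listₚ.∷-injectiveˡ eq))
    (++-injective xs ys (ℕₚ.suc-injective len) (Listₚ.∷-injectiveʳ eq))

  -- Colored words and the convolution

  Word : ℕ → Set
  Word ℓ = List (Biletter ℓ)

  module _ {ℓ : ℕ} where

    letters : Word ℓ → List ℕ
    letters = map proj₁

    hues : Word ℓ → List (Fin ℓ)
    hues = map proj₂

    Distinct : Word ℓ → Set
    Distinct w = Unique (letters w)

    infix 4 _≋_ _≋?_

    -- For distinct letters: same standardization and same colors, stated without constructing the
    -- standardization.
    _≋_ : Word ℓ → Word ℓ → Set
    v ≋ w = shape (letters v) ≡ shape (letters w) × hues v ≡ hues w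

    _≋?_ : Decidable _≋_
    v ≋? w = Listₚ.≡-dec (Listₚ.≡-dec (Productₚ.≡-dec Boolₚ._≟_ Boolₚ._≟_)) _ _
      ×-dec Listₚ.≡-dec Finₚ._≟_ _ _

    ≋-refl : ∀ {v} → v ≋ v
    ≋-refl = refl , refl

    ≋-sym : ∀ {v w} → v ≋ w → w ≋ v
    ≋-sym (s , h) = sym s , sym h

    ≋-trans : ∀ {u v w} → u ≋ v → v ≋ w → u ≋ w
    ≋-trans (s , h) (s′ , h′) = trans s s′ , trans h h′

    ≋-length : ∀ v w → v ≋ w → length v ≡ length w
    ≋-length v w (_ , h) = trans (sym (Listₚ.length-map proj₂ v))
      (trans (cong length h) (Listₚ.length-map proj₂ w))

    word-≡ : ∀ {v w : Word ℓ} → letters v ≡ letters w → hues v ≡ hues w → v ≡ w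
    word-≡ {[]}    {[]}    p q = refl
    word-≡ {x ∷ v} {y ∷ w} p q = cong₂ _∷_
      (cong₂ _,_ (Listₚ.∷-injectiveˡ p) (Listₚ.∷-injectiveˡ q))
      (word-≡ (Listₚ.∷-injectiveʳ p) (Listₚ.∷-injectiveʳ q))

    ranked-≋⇒≡ : ∀ {v w} → Ranked (letters v) → Ranked (letters w) → v ≋ w → v ≡ w
    ranked-≋⇒≡ rv rw (s , h) = word-≡ (shape-injective rv rw s) h

    letters-biword : ∀ (a : ColoredPermutation ℓ) → letters (biword a) ≡ oneLine (perm a)
    letters-biword a = Listₚ.map-tabulate _ proj₁

    tabulate-lookup : ∀ {A : Set} {n} (u : Vec A n) → tabulate (Vec.lookup u) ≡ Vec.toList u
    tabulate-lookup []      = refl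
    tabulate-lookup (c ∷ u) = cong (c ∷_) (tabulate-lookup u)

    hues-biword : ∀ (a : ColoredPermutation ℓ) → hues (biword a) ≡ Vec.toList (colors a)
    hues-biword a = trans (Listₚ.map-tabulate _ proj₂) (tabulate-lookup (colors a))

    length-biword : ∀ (a : ColoredPermutation ℓ) → length (biword a) ≡ size a
    length-biword a = Listₚ.length-tabulate _

    distinct-biword : ∀ a → Distinct (biword a)
    distinct-biword a = subst Unique (sym (letters-biword a)) (unique-oneLine (perm a))

    ranked-biword : ∀ a → Ranked (letters (biword a))
    ranked-biword a = subst Ranked (sym (letters-biword a)) (ranked-oneLine (perm a))

    biword-≋⇒≡ : ∀ {a b} → biword a ≋ biword b → biword a ≡ biword b
    biword-≋⇒≡ {a} {b} = ranked-≋⇒≡ (ranked-biword a) (ranked-biword b)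

    biword-≋⁺ : ∀ {n} (σ : Permutation′ n) (u : Vec (Fin ℓ) n) w →
      shape (oneLine σ) ≡ shape (letters w) → Vec.toList u ≡ hues w → biword ⟨ σ , u ⟩ ≋ w
    biword-≋⁺ σ u w s h =
      trans (cong shape (letters-biword ⟨ σ , u ⟩)) s , trans (hues-biword ⟨ σ , u ⟩) h

    biword-≋⁻ : ∀ {n} (σ : Permutation′ n) (u : Vec (Fin ℓ) n) w → biword ⟨ σ , u ⟩ ≋ w →
      shape (oneLine σ) ≡ shape (letters w) × Vec.toList u ≡ hues w
    biword-≋⁻ σ u w (s , h) =
      trans (cong shape (sym (letters-biword ⟨ σ , u ⟩))) s , trans (sym (hues-biword ⟨ σ , u ⟩)) h

    once-words : ∀ n (cs : List (Fin ℓ)) → length cs ≡ n → Once (λ u → Vec.toList u ≡ cs) (words n)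
    once-words zero    []       len = here refl []
    once-words (suc n) (c ∷ cs) len = once-cartesianProductWith _∷_
      (λ { refl eq → cong (c ∷_) eq })
      (λ eq → sym (Listₚ.∷-injectiveˡ eq) , Listₚ.∷-injectiveʳ eq)
      (unique⇒once (Uniqueₚ.allFin⁺ ℓ) (∈-allFin c))
      (once-words n cs (ℕₚ.suc-injective len))

    once-coloredPermutations : ∀ n (w : Word ℓ) → Distinct w → length w ≡ n →
      Once (λ a → biword a ≋ w) (coloredPermutations n)
    once-coloredPermutations n w d len = once-cartesianProductWith ⟨_,_⟩
      (λ {σ} {u} → biword-≋⁺ σ u w) (λ {σ} {u} → biword-≋⁻ σ u w)
      (once-standardization n (letters w) d (trans (Listₚ.length-map proj₁ w) len))
      (once-words n (hues w) (trans (Listₚ.length-map proj₂ w) len))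

    standardize : ∀ w → Distinct w → ∃ λ a → biword a ≋ w
    standardize w d = once-∃ (once-coloredPermutations (length w) w d refl)

    letters-shift : ∀ p (w : Word ℓ) → letters (shift p w) ≡ map (p +_) (letters w)
    letters-shift p w = trans (sym (Listₚ.map-∘ w)) (Listₚ.map-∘ w)

    +-<ᵇ : ∀ p x y → ((p + x) <ᵇ (p + y)) ≡ (x <ᵇ y)
    +-<ᵇ zero    x y = refl
    +-<ᵇ (suc p) x y = +-<ᵇ p x y

    shift-≋ : ∀ p (w : Word ℓ) → shift p w ≋ w
    shift-≋ p w =
      trans (cong shape (letters-shift p w)) (shape-map (p +_) (+-<ᵇ p) (letters w)) ,
      sym (Listₚ.map-∘ w)

    distinct-shift : ∀ p w → Distinct w → Distinct (shift p w)
    distinct-shift p w d = subst Unique (sym (letters-shift p w)) (Uniqueₚ.map⁺ (ℕₚ.+-cancelˡ-≡ p _ _) d)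

    private
      tabulate-++ : ∀ {A : Set} p {q} (f : Fin (p + q) → A) →
                    tabulate f ≡ tabulate (λ i → f (i ↑ˡ q)) ++ tabulate (λ j → f (p ↑ʳ j))
      tabulate-++ zero    f = refl
      tabulate-++ (suc p) f = cong (f Fin.zero ∷_) (tabulate-++ p (f ∘ Fin.suc))

    module _ (a b : ColoredPermutation ℓ) (τ : Permutation′ (size a + size b)) {w₁ w₂ : Word ℓ}
             (len : length w₁ ≡ size a)
             (τ≋ : shape (oneLine τ) ≡ shape (letters (w₁ ++ w₂))) where

      private
        p = size a
        q = size b

        τˡ τʳ : List ℕ
        τˡ = tabulate (λ i → toℕ (τ ⟨$⟩ʳ (i ↑ˡ q)))
        τʳ = tabulate (λ j → toℕ (τ ⟨$⟩ʳ (p ↑ʳ j)))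

        -- Membership in the convolution looks only inside the two blocks of `τ`, and there the
        -- shape of `τ` is that of `w₁` and of `w₂`.
        blocks : shape τˡ ≡ shape (letters w₁) × shape τʳ ≡ shape (letters w₂)
        blocks = shape-++ τˡ (letters w₁)
          (trans (Listₚ.length-tabulate _) (trans (sym len) (sym (Listₚ.length-map proj₁ w₁))))
          (trans (cong shape (sym (tabulate-++ p _))) (trans τ≋ (cong shape (Listₚ.map-++ proj₁ w₁ w₂))))

      convolution⁺ : biword a ≋ w₁ → biword b ≋ w₂ → τ ∈ perm a * perm b
      convolution⁺ (sa , _) (sb , _) =
        shape⇒sameInversions (trans (cong shape (sym (letters-biword a))) (trans sa (sym (proj₁ blocks)))) ,
        shape⇒sameInversions (trans (cong shape (sym (letters-biword b))) (trans sb (sym (proj₂ blocks))))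

      convolution⁻ : τ ∈ perm a * perm b → biword ⟨ τ , colors a Vec.++ colors b ⟩ ≋ w₁ ++ w₂ →
                     biword a ≋ w₁ × biword b ≋ w₂
      convolution⁻ (ia , ib) τu≋ =
        biword-≋⁺ (perm a) (colors a) w₁ (trans sa (proj₁ blocks)) (proj₁ h) , biword-≋⁺ (perm b) (colors b) w₂ (trans sb (proj₂ blocks)) (proj₂ h)
        where
        sa = sameInversions⇒shape (⟨$⟩ʳ-injective (perm a)) (Finₚ.↑ˡ-injective q _ _ ∘ ⟨$⟩ʳ-injective τ) ia
        sb = sameInversions⇒shape (⟨$⟩ʳ-injective (perm b)) (Finₚ.↑ʳ-injective p _ _ ∘ ⟨$⟩ʳ-injective τ) ib
        split : ∀ {n} (u : Vec (Fin ℓ) n) {cs : List (Fin ℓ)} v {ds} → length v ≡ n →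
                Vec.toList u ++ cs ≡ hues v ++ ds → Vec.toList u ≡ hues v × cs ≡ ds
        split []      []      _  eq = refl , eq
        split (c ∷ u) (_ ∷ v) l≡ eq = Product.map₁ (cong₂ _∷_ (Listₚ.∷-injectiveˡ eq))
          (split u v (ℕₚ.suc-injective l≡) (Listₚ.∷-injectiveʳ eq))
        h = split (colors a) w₁ len (trans (sym (Vecₚ.toList-++ (colors a) (colors b)))
              (trans (proj₂ (biword-≋⁻ τ (colors a Vec.++ colors b) (w₁ ++ w₂) τu≋)) (Listₚ.map-++ proj₂ w₁ w₂)))

      convolution-hues : biword a ≋ w₁ → biword b ≋ w₂ → biword ⟨ τ , colors a Vec.++ colors b ⟩ ≋ w₁ ++ w₂
      convolution-hues (_ , ha) (_ , hb) = biword-≋⁺ τ (colors a Vec.++ colors b) (w₁ ++ w₂) τ≋ (trans (Vecₚ.toList-++ (colors a) (colors b))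
        (trans (cong₂ _++_ (trans (sym (hues-biword a)) ha) (trans (sym (hues-biword b)) hb))
          (sym (Listₚ.map-++ proj₂ w₁ w₂))))

  -- Cuts and shuffles of words

  module _ {A : Set} where

    splits : List A → List (List A × List A)
    splits []      = ([] , []) ∷ []
    splits (x ∷ w) = ([] , x ∷ w) ∷ map (Product.map₁ (x ∷_)) (splits w)

    ∈-splits⁻ : ∀ w {s} → s ∈ splits w → proj₁ s ++ proj₂ s ≡ w
    ∈-splits⁻ []      (here refl) = refl
    ∈-splits⁻ (x ∷ w) (here refl) = refl
    ∈-splits⁻ (x ∷ w) (there s∈)  with ∈-map⁻ _ s∈
    ... | s′ , s′∈ , refl = cong (x ∷_) (∈-splits⁻ w s′∈)

    once-splits : ∀ (v : List A) w → Once ((v , w) ≡_) (splits (v ++ w))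
    once-splits []      []      = here refl []
    once-splits []      (x ∷ w) = here refl (Allₚ.map⁺ (All.tabulate {xs = splits w} λ { _ () }))
    once-splits (x ∷ v) w       = there (λ ()) (once-map (once-⇔ (λ { refl → refl }) (λ { refl → refl })
      (once-splits v w)))

    shuffles : List A → List A → List (List A)
    shuffles []      u       = u ∷ []
    shuffles (x ∷ v) []      = (x ∷ v) ∷ []
    shuffles (x ∷ v) (y ∷ u) = map (x ∷_) (shuffles v (y ∷ u)) ++ map (y ∷_) (shuffles (x ∷ v) u)

    shuffles-[]ʳ : ∀ v → shuffles v [] ≡ v ∷ []
    shuffles-[]ʳ []      = refl
    shuffles-[]ʳ (x ∷ v) = refl

    private
      allˡ : ∀ v → Interleaving {A = A} v [] v
      allˡ []      = []
      allˡ (x ∷ v) = consˡ (allˡ v)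

      allʳ : ∀ u → Interleaving {A = A} [] u u
      allʳ []      = []
      allʳ (x ∷ u) = consʳ (allʳ u)

      allˡ⁻ : ∀ {v t} → Interleaving {A = A} v [] t → v ≡ t
      allˡ⁻ []        = refl
      allˡ⁻ (consˡ i) = cong (_ ∷_) (allˡ⁻ i)

      allʳ⁻ : ∀ {u t} → Interleaving {A = A} [] u t → u ≡ t
      allʳ⁻ []        = refl
      allʳ⁻ (consʳ i) = cong (_ ∷_) (allʳ⁻ i)

    ∈-shuffles⁻ : ∀ v u {t} → t ∈ shuffles v u → Interleaving {A = A} v u t
    ∈-shuffles⁻ []      u       (here refl) = allʳ u
    ∈-shuffles⁻ (x ∷ v) []      (here refl) = allˡ (x ∷ v)
    ∈-shuffles⁻ (x ∷ v) (y ∷ u) t∈ with ∈-++⁻ (map (x ∷_) (shuffles v (y ∷ u))) t∈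
    ... | inj₁ t∈ˡ with ∈-map⁻ _ t∈ˡ
    ...   | _ , t′∈ , refl = consˡ (∈-shuffles⁻ v (y ∷ u) t′∈)
    ∈-shuffles⁻ (x ∷ v) (y ∷ u) t∈ | inj₂ t∈ʳ with ∈-map⁻ _ t∈ʳ
    ...   | _ , t′∈ , refl = consʳ (∈-shuffles⁻ (x ∷ v) u t′∈)

    -- Without a common letter, the first letter of `t` tells which word it comes from, so `t` never
    -- arises in both branches of the recursion.
    once-shuffles : ∀ v u {t} → (∀ {x} → x ∈ v → x ∈ u → ⊥) → Interleaving {A = A} v u t →
                    Once (t ≡_) (shuffles v u)
    once-shuffles []      u       disj i = here (sym (allʳ⁻ i)) []
    once-shuffles (x ∷ v) []      disj i = here (sym (allˡ⁻ i)) []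
    once-shuffles (x ∷ v) (y ∷ u) disj (consˡ i) = once-++ˡ
      (once-map (once-⇔ (cong (x ∷_)) Listₚ.∷-injectiveʳ (once-shuffles v (y ∷ u) (disj ∘ there) i)))
      (Allₚ.map⁺ (All.tabulate {xs = shuffles (x ∷ v) u} λ _ eq →
        disj (here refl) (here (Listₚ.∷-injectiveˡ eq))))
    once-shuffles (x ∷ v) (y ∷ u) disj (consʳ i) = once-++ʳ
      (Allₚ.map⁺ (All.tabulate {xs = shuffles v (y ∷ u)} λ _ eq →
        disj (here refl) (here (sym (Listₚ.∷-injectiveˡ eq)))))
      (once-map (once-⇔ (cong (y ∷_)) Listₚ.∷-injectiveʳ
        (once-shuffles (x ∷ v) u (λ x∈v x∈u → disj x∈v (there x∈u)) i)))

  -- Shuffles of a word with a higher one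

  rank-↭ : ∀ {l m} x → l ↭ m → rank x l ≡ rank x m
  rank-↭ x Perm.refl         = refl
  rank-↭ x (Perm.prep y p)   = cong (_ +_) (rank-↭ x p)
  rank-↭ x (Perm.swap {xs} {ys} y z p) = begin
    iy + (iz + rank x xs)  ≡⟨ cong (λ r → iy + (iz + r)) (rank-↭ x p) ⟩
    iy + (iz + rank x ys)  ≡⟨ ℕₚ.+-assoc iy iz _ ⟨
    iy + iz + rank x ys    ≡⟨ cong (_+ rank x ys) (ℕₚ.+-comm iy iz) ⟩
    iz + iy + rank x ys    ≡⟨ ℕₚ.+-assoc iz iy _ ⟩
    iz + (iy + rank x ys)  ∎
    where
    open ≡-Reasoning
    iy = indicator (y <ᵇ x)
    iz = indicator (z <ᵇ x)
  rank-↭ x (Perm.trans p q)  = trans (rank-↭ x p) (rank-↭ x q)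

  rank-++ : ∀ x l m → rank x (l ++ m) ≡ rank x l + rank x m
  rank-++ x []      m = refl
  rank-++ x (y ∷ l) m = trans (cong (_ +_) (rank-++ x l m)) (sym (ℕₚ.+-assoc (indicator (y <ᵇ x)) _ _))

  rank-all : ∀ {x l} → All (_< x) l → rank x l ≡ length l
  rank-all []                = refl
  rank-all {x} (_∷_ {y} y<x ys) rewrite <ᵇ-true y<x = cong suc (rank-all ys)

  rank-none : ∀ {x l} → All (x ≤_) l → rank x l ≡ 0
  rank-none []                 = refl
  rank-none {x} (_∷_ {y} x≤y ys) rewrite <ᵇ-false x≤y = rank-none ys

  rank-shift : ∀ p x l → rank (p + x) (map (p +_) l) ≡ rank x l
  rank-shift p x l = cong trues (trans (sym (Listₚ.map-∘ l)) (Listₚ.map-cong (λ y → +-<ᵇ {0} p y x) l))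

  ranked⁻ : ∀ {l x} → Ranked l → x ∈ l → rank x l ≡ x
  ranked⁻ {l} rl = go l l rl
    where
    go : ∀ l m → map (λ x → rank x l) m ≡ m → ∀ {x} → x ∈ m → rank x l ≡ x
    go l (y ∷ m) eq (here refl) = Listₚ.∷-injectiveˡ eq
    go l (y ∷ m) eq (there x∈)  = go l m (Listₚ.∷-injectiveʳ eq) x∈

  ranked⁺ : ∀ {l} → (∀ {x} → x ∈ l → rank x l ≡ x) → Ranked l
  ranked⁺ {l} h = trans (map-cong-∈ l h) (Listₚ.map-id l)

  -- A letter is not counted in its own rank, so its rank stays below the length.
  ranked-< : ∀ {l x} → Ranked l → x ∈ l → x < length l
  ranked-< {l} {x} rl x∈l = subst (_< length l) (ranked⁻ rl x∈l) (strict l x∈l)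
    where
    strict : ∀ m → x ∈ m → rank x m < length m
    strict (y ∷ m) (here refl) rewrite <ᵇ-false (ℕₚ.≤-refl {x}) = s≤s (rank-≤-length x m)
    strict (y ∷ m) (there x∈)  = ℕₚ.+-mono-≤-< (indicator-≤1 (y <ᵇ x)) (strict m x∈)

  -- The letters of `l` lie below `length l`, hence below the shifted block: they keep their ranks,
  -- while each shifted letter gains exactly `length l`.
  ranked-++ : ∀ {l m} → Ranked l → Ranked m → Ranked (l ++ map (length l +_) m)
  ranked-++ {l} {m} rl rm = ranked⁺ λ {x} x∈ → trans (rank-++ x l (map (length l +_) m)) (cases x∈)
    where
    p = length l
    cases : ∀ {x} → x ∈ l ++ map (p +_) m → rank x l + rank x (map (p +_) m) ≡ x
    cases {x} x∈ with ∈-++⁻ l x∈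
    ... | inj₁ x∈l = trans (cong₂ _+_ (ranked⁻ rl x∈l)
      (rank-none (Allₚ.map⁺ (All.tabulate {xs = m} λ {y} _ → ℕₚ.≤-trans (ℕₚ.<⇒≤ (ranked-< rl x∈l)) (ℕₚ.m≤m+n p y)))))
      (ℕₚ.+-identityʳ x)
    ... | inj₂ x∈m with ∈-map⁻ (p +_) x∈m
    ...   | y , y∈m , refl = cong₂ _+_
      (rank-all (All.tabulate λ z∈l → ℕₚ.<-≤-trans (ranked-< rl z∈l) (ℕₚ.m≤m+n p y)))
      (trans (rank-shift p y m) (ranked⁻ rm y∈m))

  ranked-↭ : ∀ {l m} → l ↭ m → Ranked m → Ranked l
  ranked-↭ l↭m rm = ranked⁺ λ {x} x∈l → trans (rank-↭ x l↭m) (ranked⁻ rm (Permₚ.∈-resp-↭ l↭m x∈l))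

  module _ {ℓ : ℕ} where

    infix 4 _≺_

    -- An abstraction of the shift in the coproduct. Unlike being a shifted permutation, it passes
    -- to the factors of both words.
    _≺_ : Word ℓ → Word ℓ → Set
    v ≺ u = ∀ {x y} → x ∈ letters v → y ∈ letters u → x < y

    ≺-disjoint : ∀ {v u} → v ≺ u → ∀ {x} → x ∈ v → x ∈ u → ⊥
    ≺-disjoint v≺u x∈v x∈u = ℕₚ.<-irrefl refl (v≺u (∈-map⁺ proj₁ x∈v) (∈-map⁺ proj₁ x∈u))

    ≺-++⁻ : ∀ v₁ u₁ {v₂ u₂} → v₁ ++ v₂ ≺ u₁ ++ u₂ → v₁ ≺ u₁ × v₂ ≺ u₂
    ≺-++⁻ v₁ u₁ {v₂} {u₂} v≺u =
      (λ x∈ y∈ → v≺u (inˡ v₁ x∈) (inˡ u₁ y∈)) , λ x∈ y∈ → v≺u (inʳ v₁ x∈) (inʳ u₁ y∈)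
      where
      inˡ : ∀ v {w x} → x ∈ letters v → x ∈ letters (v ++ w)
      inˡ v {w} x∈ = subst (_ ∈_) (sym (Listₚ.map-++ proj₁ v w)) (∈-++⁺ˡ x∈)
      inʳ : ∀ v {w x} → x ∈ letters w → x ∈ letters (v ++ w)
      inʳ v {w} x∈ = subst (_ ∈_) (sym (Listₚ.map-++ proj₁ v w)) (∈-++⁺ʳ (letters v) x∈)

    distinct-++⁻ : ∀ v {w : Word ℓ} → Distinct (v ++ w) → Distinct v × Distinct w
    distinct-++⁻ []      d        = [] , d
    distinct-++⁻ (x ∷ v) {w} (h ∷ d) = Product.map₁
      (Allₚ.++⁻ˡ (letters v) (subst (All _) (Listₚ.map-++ proj₁ v w) h) ∷_) (distinct-++⁻ v d)

    distinct-++⁺ : ∀ {v w : Word ℓ} → (∀ {x} → x ∈ letters v → x ∈ letters w → ⊥) →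
                   Distinct v → Distinct w → Distinct (v ++ w)
    distinct-++⁺ {v} {w} disj dv dw = subst Unique (sym (Listₚ.map-++ proj₁ v w))
      (Uniqueₚ.++⁺ dv dw λ { (x∈v , x∈w) → disj x∈v x∈w })

    distinct-shuffle : ∀ {v u t} → v ≺ u → Distinct v → Distinct u → t ∈ shuffles v u → Distinct t
    distinct-shuffle {v} {u} v≺u dv du t∈ = SetoidPermₚ.Unique-resp-↭ (≡.setoid ℕ)
      (Perm.↭⇒↭ₛ (Permₚ.map⁺ proj₁ (Perm.↭-sym (toPermutation (∈-shuffles⁻ v u t∈)))))
      (distinct-++⁺ (λ x∈v x∈u → ℕₚ.<-irrefl refl (v≺u x∈v x∈u)) dv du)

    biword-≺ : ∀ a b → biword a ≺ shift (size a) (biword b)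
    biword-≺ a b {x} x∈ y∈ with ∈-map⁻ (size a +_) (subst (_ ∈_) (letters-shift (size a) (biword b)) y∈)
    ... | z , _ , refl = ℕₚ.<-≤-trans
      (subst (x <_) (trans (Listₚ.length-map proj₁ (biword a)) (length-biword a)) (ranked-< (ranked-biword a) x∈))
      (ℕₚ.m≤m+n (size a) z)

    -- With it, a biword that is `≋` to such a shuffle is equal to it, so coefficients of the
    -- coproduct can be read off from the words themselves.
    ranked-shuffle : ∀ (a b : ColoredPermutation ℓ) {t} → t ∈ shuffles (biword a) (shift (size a) (biword b)) → Ranked (letters t)
    ranked-shuffle a b {t} t∈ = ranked-↭
      (Permₚ.map⁺ proj₁ (toPermutation (∈-shuffles⁻ (biword a) (shift (size a) (biword b)) t∈)))
      (subst Ranked eq (ranked-++ (ranked-biword a) (ranked-biword b)))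
      where
      eq : letters (biword a) ++ map (length (letters (biword a)) +_) (letters (biword b)) ≡
           letters (biword a ++ shift (size a) (biword b))
      eq = trans (cong (letters (biword a) ++_) (trans
          (cong (λ p → map (p +_) (letters (biword b))) (trans (Listₚ.length-map proj₁ (biword a)) (length-biword a)))
          (sym (letters-shift (size a) (biword b)))))
        (sym (Listₚ.map-++ proj₁ (biword a) _))

  -- Increasing words

  private
    sides-ascending : ∀ {a} l → All (a <_) l → map (side a) l ≡ List.replicate (length l) (false , true)
    sides-ascending []      []          = refl
    sides-ascending (x ∷ l) (a<x ∷ a<l) =
      cong₂ _∷_ (cong₂ _,_ (<ᵇ-false (ℕₚ.<⇒≤ a<x)) (<ᵇ-true a<x)) (sides-ascending l a<l)

  ascending-shape : ∀ {l m} → AllPairs _<_ l → AllPairs _<_ m → length l ≡ length m → shape l ≡ shape m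
  ascending-shape {[]}    {[]}    []        []        len = refl
  ascending-shape {a ∷ l} {b ∷ m} (a<l ∷ p) (b<m ∷ q) len = cong₂ _∷_
    (trans (sides-ascending l a<l) (trans
      (cong (λ n → List.replicate n (false , true)) (ℕₚ.suc-injective len))
      (sym (sides-ascending m b<m))))
    (ascending-shape p q (ℕₚ.suc-injective len))

  ascending-resp : ∀ {l m} → shape l ≡ shape m → AllPairs _<_ l → AllPairs _<_ m
  ascending-resp {[]}    {[]}    eq []        = []
  ascending-resp {a ∷ l} {b ∷ m} eq (a<l ∷ p) =
    sides l m (Listₚ.∷-injectiveˡ eq) a<l ∷ ascending-resp (Listₚ.∷-injectiveʳ eq) p
    where
    sides : ∀ l m → map (side a) l ≡ map (side b) m → All (a <_) l → All (b <_) m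
    sides []      []      eq []       = []
    sides (x ∷ l) (y ∷ m) eq (lt ∷ p) =
      <ᵇ⁻ (trans (sym (cong proj₂ (Listₚ.∷-injectiveˡ eq))) (<ᵇ-true lt)) ∷ sides l m (Listₚ.∷-injectiveʳ eq) p

  -- Partite numbers and color contents

  infixl 6 _⊕_

  _⊕_ : ∀ {ℓ} → Partite ℓ → Partite ℓ → Partite ℓ
  _⊕_ = Vec.zipWith _+_

  𝟎 : ∀ {ℓ} → Partite ℓ
  𝟎 = Vec.replicate _ 0

  ⊕-comm : ∀ {ℓ} (m n : Partite ℓ) → m ⊕ n ≡ n ⊕ m
  ⊕-comm = Vecₚ.zipWith-comm ℕₚ.+-comm

  ⊕-identityˡ : ∀ {ℓ} (n : Partite ℓ) → 𝟎 ⊕ n ≡ n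
  ⊕-identityˡ = Vecₚ.zipWith-identityˡ ℕₚ.+-identityˡ

  ⊕-identityʳ : ∀ {ℓ} (n : Partite ℓ) → n ⊕ 𝟎 ≡ n
  ⊕-identityʳ = Vecₚ.zipWith-identityʳ ℕₚ.+-identityʳ

  ∣𝟎∣ : ∀ ℓ → ∣ 𝟎 {ℓ} ∣ ≡ 0
  ∣𝟎∣ zero    = refl
  ∣𝟎∣ (suc ℓ) = ∣𝟎∣ ℓ

  ∣n∣≡0⇒𝟎 : ∀ {ℓ} (n : Partite ℓ) → ∣ n ∣ ≡ 0 → n ≡ 𝟎
  ∣n∣≡0⇒𝟎 []         eq = refl
  ∣n∣≡0⇒𝟎 (zero ∷ n) eq = cong (0 ∷_) (∣n∣≡0⇒𝟎 n eq)

  ∣⊕∣ : ∀ {ℓ} (m n : Partite ℓ) → ∣ m ⊕ n ∣ ≡ ∣ m ∣ + ∣ n ∣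
  ∣⊕∣ []      []      = refl
  ∣⊕∣ (x ∷ m) (y ∷ n) = begin
    x + y + ∣ m ⊕ n ∣          ≡⟨ cong (x + y +_) (∣⊕∣ m n) ⟩
    x + y + (∣ m ∣ + ∣ n ∣)    ≡⟨ ℕₚ.+-assoc x y _ ⟩
    x + (y + (∣ m ∣ + ∣ n ∣))  ≡⟨ cong (x +_) (ℕₚ.+-assoc y ∣ m ∣ _) ⟨
    x + (y + ∣ m ∣ + ∣ n ∣)    ≡⟨ cong (λ z → x + (z + ∣ n ∣)) (ℕₚ.+-comm y ∣ m ∣) ⟩
    x + (∣ m ∣ + y + ∣ n ∣)    ≡⟨ cong (x +_) (ℕₚ.+-assoc ∣ m ∣ y _) ⟩
    x + (∣ m ∣ + (y + ∣ n ∣))  ≡⟨ ℕₚ.+-assoc x ∣ m ∣ _ ⟨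
    x + ∣ m ∣ + (y + ∣ n ∣)    ∎
    where open ≡-Reasoning

  content : ∀ {ℓ} → List (Fin ℓ) → Partite ℓ
  content []       = 𝟎
  content (c ∷ cs) = Vec.updateAt (content cs) c suc

  ∣content∣ : ∀ {ℓ} (cs : List (Fin ℓ)) → ∣ content cs ∣ ≡ length cs
  ∣content∣ {ℓ} []   = ∣𝟎∣ ℓ
  ∣content∣ (c ∷ cs) = trans (∣updateAt∣ (content cs) c) (cong suc (∣content∣ cs))
    where
    ∣updateAt∣ : ∀ {ℓ} (n : Partite ℓ) c → ∣ Vec.updateAt n c suc ∣ ≡ suc ∣ n ∣
    ∣updateAt∣ (x ∷ n) Fin.zero    = refl
    ∣updateAt∣ (x ∷ n) (Fin.suc c) = trans (cong (x +_) (∣updateAt∣ n c)) (ℕₚ.+-suc x _)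

  content-++ : ∀ {ℓ} (cs ds : List (Fin ℓ)) → content (cs ++ ds) ≡ content cs ⊕ content ds
  content-++ []       ds = sym (⊕-identityˡ _)
  content-++ (c ∷ cs) ds = trans (cong (λ n → Vec.updateAt n c suc) (content-++ cs ds))
    (updateAt-⊕ (content cs) (content ds) c)
    where
    updateAt-⊕ : ∀ {ℓ} (m n : Partite ℓ) c → Vec.updateAt (m ⊕ n) c suc ≡ Vec.updateAt m c suc ⊕ n
    updateAt-⊕ (x ∷ m) (y ∷ n) Fin.zero    = refl
    updateAt-⊕ (x ∷ m) (y ∷ n) (Fin.suc c) = cong (_ ∷_) (updateAt-⊕ m n c)

  lookup-content : ∀ {ℓ m} (u : Vec (Fin ℓ) m) i →
                   Vec.lookup (content (Vec.toList u)) i ≡ Vec.count (i Finₚ.≟_) u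
  lookup-content []      i = Vecₚ.lookup-replicate i 0
  lookup-content (c ∷ u) i with i Finₚ.≟ c
  ... | yes refl = trans (Vecₚ.lookup∘updateAt i (content (Vec.toList u))) (cong suc (lookup-content u i))
  ... | no  i≢c  = trans (Vecₚ.lookup∘updateAt′ i c i≢c (content (Vec.toList u))) (lookup-content u i)

  hasContent⁺ : ∀ {ℓ m} {n : Partite ℓ} (u : Vec (Fin ℓ) m) → content (Vec.toList u) ≡ n → HasContent n u
  hasContent⁺ u refl i = sym (lookup-content u i)

  hasContent⁻ : ∀ {ℓ m} {n : Partite ℓ} (u : Vec (Fin ℓ) m) → HasContent n u → content (Vec.toList u) ≡ n
  hasContent⁻ u h = lookup-injective λ i → trans (lookup-content u i) (h i)
    where
    lookup-injective : ∀ {ℓ} {m n : Partite ℓ} → (∀ i → Vec.lookup m i ≡ Vec.lookup n i) → m ≡ n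
    lookup-injective {m = []}    {[]}    eq = refl
    lookup-injective {m = x ∷ m} {y ∷ n} eq = cong₂ _∷_ (eq Fin.zero) (lookup-injective (eq ∘ Fin.suc))

  content-surjective : ∀ {ℓ} (n : Partite ℓ) → ∃ λ cs → content cs ≡ n
  content-surjective []      = [] , refl
  content-surjective (m ∷ n) with content-surjective n
  ... | cs , eq = List.replicate m Fin.zero ++ map Fin.suc cs , trans (zeros m (map Fin.suc cs))
    (trans (cong (λ n → Vec.updateAt n Fin.zero (m +_)) (trans (sucs cs) (cong (0 ∷_) eq)))
      (cong (_∷ n) (ℕₚ.+-identityʳ m)))
    where
    zeros : ∀ {ℓ} m (cs : List (Fin (suc ℓ))) →
            content (List.replicate m Fin.zero ++ cs) ≡ Vec.updateAt (content cs) Fin.zero (m +_)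
    zeros zero    cs with content cs
    ... | _ ∷ _ = refl
    zeros (suc m) cs rewrite zeros m cs with content cs
    ... | _ ∷ _ = refl
    sucs : ∀ {ℓ} (cs : List (Fin ℓ)) → content (map Fin.suc cs) ≡ 0 ∷ content cs
    sucs []       = refl
    sucs (c ∷ cs) rewrite sucs cs = refl

  ∈-decompositions⁻ : ∀ {ℓ} (n : Partite ℓ) {s} → s ∈ decompositions n → proj₁ s ⊕ proj₂ s ≡ n
  ∈-decompositions⁻ []      (here refl) = refl
  ∈-decompositions⁻ (m ∷ n) s∈
    with k , _ , k∈ , t∈ , refl ← ∈-cartesianProductWith⁻ _ (List.upTo (suc m)) (decompositions n) s∈ =
    cong₂ _∷_ (ℕₚ.m+[n∸m]≡n (s≤s⁻¹ (∈-upTo⁻ k∈))) (∈-decompositions⁻ n t∈)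

  once-decompositions : ∀ {ℓ} (i j : Partite ℓ) → Once ((i , j) ≡_) (decompositions (i ⊕ j))
  once-decompositions []      []      = here refl []
  once-decompositions (x ∷ i) (y ∷ j) = once-cartesianProductWith _
    (λ { refl refl → cong (λ z → (x ∷ i) , (z ∷ j)) (sym (ℕₚ.m+n∸m≡n x y)) })
    (λ { {k} {_ , _} eq → cong (Vec.head ∘ proj₁) eq ,
      cong (Product.map Vec.tail Vec.tail) eq })
    (unique⇒once (Uniqueₚ.upTo⁺ (suc (x + y))) (∈-upTo⁺ (s≤s (ℕₚ.m≤m+n x y))))
    (once-decompositions i j)

  -- Column lists and their decompositions

  module _ {ℓ : ℕ} where

    Columns : Set
    Columns = List (Partite ℓ)

    columnDecompositions : Columns → List (Columns × Columns)
    columnDecompositions []      = ([] , []) ∷ []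
    columnDecompositions (n ∷ I) = List.cartesianProductWith (λ (i , j) (A , B) → (i ∷ A) , (j ∷ B))
      (decompositions n) (columnDecompositions I)

    data ColumnSum : Columns → Columns → Columns → Set where
      []  : ColumnSum [] [] []
      _∷_ : ∀ {i j n A B I} → i ⊕ j ≡ n → ColumnSum A B I → ColumnSum (i ∷ A) (j ∷ B) (n ∷ I)

    columnSum-comm : ∀ {A B I} → ColumnSum A B I → ColumnSum B A I
    columnSum-comm []                   = []
    columnSum-comm (_∷_ {i} {j} refl s) = ⊕-comm j i ∷ columnSum-comm s

    columnSum-𝟎 : ∀ I → ColumnSum I (map (λ _ → 𝟎) I) I
    columnSum-𝟎 []      = []
    columnSum-𝟎 (n ∷ I) = ⊕-identityʳ n ∷ columnSum-𝟎 I

    ∈-columnDecompositions⁻ : ∀ I {s} → s ∈ columnDecompositions I → ColumnSum (proj₁ s) (proj₂ s) I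
    ∈-columnDecompositions⁻ []      (here refl) = []
    ∈-columnDecompositions⁻ (n ∷ I) s∈
      with _ , _ , d∈ , t∈ , refl ← ∈-cartesianProductWith⁻ _ (decompositions n) (columnDecompositions I) s∈ =
      ∈-decompositions⁻ n d∈ ∷ ∈-columnDecompositions⁻ I t∈

    once-columnDecompositions : ∀ {A B I} → ColumnSum A B I → Once ((A , B) ≡_) (columnDecompositions I)
    once-columnDecompositions []                   = here refl []
    once-columnDecompositions (_∷_ {i} {j} refl s) = once-cartesianProductWith _
      (λ { refl refl → refl }) (λ { {_ , _} {_ , _} refl → refl , refl })
      (once-decompositions i j) (once-columnDecompositions s)

    weight : Columns → ℕ
    weight []      = 0
    weight (n ∷ I) = ∣ n ∣ + weight I

    -- Weight lost on the left is the weight of `B`, which vanishes only for zero columns. The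
    -- exceptional pair is the one that carries the unknown in the antipode equation.
    weight-columnSum : ∀ {A B I} → ColumnSum A B I →
      weight A < weight I ⊎ (A ≡ I × B ≡ map (λ _ → 𝟎) I)
    weight-columnSum [] = inj₂ (refl , refl)
    weight-columnSum (_∷_ {i} {j} {A = A} refl s) with ∣ j ∣ in eq | weight-columnSum s
    ... | suc k | r      = inj₁ (ℕₚ.+-mono-<-≤ (subst (∣ i ∣ <_) (sym (trans (∣⊕∣ i j) (cong (∣ i ∣ +_) eq)))
      (ℕₚ.m<m+n ∣ i ∣ (s≤s z≤n))) (≤-of r))
      where
      ≤-of : ∀ {I} {P : Set} → weight A < weight I ⊎ (A ≡ I × P) → weight A ≤ weight I
      ≤-of (inj₁ lt)         = ℕₚ.<⇒≤ lt
      ≤-of (inj₂ (refl , _)) = ℕₚ.≤-refl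
    ... | zero  | inj₁ lt = inj₁ (subst (λ x → ∣ i ∣ + weight A < x + _)
      (sym (trans (∣⊕∣ i j) (trans (cong (∣ i ∣ +_) eq) (ℕₚ.+-identityʳ _)))) (ℕₚ.+-monoʳ-< ∣ i ∣ lt))
    ... | zero  | inj₂ (refl , refl) rewrite ∣n∣≡0⇒𝟎 j eq = inj₂ (cong (_∷ _) (sym (⊕-identityʳ i)) , refl)

    -- Factorizations of a word into increasing rows

    Ascending : Word ℓ → Set
    Ascending w = AllPairs _<_ (letters w)

    Row : Partite ℓ → Word ℓ → Set
    Row n w = Ascending w × content (hues w) ≡ n

    row? : ∀ n w → Dec (Row n w)
    row? n w = allPairs? ℕₚ._<?_ (letters w) ×-dec Vecₚ.≡-dec ℕₚ._≟_ (content (hues w)) n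

    row-length : ∀ {n} w → Row n w → length w ≡ ∣ n ∣
    row-length w (_ , refl) = trans (sym (Listₚ.length-map proj₂ w)) (sym (∣content∣ (hues w)))

    ascending-++⁺ : ∀ {v w} → v ≺ w → Ascending v → Ascending w → Ascending (v ++ w)
    ascending-++⁺ {v} {w} v≺w av aw = subst (AllPairs _<_) (sym (Listₚ.map-++ proj₁ v w))
      (AllPairsₚ.++⁺ av aw (All.tabulate λ x∈ → All.tabulate (v≺w x∈)))

    ascending-++⁻ : ∀ v {w} → Ascending (v ++ w) → Ascending v × Ascending w × v ≺ w
    ascending-++⁻ []      a       = [] , a , λ ()
    ascending-++⁻ (x ∷ v) {w} (h ∷ a) with subst (All _) (Listₚ.map-++ proj₁ v w) h | ascending-++⁻ v a
    ... | h′ | av , aw , v≺w = (Allₚ.++⁻ˡ (letters v) h′ ∷ av) , aw ,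
      λ { (here refl) y∈ → All.lookup (Allₚ.++⁻ʳ (letters v) h′) y∈ ; (there x∈) y∈ → v≺w x∈ y∈ }

    row-++⁺ : ∀ {i j v w} → v ≺ w → Row i v → Row j w → Row (i ⊕ j) (v ++ w)
    row-++⁺ {v = v} {w} v≺w (av , refl) (aw , refl) = ascending-++⁺ v≺w av aw ,
      trans (cong content (Listₚ.map-++ proj₂ v w)) (content-++ (hues v) (hues w))

    row-++⁻ : ∀ {n} v {w} → Row n (v ++ w) →
              Row (content (hues v)) v × Row (content (hues w)) w × content (hues v) ⊕ content (hues w) ≡ n
    row-++⁻ v {w} (a , eq) with ascending-++⁻ v a
    ... | av , aw , _ = (av , refl) , (aw , refl) ,
      trans (sym (trans (cong content (Listₚ.map-++ proj₂ v w)) (content-++ (hues v) (hues w)))) eq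

    biword-id-≋⁺ : ∀ {n m} (u : Vec (Fin ℓ) m) {w} → m ≡ ∣ n ∣ → Vec.toList u ≡ hues w → Row n w →
                   biword ⟨ idₚ , u ⟩ ≋ w
    biword-id-≋⁺ {m = m} u {w} m≡ h r@(a , _) = biword-≋⁺ idₚ u w (ascending-shape
      (AllPairsₚ.tabulate⁺-< {n = m} id) a (trans (Listₚ.length-tabulate {n = m} _)
        (trans m≡ (sym (trans (Listₚ.length-map proj₁ w) (row-length w r)))))) h

    biword-id-≋⁻ : ∀ {n m} (u : Vec (Fin ℓ) m) {w} → HasContent n u → biword ⟨ idₚ , u ⟩ ≋ w → Row n w
    biword-id-≋⁻ {m = m} u {w} hc eq with biword-≋⁻ idₚ u w eq
    ... | s , h = ascending-resp s (AllPairsₚ.tabulate⁺-< {n = m} id) ,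
      trans (cong content (sym h)) (hasContent⁻ u hc)

    data Rows : Columns → Word ℓ → Set where
      []  : Rows [] []
      cons : ∀ {n I v w} → Row n v → Rows I w → Rows (n ∷ I) (v ++ w)

    -- Each row lies above everything after it. For nonzero columns the descents of the word
    -- therefore sit exactly at the ends of the rows, which makes it a test word for `J`.
    data Descending : Columns → Word ℓ → Set where
      []  : Descending [] []
      cons : ∀ {n I v w} → Row n v → Descending I w → w ≺ v → Descending (n ∷ I) (v ++ w)

    Nonzero : Columns → Set
    Nonzero = All (_≢ 𝟎)

    row-nonempty : ∀ {n v} → n ≢ 𝟎 → Row n v → v ≢ []
    row-nonempty n≢0 (_ , refl) refl = n≢0 refl

    private
      ++-compare : ∀ {A : Set} (v v′ : List A) {w w′} → v ++ w ≡ v′ ++ w′ →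
        (∃ λ t → v ≡ v′ ++ t × w′ ≡ t ++ w) ⊎ (∃ λ t → v′ ≡ v ++ t × t ≢ [] × w ≡ t ++ w′)
      ++-compare v       []       eq = inj₁ (v , refl , sym eq)
      ++-compare []      (x ∷ v′) eq = inj₂ (x ∷ v′ , refl , (λ ()) , eq)
      ++-compare (x ∷ v) (y ∷ v′) eq with Listₚ.∷-injectiveˡ eq | ++-compare v v′ (Listₚ.∷-injectiveʳ eq)
      ... | refl | inj₁ (t , p , q)      = inj₁ (t , cong (x ∷_) p , q)
      ... | refl | inj₂ (t , p , t≢ , q) = inj₂ (t , cong (x ∷_) p , t≢ , q)

      -- An ascending word cannot cross from the end of v into a lower word.
      no-crossing : ∀ {n v t w} → v ≢ [] → Row n (v ++ t) → t ++ w ≺ v → t ≡ []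
      no-crossing {v = []}              v≢ r tw≺v = contradiction refl v≢
      no-crossing {v = x ∷ v} {[]}      v≢ r tw≺v = refl
      no-crossing {v = x ∷ v} {y ∷ t}   v≢ (a , _) tw≺v = contradiction
        (proj₂ (proj₂ (ascending-++⁻ (x ∷ v) {y ∷ t} a)) (here refl) (here refl))
        (ℕₚ.<-asym (tw≺v (here refl) (here refl)))

    mutual

      rows-descending-≤ : ∀ {I J w} → Rows I w → Descending J w → Nonzero J → length J ≤ length I
      rows-descending-≤ rs []              nz         = z≤n
      rows-descending-≤ rs (cons r ds w≺v) (n≢0 ∷ nz) =
        rows-descending-< rs (row-nonempty n≢0 r) refl ds w≺v nz

      -- Rows cannot pass a descent, so every row of the descending word uses up at least one column
      -- of `I`. Here `v` is the part of the current descending row not yet covered; being nonempty,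
      -- it costs one column more than `J`.
      rows-descending-< : ∀ {I J t v w} → Rows I t → v ≢ [] → t ≡ v ++ w → Descending J w → w ≺ v →
                          Nonzero J → length J < length I
      rows-descending-< {v = []} [] v≢ eq ds w≺v nz = contradiction refl v≢
      rows-descending-< {v = v} (cons {v = v₁} r rs) v≢ eq ds w≺v nz with ++-compare v₁ v eq
      ... | inj₂ (t , refl , t≢ , refl) = ℕₚ.m≤n⇒m≤1+n
        (rows-descending-< rs t≢ refl ds (λ x∈ y∈ → w≺v x∈ (subst (_ ∈_)
          (sym (Listₚ.map-++ proj₁ v₁ t)) (∈-++⁺ʳ (letters v₁) y∈))) nz)
      -- This row of `I` reaches the end of `v` and must stop there, since `w` lies below `v`.
      ... | inj₁ (t , refl , refl) with no-crossing v≢ r w≺v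
      ...   | refl = s≤s (rows-descending-≤ rs ds nz)

    -- If a row of `I` ended inside a row of `J`, covering the remainder would cost an additional
    -- column. With no column to spare the rows coincide, and so do their contents.
    rows-descending-≡ : ∀ {I J w} → Rows I w → Descending J w → Nonzero J → length I ≤ length J → I ≡ J
    rows-descending-≡ {I} {J} {w} rs ds nz le = go rs refl ds nz le
      where
      go : ∀ {I J t w} → Rows I t → t ≡ w → Descending J w → Nonzero J → length I ≤ length J → I ≡ J
      go []          eq []                      nz         le = refl
      go []          eq (cons {v = []} r ds _)  (n≢0 ∷ nz) le = contradiction refl (row-nonempty n≢0 r)
      go (cons {v = v₁} r rs) eq (cons {n} {v = v} r′ ds w≺v) (n≢0 ∷ nz) le with ++-compare v₁ v eq
      ... | inj₂ (t , refl , t≢ , refl) = contradiction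
        (rows-descending-< rs t≢ refl ds (λ x∈ y∈ → w≺v x∈ (subst (_ ∈_)
          (sym (Listₚ.map-++ proj₁ v₁ t)) (∈-++⁺ʳ (letters v₁) y∈))) nz)
        (ℕₚ.≤⇒≯ (s≤s⁻¹ le))
      ... | inj₁ (t , refl , refl) with no-crossing (row-nonempty n≢0 r′) r w≺v
      ...   | refl = cong₂ _∷_
        (trans (sym (proj₂ r)) (trans (cong (content ∘ hues) (Listₚ.++-identityʳ v)) (proj₂ r′)))
        (go rs refl ds nz (s≤s⁻¹ le))

    descending-rows : ∀ {J w} → Descending J w → Rows J w
    descending-rows []            = []
    descending-rows (cons r ds _) = cons r (descending-rows ds)

    -- Built from the last column backwards. The bound `b` exceeds all letters used so far, and the
    -- new row takes consecutive letters starting at `b`, with colors chosen to give the content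
    -- `n`.
    descending-exists : ∀ J → ∃ λ w → Descending J w × Distinct w × (∃ λ b → All (_< b) (letters w))
    descending-exists []      = [] , [] , [] , 0 , []
    descending-exists (n ∷ J) with descending-exists J | content-surjective n
    ... | w , ds , d , b , w<b | cs , refl =
      run b cs ++ w , cons (ascending-run b cs , cong content (hues-run b cs)) ds w≺run ,
      distinct-++⁺ (λ x∈ x∈w → ℕₚ.<-irrefl refl (w≺run x∈w x∈)) (AllPairs.map ℕₚ.<⇒≢ (ascending-run b cs)) d ,
      b + length cs , subst (All _) (sym (Listₚ.map-++ proj₁ (run b cs) w))
        (Allₚ.++⁺ (run-< b cs) (All.map (λ x<b → ℕₚ.<-≤-trans x<b (ℕₚ.m≤m+n b _)) w<b))
      where
      run : ℕ → List (Fin ℓ) → Word ℓ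
      run b []       = []
      run b (c ∷ cs) = (b , c) ∷ run (suc b) cs

      hues-run : ∀ b cs → hues (run b cs) ≡ cs
      hues-run b []       = refl
      hues-run b (c ∷ cs) = cong (c ∷_) (hues-run (suc b) cs)

      run-≥ : ∀ b cs → All (b ≤_) (letters (run b cs))
      run-≥ b []       = []
      run-≥ b (c ∷ cs) = ℕₚ.≤-refl ∷ All.map ℕₚ.<⇒≤ (run-≥ (suc b) cs)

      run-< : ∀ b cs → All (_< b + length cs) (letters (run b cs))
      run-< b []       = []
      run-< b (c ∷ cs) = subst (λ m → All (_< m) (letters (run b (c ∷ cs)))) (sym (ℕₚ.+-suc b _))
        (s≤s (ℕₚ.m≤m+n b _) ∷ run-< (suc b) cs)

      ascending-run : ∀ b cs → Ascending (run b cs)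
      ascending-run b []       = []
      ascending-run b (c ∷ cs) = run-≥ (suc b) cs ∷ ascending-run (suc b) cs

      w≺run : w ≺ run b cs
      w≺run x∈ y∈ = ℕₚ.<-≤-trans (All.lookup w<b x∈) (All.lookup (run-≥ b cs) y∈)

open Combinatorics

-- Finite sums in a ring

module ListSum {r e} (R : Ring r e) where

  open Ring R
  open SetoidReasoning setoid
  open CommutativeSemigroupProperties +-commutativeSemigroup using (interchange)

  sum : ∀ {a} {A : Set a} → List A → (A → Carrier) → Carrier
  sum xs f = List.foldr (λ x s → f x + s) 0# xs

  ind : ∀ {p} {P : Set p} → Dec P → Carrier
  ind d = if does d then 1# else 0#

  ind-yes : ∀ {p} {P : Set p} (d : Dec P) → P → ind d ≈ 1#
  ind-yes (yes _) p = refl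
  ind-yes (no ¬p) p = contradiction p ¬p

  ind-no : ∀ {p} {P : Set p} (d : Dec P) → ¬ P → ind d ≈ 0#
  ind-no (yes p) ¬p = contradiction p ¬p
  ind-no (no _)  ¬p = refl

  ind-cong : ∀ {p q} {P : Set p} {Q : Set q} (d : Dec P) (d′ : Dec Q) → (P → Q) → (Q → P) → ind d ≈ ind d′
  ind-cong (yes p) d′ to from = sym (ind-yes d′ (to p))
  ind-cong (no ¬p) d′ to from = sym (ind-no d′ (¬p ∘ from))

  ind-* : ∀ {p q s} {P : Set p} {Q : Set q} {T : Set s} (d : Dec P) (d′ : Dec Q) (d″ : Dec T) →
          (P → Q → T) → (T → P × Q) → ind d * ind d′ ≈ ind d″
  ind-* (yes p) d′ d″ to from = trans (*-identityˡ _) (ind-cong d′ d″ (to p) (proj₂ ∘ from))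
  ind-* (no ¬p) d′ d″ to from = trans (zeroˡ _) (sym (ind-no d″ (¬p ∘ proj₁ ∘ from)))

  module _ {a} {A : Set a} where

    sum-cong-∈ : ∀ xs {f g : A → Carrier} → (∀ {x} → x ∈ xs → f x ≈ g x) → sum xs f ≈ sum xs g
    sum-cong-∈ []       h = refl
    sum-cong-∈ (x ∷ xs) h = +-cong (h (here ≡.refl)) (sum-cong-∈ xs (h ∘ there))

    sum-cong : ∀ xs {f g : A → Carrier} → (∀ x → f x ≈ g x) → sum xs f ≈ sum xs g
    sum-cong xs h = sum-cong-∈ xs λ {x} _ → h x

    sum-0-∈ : ∀ xs {f : A → Carrier} → (∀ {x} → x ∈ xs → f x ≈ 0#) → sum xs f ≈ 0#
    sum-0-∈ []       h = refl
    sum-0-∈ (x ∷ xs) h = trans (+-cong (h (here ≡.refl)) (sum-0-∈ xs (h ∘ there))) (+-identityˡ 0#)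

    sum-0 : ∀ xs {f : A → Carrier} → (∀ x → f x ≈ 0#) → sum xs f ≈ 0#
    sum-0 xs h = sum-0-∈ xs λ {x} _ → h x

    sum-++ : ∀ xs ys {f : A → Carrier} → sum (xs ++ ys) f ≈ sum xs f + sum ys f
    sum-++ []       ys = sym (+-identityˡ _)
    sum-++ (x ∷ xs) ys = trans (+-congˡ (sum-++ xs ys)) (sym (+-assoc _ _ _))

    sum-map : ∀ {b} {B : Set b} (g : B → A) xs {f : A → Carrier} → sum (map g xs) f ≈ sum xs (f ∘ g)
    sum-map g []       = refl
    sum-map g (x ∷ xs) = +-congˡ (sum-map g xs)

    sum-concatMap : ∀ {b} {B : Set b} (g : B → List A) xs {f : A → Carrier} →
                    sum (concatMap g xs) f ≈ sum xs (λ x → sum (g x) f)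
    sum-concatMap g []       = refl
    sum-concatMap g (x ∷ xs) = trans (sum-++ (g x) _) (+-congˡ (sum-concatMap g xs))

    sum-cartesianProductWith : ∀ {b c} {B : Set b} {C : Set c} (g : B → C → A) xs ys {f : A → Carrier} →
      sum (cartesianProductWith g xs ys) f ≈ sum xs (λ x → sum ys (λ y → f (g x y)))
    sum-cartesianProductWith g []       ys = refl
    sum-cartesianProductWith g (x ∷ xs) ys = trans (sum-++ (map (g x) ys) _)
      (+-cong (sum-map (g x) ys) (sum-cartesianProductWith g xs ys))

    sum-+ : ∀ xs (f g : A → Carrier) → sum xs (λ x → f x + g x) ≈ sum xs f + sum xs g
    sum-+ []       f g = sym (+-identityˡ _)
    sum-+ (x ∷ xs) f g = trans (+-congˡ (sum-+ xs f g)) (interchange _ _ _ _)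

    sum-*ˡ : ∀ c xs (f : A → Carrier) → c * sum xs f ≈ sum xs (λ x → c * f x)
    sum-*ˡ c []       f = zeroʳ c
    sum-*ˡ c (x ∷ xs) f = trans (distribˡ _ _ _) (+-congˡ (sum-*ˡ c xs f))

    sum-*ʳ : ∀ c xs (f : A → Carrier) → sum xs f * c ≈ sum xs (λ x → f x * c)
    sum-*ʳ c []       f = zeroˡ c
    sum-*ʳ c (x ∷ xs) f = trans (distribʳ _ _ _) (+-congˡ (sum-*ʳ c xs f))

  sum-swap : ∀ {a b} {A : Set a} {B : Set b} xs ys (f : A → B → Carrier) →
             sum xs (λ x → sum ys (f x)) ≈ sum ys (λ y → sum xs (λ x → f x y))
  sum-swap []       ys f = sym (sum-0 ys λ _ → refl)
  sum-swap (x ∷ xs) ys f = trans (+-congˡ (sum-swap xs ys f)) (sym (sum-+ ys _ _))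

  module _ {a} {A : Set a} where

    sum-once : ∀ {p} {P : A → Set p} {k xs} {f : A → Carrier} → Once P xs →
               (∀ {x} → x ∈ xs → P x → f x ≈ k) → (∀ {x} → x ∈ xs → ¬ P x → f x ≈ 0#) → sum xs f ≈ k
    sum-once (here {xs = xs} px ¬p) yes! no! = trans
      (+-cong (yes! (here ≡.refl) px) (sum-0-∈ xs λ x∈ → no! (there x∈) (All.lookup ¬p x∈)))
      (+-identityʳ _)
    sum-once (there ¬p o) yes! no! = trans
      (+-cong (no! (here ≡.refl) ¬p) (sum-once o (yes! ∘ there) (no! ∘ there)))
      (+-identityˡ _)

    sum-filter : ∀ {p} {P : A → Set p} (P? : ∀ x → Dec (P x)) xs (f : A → Carrier) →
                 sum (filter P? xs) f ≈ sum xs (λ x → ind (P? x) * f x)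
    sum-filter P? []       f = refl
    sum-filter P? (x ∷ xs) f with P? x
    ... | yes _ = +-cong (sym (*-identityˡ _)) (sum-filter P? xs f)
    ... | no  _ = trans (sum-filter P? xs f) (sym (trans (+-congʳ (zeroˡ _)) (+-identityˡ _)))

    sum-peel : ∀ {p} {P : A → Set p} (P? : ∀ x → Dec (P x)) {k xs} (f : A → Carrier) → Once P xs →
               (∀ {x} → P x → f x ≈ k) → sum xs f ≈ k + sum (filter (¬? ∘ P?) xs) f
    sum-peel P? {k} {xs} f o yes! = begin
      sum xs f
        ≈⟨ sum-cong xs (λ x → split x (P? x)) ⟩
      sum xs (λ x → ind (P? x) * f x + ind (¬? (P? x)) * f x)
        ≈⟨ sum-+ xs _ _ ⟩
      sum xs (λ x → ind (P? x) * f x) + sum xs (λ x → ind (¬? (P? x)) * f x)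
        ≈⟨ +-cong (sum-once o
             (λ {x} _ px → trans (*-congʳ (ind-yes (P? x) px)) (trans (*-identityˡ _) (yes! px)))
             (λ {x} _ ¬px → trans (*-congʳ (ind-no (P? x) ¬px)) (zeroˡ _)))
           (sym (sum-filter (¬? ∘ P?) xs f)) ⟩
      k + sum (filter (¬? ∘ P?) xs) f
        ∎
      where
      split : ∀ x (d : Dec _) → f x ≈ ind d * f x + ind (¬? d) * f x
      split x (yes _) = sym (trans (+-cong (*-identityˡ _) (zeroˡ _)) (+-identityʳ _))
      split x (no _)  = sym (trans (+-cong (zeroˡ _) (*-identityˡ _)) (+-identityˡ _))

  sum-product : ∀ {a b} {A : Set a} {B : Set b} (f : A → Carrier) (g : B → Carrier) xs ys →
                sum xs (λ x → sum ys (λ y → f x * g y)) ≈ sum xs f * sum ys g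
  sum-product f g xs ys = trans (sum-cong xs λ x → sym (sum-*ˡ (f x) ys g)) (sym (sum-*ʳ (sum ys g) xs f))

  -- Double counting: both sides equal the sum over all pairs related by `T`, in which every entry
  -- has exactly one partner.
  sum-reindex : ∀ {a b t} {A : Set a} {B : Set b} {T : A → B → Set t} (T? : ∀ x y → Dec (T x y)) xs ys
    {f : A → Carrier} {g : B → Carrier} →
    (∀ {x} → x ∈ xs → Once (T x) ys) → (∀ {y} → y ∈ ys → Once (λ x → T x y) xs) →
    (∀ {x y} → T x y → f x ≈ g y) → sum xs f ≈ sum ys g
  sum-reindex T? xs ys {f} {g} right left eq = begin
    sum xs f
      ≈⟨ sum-cong-∈ xs (λ {x} x∈ → sym (sum-once (right x∈)
           (λ {y} _ t → trans (*-congʳ (ind-yes (T? x y) t)) (trans (*-identityˡ _) (sym (eq t))))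
           (λ {y} _ ¬t → trans (*-congʳ (ind-no (T? x y) ¬t)) (zeroˡ _)))) ⟩
    sum xs (λ x → sum ys (λ y → ind (T? x y) * g y))
      ≈⟨ sum-swap xs ys _ ⟩
    sum ys (λ y → sum xs (λ x → ind (T? x y) * g y))
      ≈⟨ sum-cong-∈ ys (λ {y} y∈ → sum-once (left y∈)
           (λ {x} _ t → trans (*-congʳ (ind-yes (T? x y) t)) (*-identityˡ _))
           (λ {x} _ ¬t → trans (*-congʳ (ind-no (T? x y) ¬t)) (zeroˡ _))) ⟩
    sum ys g
      ∎

-- Evaluating formal linear combinations in an algebra

module Evaluation {c e a b} (K : CommutativeRing c e) (A : AssociativeAlgebra K a b) where

  private module K = CommutativeRing K
  open AssociativeAlgebra A
  open FreeModule K
  open ListSum ring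
  open SetoidReasoning setoid
  module ι = RingMorphisms.IsRingHomomorphism ι-isRingHomomorphism
  open CommutativeSemigroupProperties +-commutativeSemigroup using (interchange; x∙yz≈y∙xz)

  -- The linear extension of `h`. With values in `K` it yields coefficients; with values in a test
  -- algebra it yields the map demanded by the universal property.
  eval : ∀ {b} {B : Set b} → (B → Carrier) → Lin B → Carrier
  eval h x = sum x λ (k , b) → ι k * h b

  module _ {ℓ} {B : Set ℓ} where

    eval-cong : ∀ {h h′ : B → Carrier} x → (∀ b → h b ≈ h′ b) → eval h x ≈ eval h′ x
    eval-cong x eq = sum-cong x λ (k , b) → *-congˡ (eq b)

    eval-+ : ∀ (g h : B → Carrier) x → eval (λ b → g b + h b) x ≈ eval g x + eval h x
    eval-+ g h x = trans (sum-cong x λ _ → distribˡ _ _ _) (sum-+ x _ _)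

    eval-basis : ∀ (h : B → Carrier) b → eval h (basis b) ≈ h b
    eval-basis h b = trans (+-identityʳ _) (trans (*-congʳ ι.1#-homo) (*-identityˡ _))

    eval-++ : ∀ {h : B → Carrier} x y → eval h (x ++ y) ≈ eval h x + eval h y
    eval-++ x y = sum-++ x y

    eval-• : ∀ {h : B → Carrier} k x → eval h (k • x) ≈ ι k * eval h x
    eval-• {h} k x = begin
      eval h (k • x)                            ≈⟨ sum-map _ x ⟩
      sum x (λ (l , b) → ι (k K.* l) * h b)     ≈⟨ sum-cong x (λ _ → trans (*-congʳ (ι.*-homo _ _)) (*-assoc _ _ _)) ⟩
      sum x (λ (l , b) → ι k * (ι l * h b))     ≈⟨ sum-*ˡ (ι k) x _ ⟨
      ι k * eval h x                            ∎

    eval-∑ : ∀ {m} {M : Set m} (h : B → Carrier) xs (f : M → Lin B) →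
             eval h (∑ xs f) ≈ sum xs (λ m → eval h (f m))
    eval-∑ h xs f = sum-concatMap f xs

    eval-*ˡ : ∀ {h : B → Carrier} u x → u * eval h x ≈ eval (λ b → u * h b) x
    eval-*ˡ u x = trans (sum-*ˡ u x _) (sum-cong x λ (k , b) →
      trans (sym (*-assoc _ _ _)) (trans (*-congʳ (sym (ι-central k u))) (*-assoc _ _ _)))

    eval-*ʳ : ∀ {h : B → Carrier} u x → eval h x * u ≈ eval (λ b → h b * u) x
    eval-*ʳ u x = trans (sum-*ʳ u x _) (sum-cong x λ (k , b) → *-assoc _ _ _)

    eval-sum : ∀ {m} {M : Set m} {h : B → M → Carrier} ms x →
               eval (λ b → sum ms (h b)) x ≈ sum ms (λ m → eval (λ b → h b m) x)
    eval-sum ms x = trans (sum-cong x λ (k , b) → sum-*ˡ (ι k) ms _) (sum-swap x ms _)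

  eval-extend : ∀ {ℓ m} {B : Set ℓ} {M : Set m} (h : B → Carrier) (f : M → Lin B) x →
                eval h (extend f x) ≈ eval (λ m → eval h (f m)) x
  eval-extend h f x = trans (sum-concatMap _ x) (sum-cong x λ (k , m) → eval-• k (f m))

  eval-extend₂ : ∀ {ℓ m n} {B : Set ℓ} {M : Set m} {N : Set n} (h : B → Carrier) (f : M → N → Lin B) x y →
                 eval h (extend₂ f x y) ≈ eval (λ m → eval (λ n → eval h (f m n)) y) x
  eval-extend₂ h f x y = trans (eval-extend h _ x) (eval-cong x λ m → eval-extend h (f m) y)

  eval-product : ∀ {m n} {M : Set m} {N : Set n} (f : M → Carrier) (g : N → Carrier) x y →
                 eval (λ m → eval (λ n → f m * g n) y) x ≈ eval f x * eval g y
  eval-product f g x y = trans (eval-cong x λ m → sym (eval-*ˡ (f m) y)) (sym (eval-*ʳ (eval g y) x))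

  module _ {s r} (B : DecSetoid s r) where

    private module B = DecSetoid B

    remove : B.Carrier → Lin B.Carrier → Lin B.Carrier
    remove b = filter λ (_ , b′) → ¬? (b′ B.≟ b)

    private

      coeff-remove-≉ : ∀ {b b′} x → ¬ b′ B.≈ b → coeff B (remove b x) b′ K.≈ coeff B x b′
      coeff-remove-≉ []            b′≉b = K.refl
      coeff-remove-≉ {b} {b′} ((k , y) ∷ x) b′≉b with y B.≟ b
      ... | no  _   = K.+-congˡ (coeff-remove-≉ x b′≉b)
      ... | yes y≈b with y B.≟ b′
      ...   | yes y≈b′ = contradiction (B.trans (B.sym y≈b′) y≈b) b′≉b
      ...   | no  _    = K.trans (coeff-remove-≉ x b′≉b) (K.sym (K.+-identityˡ _))

      coeff-remove-≈ : ∀ {b b′} x → b′ B.≈ b → coeff B (remove b x) b′ K.≈ K.0#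
      coeff-remove-≈ []            b′≈b = K.refl
      coeff-remove-≈ {b} {b′} ((k , y) ∷ x) b′≈b with y B.≟ b
      ... | yes _   = coeff-remove-≈ x b′≈b
      ... | no  y≉b with y B.≟ b′
      ...   | yes y≈b′ = contradiction (B.trans y≈b′ b′≈b) y≉b
      ...   | no  _    = K.trans (K.+-identityˡ _) (coeff-remove-≈ x b′≈b)

    module _ {h : B.Carrier → Carrier} (h-cong : ∀ {b b′} → b B.≈ b′ → h b ≈ h b′) where

      eval-remove : ∀ b x → eval h x ≈ ι (coeff B x b) * h b + eval h (remove b x)
      eval-remove b []            = sym (trans (+-identityʳ _) (trans (*-congʳ ι.0#-homo) (zeroˡ _)))
      eval-remove b ((k , y) ∷ x) with y B.≟ b
      ... | yes y≈b = begin
        ι k * h y + eval h x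
          ≈⟨ +-cong (*-congˡ (h-cong y≈b)) (eval-remove b x) ⟩
        ι k * h b + (ι (coeff B x b) * h b + eval h (remove b x))
          ≈⟨ +-assoc _ _ _ ⟨
        ι k * h b + ι (coeff B x b) * h b + eval h (remove b x)
          ≈⟨ +-congʳ (trans (*-congʳ (ι.+-homo _ _)) (distribʳ _ _ _)) ⟨
        ι (k K.+ coeff B x b) * h b + eval h (remove b x)
          ∎
      ... | no  _   = begin
        ι k * h y + eval h x
          ≈⟨ +-congˡ (eval-remove b x) ⟩
        ι k * h y + (ι (coeff B x b) * h b + eval h (remove b x))
          ≈⟨ x∙yz≈y∙xz _ _ _ ⟩
        ι (coeff B x b) * h b + (ι k * h y + eval h (remove b x))
          ≈⟨ +-congʳ (*-congʳ (ι.⟦⟧-cong (K.+-identityˡ _))) ⟨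
        ι (K.0# K.+ coeff B x b) * h b + (ι k * h y + eval h (remove b x))
          ∎

      -- A formal sum may list a basis element several times, so all terms equivalent to the first
      -- are collected into one coefficient and removed, which shortens the list. The hypothesis
      -- concerns products, so that a triangularity argument can let the coefficient vanish for some
      -- `b` and the value for the others.
      eval-vanishes : ∀ x → (∀ b → ι (coeff B x b) * h b ≈ 0#) → eval h x ≈ 0#
      eval-vanishes x = go (length x) x ℕₚ.≤-refl
        where
        go : ∀ n x → length x ≤ n → (∀ b → ι (coeff B x b) * h b ≈ 0#) → eval h x ≈ 0#
        go n       []            len      z = refl
        go (suc n) ((k , b) ∷ x) (s≤s len) z = begin
          eval h x₀                                          ≈⟨ eval-remove b x₀ ⟩
          ι (coeff B x₀ b) * h b + eval h (remove b x₀)      ≈⟨ +-cong (z b) (go n (remove b x₀) shorter z′) ⟩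
          0# + 0#                                            ≈⟨ +-identityˡ _ ⟩
          0#                                                 ∎
          where
          x₀ = (k , b) ∷ x
          shorter : length (remove b x₀) ≤ n
          shorter with b B.≟ b
          ... | yes _   = ℕₚ.≤-trans (Listₚ.length-filter _ x) len
          ... | no  b≉b = contradiction B.refl b≉b
          z′ : ∀ b′ → ι (coeff B (remove b x₀) b′) * h b′ ≈ 0#
          z′ b′ with b′ B.≟ b
          ... | yes b′≈b = trans (*-congʳ (trans (ι.⟦⟧-cong (coeff-remove-≈ x₀ b′≈b)) ι.0#-homo)) (zeroˡ _)
          ... | no  b′≉b = trans (*-congʳ (ι.⟦⟧-cong (coeff-remove-≉ x₀ b′≉b))) (z b′)

selfAlgebra : ∀ {c e} (K : CommutativeRing c e) → AssociativeAlgebra K c e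
selfAlgebra K = record
  { ring                 = ring
  ; ι                    = id
  ; ι-isRingHomomorphism = isRingHomomorphism rawRing refl
  ; ι-central            = *-comm
  }
  where
  open CommutativeRing K

module Coefficients {c e} (K : CommutativeRing c e) where

  open CommutativeRing K
  open FreeModule K
  open ListSum ring public
  open Evaluation K (selfAlgebra K) public
  open SetoidReasoning setoid

  module _ {s r} (B : DecSetoid s r) where

    private module B = DecSetoid B

    coeff-eval : ∀ x y → coeff B x y ≈ eval (λ b → ind (b B.≟ y)) x
    coeff-eval []            y = refl
    coeff-eval ((k , b) ∷ x) y with b B.≟ y
    ... | yes _ = +-cong (sym (*-identityʳ k)) (coeff-eval x y)
    ... | no  _ = +-cong (sym (zeroʳ k)) (coeff-eval x y)

    coeff-++ : ∀ x y b → coeff B (x ++ y) b ≈ coeff B x b + coeff B y b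
    coeff-++ x y b = trans (coeff-eval (x ++ y) b)
      (trans (eval-++ x y) (+-cong (sym (coeff-eval x b)) (sym (coeff-eval y b))))

    coeff-• : ∀ k x b → coeff B (k • x) b ≈ k * coeff B x b
    coeff-• k x b = trans (coeff-eval (k • x) b) (trans (eval-• k x) (*-congˡ (sym (coeff-eval x b))))

    difference : Lin B.Carrier → Lin B.Carrier → Lin B.Carrier
    difference x y = x ++ (- 1#) • y

    coeff-difference : ∀ x y b → coeff B x b ≈ coeff B y b → coeff B (difference x y) b ≈ 0#
    coeff-difference x y b eq = begin
      coeff B (difference x y) b                ≈⟨ coeff-++ x ((- 1#) • y) b ⟩
      coeff B x b + coeff B ((- 1#) • y) b      ≈⟨ +-cong eq (coeff-• (- 1#) y b) ⟩
      coeff B y b + (- 1#) * coeff B y b        ≈⟨ +-congˡ (RingProperties.-1*x≈-x ring _) ⟩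
      coeff B y b - coeff B y b                 ≈⟨ -‿inverseʳ _ ⟩
      0#                                        ∎

module EvaluationCong {c e a b} (K : CommutativeRing c e) (A : AssociativeAlgebra K a b) {s r} (B : DecSetoid s r) where

  private
    module K = CommutativeRing K
    module B = DecSetoid B
    module C = Coefficients K
  open AssociativeAlgebra A
  open FreeModule K
  open Evaluation K A
  open SetoidReasoning setoid

  eval-difference : ∀ {h : B.Carrier → Carrier} x y → eval h (C.difference B x y) ≈ 0# → eval h x ≈ eval h y
  eval-difference {h} x y eq = begin
    eval h x                                        ≈⟨ +-identityʳ _ ⟨
    eval h x + 0#                                   ≈⟨ +-congˡ (-‿inverseˡ _) ⟨
    eval h x + (- eval h y + eval h y)              ≈⟨ +-assoc _ _ _ ⟨
    eval h x + - eval h y + eval h y                ≈⟨ +-congʳ (+-congˡ -1•) ⟨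
    eval h x + eval h ((K.- K.1#) • y) + eval h y   ≈⟨ +-congʳ (eval-++ x ((K.- K.1#) • y)) ⟨
    eval h (C.difference B x y) + eval h y          ≈⟨ +-congʳ eq ⟩
    0# + eval h y                                   ≈⟨ +-identityˡ _ ⟩
    eval h y                                        ∎
    where
    -1• : eval h ((K.- K.1#) • y) ≈ - eval h y
    -1• = trans (eval-• (K.- K.1#) y) (trans
      (*-congʳ (trans (ι.-‿homo K.1#) (-‿cong ι.1#-homo)))
      (RingProperties.-1*x≈-x ring _))

  -- Formal sums are equal when their coefficients agree, so a map defined on the list of terms has
  -- to be checked against this equality.
  eval-respects : ∀ {h : B.Carrier → Carrier} → (∀ {b b′} → b B.≈ b′ → h b ≈ h b′) →
                  ∀ x y → (∀ b → coeff B x b K.≈ coeff B y b) → eval h x ≈ eval h y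
  eval-respects h-cong x y eq = eval-difference x y (eval-vanishes B h-cong (C.difference B x y) λ b →
    trans (*-congʳ (trans (ι.⟦⟧-cong (C.coeff-difference B x y b (eq b))) ι.0#-homo)) (zeroˡ _))

-- Elements of FQSym as functions on words

module WordFunctions {c e} (K : CommutativeRing c e) (ℓ : ℕ) where

  open CommutativeRing K
  open ColoredAlgebra K ℓ renaming (_≈_ to infix 4 _≈ᶠ_)
  open Coefficients K
  open SetoidReasoning setoid
  open CommutativeSemigroupProperties *-commutativeSemigroup using (interchange)

  private
    CP : Set
    CP = ColoredPermutation ℓ

    𝕊 = coloredPermutationDecSetoid ℓ

  -- Extends the coefficient function of x to all words: for a word with
  -- distinct letters, ⟦ x ⟧ w is the coefficient of its standardization.
  ⟦_⟧ : FQSym → Word ℓ → Carrier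
  ⟦ x ⟧ w = eval (λ a → ind (biword a ≋? w)) x

  coeff-⟦⟧ : ∀ x {c w} → biword c ≋ w → coeff 𝕊 x c ≈ ⟦ x ⟧ w
  coeff-⟦⟧ x {c} {w} c≋w = trans (coeff-eval 𝕊 x c) (eval-cong x λ a →
    ind-cong (DecSetoid._≟_ 𝕊 a c) (biword a ≋? w)
      (λ eq → ≡.subst (_≋ w) (≡.sym eq) c≋w)
      (λ a≋w → biword-≋⇒≡ {a = a} {c} (≋-trans a≋w (≋-sym c≋w))))

  ⟦⟧-cong : ∀ x y → x ≈ᶠ y → ∀ {w} → Distinct w → ⟦ x ⟧ w ≈ ⟦ y ⟧ w
  ⟦⟧-cong x y x≈y {w} d with standardize w d
  ... | a , a≋w = trans (sym (coeff-⟦⟧ x a≋w)) (trans (x≈y a) (coeff-⟦⟧ y a≋w))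

  -- Together with `⟦⟧-cong` this turns an identity in FQSym into one between functions on words.
  -- The laws of the product below are proved in this way.
  ⟦⟧-ext : ∀ x y → (∀ {w} → Distinct w → ⟦ x ⟧ w ≈ ⟦ y ⟧ w) → x ≈ᶠ y
  ⟦⟧-ext x y h c = trans (coeff-⟦⟧ x ≋-refl) (trans (h (distinct-biword c)) (sym (coeff-⟦⟧ y ≋-refl)))

  ⟦⟧-≋ : ∀ x {v w} → v ≋ w → ⟦ x ⟧ v ≈ ⟦ x ⟧ w
  ⟦⟧-≋ x {v} {w} v≋w = eval-cong x λ a →
    ind-cong (biword a ≋? v) (biword a ≋? w) (λ p → ≋-trans p v≋w) (λ p → ≋-trans p (≋-sym v≋w))

  ⟦⟧-extend : ∀ {b} {B : Set b} (f : B → FQSym) x {w} → ⟦ extend f x ⟧ w ≈ eval (λ b → ⟦ f b ⟧ w) x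
  ⟦⟧-extend f x = eval-extend _ f x

  ⟦⟧-∑ : ∀ {b} {B : Set b} (f : B → FQSym) xs {w} → ⟦ ∑ xs f ⟧ w ≈ sum xs (λ b → ⟦ f b ⟧ w)
  ⟦⟧-∑ f xs = eval-∑ _ xs f

  private

    shape-length-no : ∀ {n} (σ : Permutation′ n) (u : Vec (Fin ℓ) n) w → length w ≢ n → ¬ biword ⟨ σ , u ⟩ ≋ w
    shape-length-no σ u w len eq =
      len (≡.trans (≡.sym (≋-length (biword ⟨ σ , u ⟩) w eq)) (length-biword ⟨ σ , u ⟩))

    -- Each side has at most one nonzero term: on the left the standardization of `w`, on the right
    -- the cut after `size a` letters. If `w` has the wrong length, both sides are 0.
    G·G : ∀ a b {w} → Distinct w →
      ⟦ ∑ (convolution (perm a) (perm b)) (λ σ → G ⟨ σ , colors a Vec.++ colors b ⟩) ⟧ w ≈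
      sum (splits w) (λ (u , v) → ind (biword a ≋? u) * ind (biword b ≋? v))
    G·G a b {w} d = trans expand (compare (length w ℕₚ.≟ n))
      where
      n = size a ℕ.+ size b

      cp : Permutation′ n → CP
      cp σ = ⟨ σ , colors a Vec.++ colors b ⟩

      τ? : ∀ σ → Dec _
      τ? σ = σ ∈? perm a * perm b

      left : Permutation′ n → Carrier
      left σ = ind (τ? σ) * ind (biword (cp σ) ≋? w)

      right : Word ℓ × Word ℓ → Carrier
      right (u , v) = ind (biword a ≋? u) * ind (biword b ≋? v)

      expand : ⟦ ∑ (convolution (perm a) (perm b)) (G ∘ cp) ⟧ w ≈ sum (permutations n) left
      expand = begin
        ⟦ ∑ (convolution (perm a) (perm b)) (G ∘ cp) ⟧ w
          ≈⟨ ⟦⟧-∑ (G ∘ cp) (convolution (perm a) (perm b)) ⟩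
        sum (convolution (perm a) (perm b)) (λ σ → ⟦ G (cp σ) ⟧ w)
          ≈⟨ sum-cong (convolution (perm a) (perm b)) (λ σ → eval-basis (λ a → ind (biword a ≋? w)) (cp σ)) ⟩
        sum (convolution (perm a) (perm b)) (λ σ → ind (biword (cp σ) ≋? w))
          ≈⟨ sum-filter τ? (permutations n) _ ⟩
        sum (permutations n) left
          ∎

      right-no : ∀ {u v} → ¬ (biword a ≋ u × biword b ≋ v) → right (u , v) ≈ 0#
      right-no {u} {v} no! = trans
        (ind-* (biword a ≋? u) (biword b ≋? v) ((biword a ≋? u) ×-dec (biword b ≋? v)) _,_ id)
        (ind-no ((biword a ≋? u) ×-dec (biword b ≋? v)) no!)

      left-no : ∀ {σ} → ¬ biword (cp σ) ≋ w → left σ ≈ 0#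
      left-no {σ} no! = trans (*-congˡ (ind-no (biword (cp σ) ≋? w) no!)) (zeroʳ _)

      pieces-length : ∀ {u v} → biword a ≋ u → length u ≡ size a
      pieces-length {u} a≋u = ≡.trans (≡.sym (≋-length (biword a) u a≋u)) (length-biword a)

      matching : ∀ u v → w ≡ u ++ v → length u ≡ size a → length w ≡ n →
                 sum (permutations n) left ≈ sum (splits w) right
      matching u v ≡.refl len lenw = trans
        (sum-once (once-standardization n (letters w) d (≡.trans (Listₚ.length-map proj₁ w) lenw))
          (λ {σ} _ s → ind-both σ s)
          (λ {σ} _ ¬s → left-no {σ} (¬s ∘ proj₁ ∘ biword-≋⁻ σ (colors a Vec.++ colors b) w)))
        (sym (sum-once (once-splits u v) (λ { _ ≡.refl → refl }) (λ s∈ s≢ → right-no (miss s∈ s≢))))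
        where
        ind-both : ∀ σ → shape (oneLine σ) ≡ shape (letters (u ++ v)) → left σ ≈ right (u , v)
        ind-both σ s = trans
          (ind-* (τ? σ) (biword (cp σ) ≋? w) ((biword a ≋? u) ×-dec (biword b ≋? v))
            (convolution⁻ a b σ {u} {v} len s)
            (λ (p , q) → convolution⁺ a b σ {u} {v} len s p q , convolution-hues a b σ {u} {v} len s p q))
          (sym (ind-* (biword a ≋? u) (biword b ≋? v) ((biword a ≋? u) ×-dec (biword b ≋? v)) _,_ id))

        miss : ∀ {s} → s ∈ splits w → (u , v) ≢ s → ¬ (biword a ≋ proj₁ s × biword b ≋ proj₂ s)
        miss {u′ , v′} s∈ s≢ (a≋u′ , _) = s≢ (≡.cong₂ _,_ (proj₁ eq) (proj₂ eq))
          where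
          eq = ++-injective u u′ (≡.trans len (≡.sym (pieces-length {v = v′} a≋u′))) (≡.sym (∈-splits⁻ w s∈))

      compare : Dec (length w ≡ n) → sum (permutations n) left ≈ sum (splits w) right
      compare (no len≢) = trans
        (sum-0 (permutations n) λ σ → left-no {σ} (shape-length-no σ (colors a Vec.++ colors b) w len≢))
        (sym (sum-0-∈ (splits w) λ {(u , v)} s∈ → right-no λ (a≋u , b≋v) → len≢ (≡.trans
          (≡.trans (≡.cong length (≡.sym (∈-splits⁻ w s∈))) (Listₚ.length-++ u))
          (≡.cong₂ ℕ._+_ (pieces-length {v = v} a≋u)
            (≡.trans (≡.sym (≋-length (biword b) v b≋v)) (length-biword b))))))
      compare (yes len) = matching (take (size a) w) (drop (size a) w) (≡.sym (Listₚ.take++drop≡id (size a) w))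
        (≡.trans (Listₚ.length-take (size a) w) (≡.trans (≡.cong (size a ℕ.⊓_) len) (ℕₚ.m≤n⇒m⊓n≡m (ℕₚ.m≤m+n (size a) (size b)))))
        len

  -- The product of FQSym is dual to deconcatenation.
  ⟦·⟧ : ∀ x y {w} → Distinct w → ⟦ x · y ⟧ w ≈ sum (splits w) (λ (u , v) → ⟦ x ⟧ u * ⟦ y ⟧ v)
  ⟦·⟧ x y {w} d = begin
    ⟦ x · y ⟧ w
      ≈⟨ eval-extend₂ (λ a → ind (biword a ≋? w)) _ x y ⟩
    eval (λ a → eval (λ b → ⟦ ∑ (convolution (perm a) (perm b)) (λ σ → G ⟨ σ , colors a Vec.++ colors b ⟩) ⟧ w) y) x
      ≈⟨ eval-cong x (λ a → trans (eval-cong y (λ b → G·G a b d)) (eval-sum (splits w) y)) ⟩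
    eval (λ a → sum (splits w) (λ (u , v) → eval (λ b → ind (biword a ≋? u) * ind (biword b ≋? v)) y)) x
      ≈⟨ eval-sum (splits w) x ⟩
    sum (splits w) (λ (u , v) → eval (λ a → eval (λ b → ind (biword a ≋? u) * ind (biword b ≋? v)) y) x)
      ≈⟨ sum-cong (splits w) (λ (u , v) → eval-product _ _ x y) ⟩
    sum (splits w) (λ (u , v) → ⟦ x ⟧ u * ⟦ y ⟧ v)
      ∎

  distinct-splits : ∀ (w : Word ℓ) {u v} → Distinct w → (u , v) ∈ splits w → Distinct u × Distinct v
  distinct-splits w {u} d s∈ = distinct-++⁻ u (≡.subst Distinct (≡.sym (∈-splits⁻ w s∈)) d)

  ·-cong : ∀ x x′ y y′ → x ≈ᶠ x′ → y ≈ᶠ y′ → x · y ≈ᶠ x′ · y′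
  ·-cong x x′ y y′ x≈ y≈ = ⟦⟧-ext (x · y) (x′ · y′) λ {w} d → trans (⟦·⟧ x y d) (trans
    (sum-cong-∈ (splits w) λ s∈ → let du , dv = distinct-splits w d s∈ in
      *-cong (⟦⟧-cong x x′ x≈ du) (⟦⟧-cong y y′ y≈ dv))
    (sym (⟦·⟧ x′ y′ d)))

  ⟦𝟙⟧-[] : ⟦ 𝟙 ⟧ [] ≈ 1#
  ⟦𝟙⟧-[] = trans (eval-basis (λ a → ind (biword a ≋? [])) ∅) (ind-yes (biword ∅ ≋? []) ≋-refl)

  ⟦𝟙⟧-∷ : ∀ l w → ⟦ 𝟙 ⟧ (l ∷ w) ≈ 0#
  ⟦𝟙⟧-∷ l w = trans (eval-basis (λ a → ind (biword a ≋? (l ∷ w))) ∅) (ind-no (biword ∅ ≋? (l ∷ w)) λ { (() , _) })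

  ·-identityˡ : ∀ x → 𝟙 · x ≈ᶠ x
  ·-identityˡ x = ⟦⟧-ext (𝟙 · x) x λ {w} d → trans (⟦·⟧ 𝟙 x d) (first w)
    where
    first : ∀ w → sum (splits w) (λ (u , v) → ⟦ 𝟙 ⟧ u * ⟦ x ⟧ v) ≈ ⟦ x ⟧ w
    first []      = trans (+-identityʳ _) (trans (*-congʳ ⟦𝟙⟧-[]) (*-identityˡ _))
    first (l ∷ w) = trans (+-cong (trans (*-congʳ ⟦𝟙⟧-[]) (*-identityˡ _))
      (trans (sum-map (Product.map₁ (l ∷_)) (splits w)) (sum-0 (splits w) λ (u , v) → trans (*-congʳ (⟦𝟙⟧-∷ l u)) (zeroˡ _))))
      (+-identityʳ _)

  ·-identityʳ : ∀ x → x · 𝟙 ≈ᶠ x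
  ·-identityʳ x = ⟦⟧-ext (x · 𝟙) x λ {w} d → trans (⟦·⟧ x 𝟙 d) (last ⟦ x ⟧ w)
    where
    last : ∀ f w → sum (splits w) (λ (u , v) → f u * ⟦ 𝟙 ⟧ v) ≈ f w
    last f []      = trans (+-identityʳ _) (trans (*-congˡ ⟦𝟙⟧-[]) (*-identityʳ _))
    last f (l ∷ w) = trans (+-cong (trans (*-congˡ (⟦𝟙⟧-∷ l w)) (zeroʳ _))
      (trans (sum-map (Product.map₁ (l ∷_)) (splits w)) (last (f ∘ (l ∷_)) w)))
      (+-identityˡ _)

  -- Coassociativity of deconcatenation: both sides run over the cuts of `w` into three factors.
  splits-coassoc : ∀ (f : Word ℓ → Word ℓ → Word ℓ → Carrier) w →
    sum (splits w) (λ (s , v) → sum (splits s) (λ (t , u) → f t u v)) ≈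
    sum (splits w) (λ (t , s) → sum (splits s) (λ (u , v) → f t u v))
  splits-coassoc f []      = refl
  splits-coassoc f (l ∷ w) = begin
    (f [] [] (l ∷ w) + 0#) + sum (map (Product.map₁ (l ∷_)) (splits w)) (λ (s , v) → sum (splits s) (λ (t , u) → f t u v))
      ≈⟨ +-cong (+-identityʳ _) (sum-map (Product.map₁ (l ∷_)) (splits w)) ⟩
    f [] [] (l ∷ w) + sum (splits w) (λ (s , v) → f [] (l ∷ s) v + sum (map (Product.map₁ (l ∷_)) (splits s)) (λ (t , u) → f t u v))
      ≈⟨ +-congˡ (sum-cong (splits w) λ (s , v) → +-congˡ (sum-map (Product.map₁ (l ∷_)) (splits s))) ⟩
    f [] [] (l ∷ w) + sum (splits w) (λ (s , v) → f [] (l ∷ s) v + sum (splits s) (λ (t , u) → f (l ∷ t) u v))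
      ≈⟨ +-congˡ (sum-+ (splits w) _ _) ⟩
    f [] [] (l ∷ w) + (sum (splits w) (λ (s , v) → f [] (l ∷ s) v) + sum (splits w) (λ (s , v) → sum (splits s) (λ (t , u) → f (l ∷ t) u v)))
      ≈⟨ +-assoc _ _ _ ⟨
    (f [] [] (l ∷ w) + sum (splits w) (λ (s , v) → f [] (l ∷ s) v)) + sum (splits w) (λ (s , v) → sum (splits s) (λ (t , u) → f (l ∷ t) u v))
      ≈⟨ +-cong (+-congˡ (sym (sum-map (Product.map₁ (l ∷_)) (splits w)))) (splits-coassoc (f ∘ (l ∷_)) w) ⟩
    sum (splits (l ∷ w)) (λ (u , v) → f [] u v) + sum (splits w) (λ (t , s) → sum (splits s) (λ (u , v) → f (l ∷ t) u v))
      ≈⟨ +-congˡ (sum-map (Product.map₁ (l ∷_)) (splits w)) ⟨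
    sum (splits (l ∷ w)) (λ (t , s) → sum (splits s) (λ (u , v) → f t u v))
      ∎

  ·-assoc : ∀ x y z → (x · y) · z ≈ᶠ x · (y · z)
  ·-assoc x y z = ⟦⟧-ext ((x · y) · z) (x · (y · z)) λ {w} d → begin
    ⟦ (x · y) · z ⟧ w
      ≈⟨ ⟦·⟧ (x · y) z d ⟩
    sum (splits w) (λ (s , v) → ⟦ x · y ⟧ s * ⟦ z ⟧ v)
      ≈⟨ sum-cong-∈ (splits w) (λ {(s , v)} s∈ → trans
           (*-congʳ (⟦·⟧ x y (proj₁ (distinct-splits w d s∈)))) (sum-*ʳ (⟦ z ⟧ v) (splits s) _)) ⟩
    sum (splits w) (λ (s , v) → sum (splits s) (λ (t , u) → ⟦ x ⟧ t * ⟦ y ⟧ u * ⟦ z ⟧ v))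
      ≈⟨ splits-coassoc (λ t u v → ⟦ x ⟧ t * ⟦ y ⟧ u * ⟦ z ⟧ v) w ⟩
    sum (splits w) (λ (t , s) → sum (splits s) (λ (u , v) → ⟦ x ⟧ t * ⟦ y ⟧ u * ⟦ z ⟧ v))
      ≈⟨ sum-cong-∈ (splits w) (λ {(t , s)} s∈ → trans
           (sum-cong (splits s) (λ _ → *-assoc _ _ _)) (trans (sym (sum-*ˡ (⟦ x ⟧ t) (splits s) _))
           (*-congˡ (sym (⟦·⟧ y z (proj₂ (distinct-splits w d s∈))))))) ⟩
    sum (splits w) (λ (t , s) → ⟦ x ⟧ t * ⟦ y · z ⟧ s)
      ≈⟨ ⟦·⟧ x (y · z) d ⟨
    ⟦ x · (y · z) ⟧ w
      ∎

  ⟦S⟧ : ∀ n w → ⟦ S n ⟧ w ≈ ind (row? n w)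
  ⟦S⟧ n w = begin
    ⟦ S n ⟧ w
      ≈⟨ ⟦⟧-∑ _ (List.filter (hasContent? n) (words ∣ n ∣)) ⟩
    sum (List.filter (hasContent? n) (words ∣ n ∣)) (λ u → ⟦ G ⟨ idₚ , u ⟩ ⟧ w)
      ≈⟨ sum-filter (hasContent? n) (words ∣ n ∣) _ ⟩
    sum (words ∣ n ∣) (λ u → ind (hasContent? n u) * ⟦ G ⟨ idₚ , u ⟩ ⟧ w)
      ≈⟨ sum-cong (words ∣ n ∣) (λ u → *-congˡ (eval-basis (λ a → ind (biword a ≋? w)) ⟨ idₚ , u ⟩)) ⟩
    sum (words ∣ n ∣) term
      ≈⟨ case (row? n w) ⟩
    ind (row? n w)
      ∎
    where
    term : Vec (Fin ℓ) ∣ n ∣ → Carrier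
    term u = ind (hasContent? n u) * ind (biword ⟨ idₚ , u ⟩ ≋? w)

    case : (d : Dec (Row n w)) → sum (words ∣ n ∣) term ≈ ind d
    -- The colors of `w` single out one `u`, and `r` supplies its content.
    case (yes r) = sum-once (once-words ∣ n ∣ (hues w) (≡.trans (Listₚ.length-map proj₂ w) (row-length w r)))
      (λ {u} _ h → trans (*-cong
        (ind-yes (hasContent? n u) (hasContent⁺ u (≡.trans (≡.cong content h) (proj₂ r))))
        (ind-yes (biword ⟨ idₚ , u ⟩ ≋? w) (biword-id-≋⁺ u ≡.refl h r))) (*-identityˡ 1#))
      (λ {u} _ ¬h → trans (*-congˡ (ind-no (biword ⟨ idₚ , u ⟩ ≋? w) λ eq →
        ¬h (proj₂ (biword-≋⁻ idₚ u w eq)))) (zeroʳ _))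
    case (no ¬r) = sum-0 (words ∣ n ∣) λ u → miss u (hasContent? n u)
      where
      miss : ∀ u (d : Dec (HasContent n u)) → ind d * ind (biword ⟨ idₚ , u ⟩ ≋? w) ≈ 0#
      miss u (yes h) = trans (*-congˡ (ind-no (biword ⟨ idₚ , u ⟩ ≋? w) λ eq → ¬r (biword-id-≋⁻ u h eq))) (zeroʳ _)
      miss u (no _)  = zeroˡ _

  𝕊⊗𝕊 : DecSetoid _ _
  𝕊⊗𝕊 = ×-decSetoid 𝕊 𝕊

  private
    pair : CP → CP → FQSym⊗FQSym
    pair a a′ = basis (a , a′)

  coeff-⊗ : ∀ x y b → coeff 𝕊⊗𝕊 (x ⊗ y) b ≈ coeff 𝕊 x (proj₁ b) * coeff 𝕊 y (proj₂ b)
  coeff-⊗ x y (b , b′) = begin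
    coeff 𝕊⊗𝕊 (x ⊗ y) (b , b′)
      ≈⟨ coeff-eval 𝕊⊗𝕊 (x ⊗ y) (b , b′) ⟩
    eval (λ c → ind (DecSetoid._≟_ 𝕊⊗𝕊 c (b , b′))) (x ⊗ y)
      ≈⟨ eval-extend₂ _ pair x y ⟩
    eval (λ a → eval (λ a′ → eval (λ c → ind (DecSetoid._≟_ 𝕊⊗𝕊 c (b , b′))) (basis (a , a′))) y) x
      ≈⟨ eval-cong x (λ a → eval-cong y (λ a′ → trans (eval-basis (λ c → ind (DecSetoid._≟_ 𝕊⊗𝕊 c (b , b′))) (a , a′))
           (sym (ind-* (DecSetoid._≟_ 𝕊 a b) (DecSetoid._≟_ 𝕊 a′ b′) (DecSetoid._≟_ 𝕊⊗𝕊 (a , a′) (b , b′)) _,_ id)))) ⟩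
    eval (λ a → eval (λ a′ → ind (DecSetoid._≟_ 𝕊 a b) * ind (DecSetoid._≟_ 𝕊 a′ b′)) y) x
      ≈⟨ eval-product _ _ x y ⟩
    eval (λ a → ind (DecSetoid._≟_ 𝕊 a b)) x * eval (λ a′ → ind (DecSetoid._≟_ 𝕊 a′ b′)) y
      ≈⟨ *-cong (sym (coeff-eval 𝕊 x b)) (sym (coeff-eval 𝕊 y b′)) ⟩
    coeff 𝕊 x b * coeff 𝕊 y b′
      ∎

  private

    size-≡ : ∀ (a b : CP) → biword a ≡ biword b → size a ≡ size b
    size-≡ a b eq = ≡.trans (≡.sym (length-biword a)) (≡.trans (≡.cong length eq) (length-biword b))

    once-biword : ∀ n (b : CP) → size b ≡ n → Once (λ a → biword a ≡ biword b) (coloredPermutations n)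
    once-biword n b eq = once-⇔ (λ {a} → biword-≋⇒≡ {a = a} {b}) (λ eq → ≡.subst (_≋ biword b) (≡.sym eq) ≋-refl)
      (once-coloredPermutations n (biword b) (distinct-biword b) (≡.trans (length-biword b) eq))

    once-pairs : ∀ (b b′ : CP) n → size b ℕ.+ size b′ ≡ n →
      Once (λ (c , c′) → biword c ≡ biword b × biword c′ ≡ biword b′)
        (List.concatMap (λ p → List.cartesianProduct (coloredPermutations p) (coloredPermutations (n ∸ p)))
          (List.upTo (suc n)))
    once-pairs b b′ n ≡.refl = once-concatMap
      (unique⇒once (Uniqueₚ.upTo⁺ (suc n)) (∈-upTo⁺ (s≤s (ℕₚ.m≤m+n (size b) (size b′)))))
      (λ { ≡.refl → once-cartesianProductWith _,_ _,_ id (once-biword _ b ≡.refl)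
        (once-biword _ b′ (≡.sym (ℕₚ.m+n∸m≡n (size b) (size b′)))) })
      -- In the block of another `p` every first component has size `p`, whereas equal biwords have
      -- equal sizes.
      (λ {p} b≢p → all-cartesianProductWith _,_
        (λ {c} c≡p _ (eq , _) → b≢p (≡.trans (≡.sym (size-≡ c b eq)) c≡p))
        (all-cartesianProductWith ⟨_,_⟩ (λ _ _ → ≡.refl)
          (All.universal {P = λ _ → ⊤} (λ _ → _) (permutations p))
          (All.universal {P = λ _ → ⊤} (λ _ → _) (words p)))
        (All.universal {P = λ _ → ⊤} (λ _ → _) (coloredPermutations (n ∸ p))))

    -- Each side has at most one nonzero term: on the left the pair `(b , b′)` itself, on the right
    -- the word `biword a`. Both occur exactly when `biword a` is a shifted shuffle of the two.
    ΔG : ∀ a b b′ → coeff 𝕊⊗𝕊 (∑ (unshuffles a) (λ (c , c′) → G c ⊗ G c′)) (b , b′) ≈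
         sum (shuffles (biword b) (shift (size b) (biword b′))) (λ t → ind (biword a ≋? t))
    ΔG a b b′ = trans expand (compare (interleaving? _≟ᵇ_ v v′ (biword a)))
      where
      v v′ : Word ℓ
      v  = biword b
      v′ = shift (size b) (biword b′)

      candidates : List (CP × CP)
      candidates = List.concatMap
        (λ p → List.cartesianProduct (coloredPermutations p) (coloredPermutations (size a ∸ p)))
        (List.upTo (suc (size a)))

      ⋓? : ∀ (s : CP × CP) → Dec _
      ⋓? (c , c′) = a ∈? c ⋓ c′

      ≟b : ∀ (s : CP × CP) → Dec _
      ≟b s = DecSetoid._≟_ 𝕊⊗𝕊 s (b , b′)

      left : CP × CP → Carrier
      left s = ind (⋓? s) * ind (≟b s)

      expand : coeff 𝕊⊗𝕊 (∑ (unshuffles a) (λ (c , c′) → G c ⊗ G c′)) (b , b′) ≈ sum candidates left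
      expand = begin
        coeff 𝕊⊗𝕊 (∑ (unshuffles a) (λ (c , c′) → G c ⊗ G c′)) (b , b′)
          ≈⟨ coeff-eval 𝕊⊗𝕊 (∑ (unshuffles a) (λ (c , c′) → G c ⊗ G c′)) (b , b′) ⟩
        eval (λ s → ind (≟b s)) (∑ (unshuffles a) (λ (c , c′) → G c ⊗ G c′))
          ≈⟨ eval-∑ _ (unshuffles a) _ ⟩
        sum (unshuffles a) (λ (c , c′) → eval (λ s → ind (≟b s)) (G c ⊗ G c′))
          ≈⟨ sum-cong (unshuffles a) (λ (c , c′) → trans (eval-extend₂ (λ s → ind (≟b s)) pair (G c) (G c′))
               (trans (eval-basis (λ d → eval (λ d′ → eval (λ s → ind (≟b s)) (pair d d′)) (G c′)) c)
                 (trans (eval-basis (λ d′ → eval (λ s → ind (≟b s)) (pair c d′)) c′)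
                   (eval-basis (λ s → ind (≟b s)) (c , c′))))) ⟩
        sum (unshuffles a) (λ s → ind (≟b s))
          ≈⟨ sum-filter ⋓? candidates _ ⟩
        sum candidates left
          ∎

      transport : ∀ c c′ → biword c ≡ v → biword c′ ≡ biword b′ →
        Interleaving (biword c) (shift (size c) (biword c′)) (biword a) ≡ Interleaving v v′ (biword a)
      transport c c′ eq eq′ = ≡.cong₂ (λ x y → Interleaving x y (biword a)) eq
        (≡.cong₂ shift (size-≡ c b eq) eq′)

      shuffle-≡ : ∀ {t} → t ∈ shuffles v v′ → biword a ≋ t → biword a ≡ t
      shuffle-≡ t∈ = ranked-≋⇒≡ (ranked-biword a) (ranked-shuffle b b′ t∈)

      compare : Dec (Interleaving v v′ (biword a)) →
                sum candidates left ≈ sum (shuffles v v′) (λ t → ind (biword a ≋? t))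
      compare (yes i) = trans
        (sum-once (once-pairs b b′ (size a) sizes)
          (λ { {c , c′} _ (eq , eq′) → trans (*-cong
            (ind-yes (⋓? (c , c′)) (≡.subst id (≡.sym (transport c c′ eq eq′)) i))
            (ind-yes (≟b (c , c′)) (eq , eq′))) (*-identityˡ 1#) })
          (λ {s} _ ¬eq → trans (*-congˡ (ind-no (≟b s) ¬eq)) (zeroʳ _)))
        (sym (sum-once (once-shuffles v v′ (≺-disjoint (biword-≺ b b′)) i)
          (λ { _ ≡.refl → ind-yes (biword a ≋? biword a) ≋-refl })
          (λ {t} t∈ a≢t → ind-no (biword a ≋? t) (a≢t ∘ shuffle-≡ t∈))))
        where
        sizes : size b ℕ.+ size b′ ≡ size a
        sizes = ≡.sym (≡.trans (≡.sym (length-biword a)) (≡.trans (Permₚ.↭-length (toPermutation i))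
          (≡.trans (Listₚ.length-++ v) (≡.cong₂ ℕ._+_ (length-biword b)
            (≡.trans (Listₚ.length-map _ (biword b′)) (length-biword b′))))))
      compare (no ¬i) = trans
        (sum-0 candidates (λ (c , c′) → miss c c′ (≟b (c , c′))))
        (sym (sum-0-∈ (shuffles v v′) λ {t} t∈ → ind-no (biword a ≋? t) λ a≋t →
          ¬i (≡.subst (Interleaving v v′) (≡.sym (shuffle-≡ t∈ a≋t)) (∈-shuffles⁻ v v′ t∈))))
        where
        miss : ∀ c c′ (d : Dec (biword c ≡ v × biword c′ ≡ biword b′)) → ind (⋓? (c , c′)) * ind d ≈ 0#
        miss c c′ (yes (eq , eq′)) = trans (*-congʳ (ind-no (⋓? (c , c′)) λ i →
          ¬i (≡.subst id (transport c c′ eq eq′) i))) (zeroˡ _)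
        miss c c′ (no _)           = zeroʳ _

  -- The coproduct of FQSym is dual to the shifted shuffle.
  coeff-Δ : ∀ x b b′ →
    coeff 𝕊⊗𝕊 (Δ x) (b , b′) ≈ sum (shuffles (biword b) (shift (size b) (biword b′))) ⟦ x ⟧
  coeff-Δ x b b′ = begin
    coeff 𝕊⊗𝕊 (Δ x) (b , b′)
      ≈⟨ coeff-eval 𝕊⊗𝕊 (Δ x) (b , b′) ⟩
    eval (λ s → ind (DecSetoid._≟_ 𝕊⊗𝕊 s (b , b′))) (Δ x)
      ≈⟨ eval-extend _ (λ a → ∑ (unshuffles a) (λ (c , c′) → G c ⊗ G c′)) x ⟩
    eval (λ a → eval (λ s → ind (DecSetoid._≟_ 𝕊⊗𝕊 s (b , b′))) (∑ (unshuffles a) (λ (c , c′) → G c ⊗ G c′))) x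
      ≈⟨ eval-cong x (λ a → trans (sym (coeff-eval 𝕊⊗𝕊 (∑ (unshuffles a) (λ (c , c′) → G c ⊗ G c′)) (b , b′))) (ΔG a b b′)) ⟩
    eval (λ a → sum (shuffles (biword b) (shift (size b) (biword b′))) (λ t → ind (biword a ≋? t))) x
      ≈⟨ eval-sum (shuffles (biword b) (shift (size b) (biword b′))) x ⟩
    sum (shuffles (biword b) (shift (size b) (biword b′))) ⟦ x ⟧
      ∎

-- Coproducts of the generators and of their products

module Coproducts {c e} (K : CommutativeRing c e) (ℓ : ℕ) where

  open CommutativeRing K
  open ColoredAlgebra K ℓ renaming (_≈_ to infix 4 _≈ᶠ_)
  open Coefficients K
  open WordFunctions K ℓ
  open SetoidReasoning setoid
  open CommutativeSemigroupProperties *-commutativeSemigroup using (interchange)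

  private

    𝕊 = coloredPermutationDecSetoid ℓ

    -- The contribution of one pair of cuts to the right-hand side of `splits-shuffles`.
    pieces : (Word ℓ → Word ℓ → Carrier) → Word ℓ × Word ℓ → Word ℓ × Word ℓ → Carrier
    pieces f (v₁ , v₂) (u₁ , u₂) = sum (shuffles v₁ u₁) λ w₁ → sum (shuffles v₂ u₂) (f w₁)

    pieces-nil-nil : ∀ f v₂ u₂ → pieces f ([] , v₂) ([] , u₂) ≈ sum (shuffles v₂ u₂) (f [])
    pieces-nil-nil f v₂ u₂ = +-identityʳ _

    pieces-cons-nil : ∀ f x v₁ v₂ u₂ → pieces f (x ∷ v₁ , v₂) ([] , u₂) ≈ pieces (f ∘ (x ∷_)) (v₁ , v₂) ([] , u₂)
    pieces-cons-nil f x v₁ v₂ u₂ rewrite shuffles-[]ʳ v₁ = refl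

    pieces-cons-cons : ∀ f x y v₁ v₂ u₁ u₂ → pieces f (x ∷ v₁ , v₂) (y ∷ u₁ , u₂) ≈
      pieces (f ∘ (x ∷_)) (v₁ , v₂) (y ∷ u₁ , u₂) + pieces (f ∘ (y ∷_)) (x ∷ v₁ , v₂) (u₁ , u₂)
    pieces-cons-cons f x y v₁ v₂ u₁ u₂ = trans
      (sum-++ (map (x ∷_) (shuffles v₁ (y ∷ u₁))) (map (y ∷_) (shuffles (x ∷ v₁) u₁)))
      (+-cong (sum-map (x ∷_) (shuffles v₁ (y ∷ u₁))) (sum-map (y ∷_) (shuffles (x ∷ v₁) u₁)))

    sum-splits-∷ : ∀ (f : Word ℓ × Word ℓ → Carrier) x w →
      sum (splits (x ∷ w)) f ≈ f ([] , x ∷ w) + sum (splits w) (λ (u , v) → f (x ∷ u , v))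
    sum-splits-∷ f x w = +-congˡ (sum-map (Product.map₁ (x ∷_)) (splits w))

  -- Deconcatenation is a morphism for the shuffle product: FQSym is a bialgebra.
  splits-shuffles : ∀ (f : Word ℓ → Word ℓ → Carrier) v u →
    sum (shuffles v u) (λ w → sum (splits w) (λ (w₁ , w₂) → f w₁ w₂)) ≈
    sum (splits v) (λ (v₁ , v₂) → sum (splits u) (λ (u₁ , u₂) →
      sum (shuffles v₁ u₁) (λ w₁ → sum (shuffles v₂ u₂) (λ w₂ → f w₁ w₂))))
  splits-shuffles f []      u  = trans (+-identityʳ _) (sym (trans (+-identityʳ _)
    (sum-cong (splits u) λ _ → trans (+-identityʳ _) (+-identityʳ _))))
  splits-shuffles f (x ∷ v) [] = trans (+-identityʳ _) (sum-cong (splits (x ∷ v)) λ (v₁ , v₂) → sym (trans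
    (+-identityʳ _) (single v₁ v₂)))
    where
    single : ∀ v₁ v₂ → pieces f (v₁ , v₂) ([] , []) ≈ f v₁ v₂
    single v₁ v₂ rewrite shuffles-[]ʳ v₁ | shuffles-[]ʳ v₂ = trans (+-identityʳ _) (+-identityʳ _)
  splits-shuffles f (x ∷ v) (y ∷ u) = begin
    sum (map (x ∷_) A ++ map (y ∷_) B) (λ w → sum (splits w) (λ (w₁ , w₂) → f w₁ w₂))
      ≈⟨ sum-++ (map (x ∷_) A) (map (y ∷_) B) ⟩
    sum (map (x ∷_) A) (λ w → sum (splits w) (λ (w₁ , w₂) → f w₁ w₂)) +
      sum (map (y ∷_) B) (λ w → sum (splits w) (λ (w₁ , w₂) → f w₁ w₂))
      ≈⟨ +-cong (expand x A) (expand y B) ⟩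
    (sum A (f [] ∘ (x ∷_)) + sum A (λ w → sum (splits w) (λ (w₁ , w₂) → fx w₁ w₂))) +
      (sum B (f [] ∘ (y ∷_)) + sum B (λ w → sum (splits w) (λ (w₁ , w₂) → fy w₁ w₂)))
      ≈⟨ +-cong (+-congˡ (trans (splits-shuffles fx v (y ∷ u)) rhs-x))
                (+-congˡ (trans (splits-shuffles fy (x ∷ v) u) rhs-y)) ⟩
    (sum A (f [] ∘ (x ∷_)) + (Q + U)) + (sum B (f [] ∘ (y ∷_)) + (P + W))
      ≈⟨ solve 6 (λ a b p q u w → (a ⊞ (q ⊞ u)) ⊞ (b ⊞ (p ⊞ w)) ⊜ ((a ⊞ b) ⊞ p) ⊞ (q ⊞ (u ⊞ w)))
           refl (sum A (f [] ∘ (x ∷_))) (sum B (f [] ∘ (y ∷_))) P Q U W ⟩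
    ((sum A (f [] ∘ (x ∷_)) + sum B (f [] ∘ (y ∷_))) + P) + (Q + (U + W))
      ≈⟨ rhs ⟨
    sum (splits (x ∷ v)) (λ s → sum (splits (y ∷ u)) (λ t → pieces f s t))
      ∎
    where
    open CommutativeMonoidSolver +-commutativeMonoid using (solve; _⊜_) renaming (_⊕_ to infixl 6 _⊞_)
    A B : List (Word ℓ)
    A = shuffles v (y ∷ u)
    B = shuffles (x ∷ v) u

    fx fy : Word ℓ → Word ℓ → Carrier
    fx = f ∘ (x ∷_)
    fy = f ∘ (y ∷_)

    -- These group the pairs of cuts: `P` has an empty left part of `x ∷ v` only, `Q` one of `y ∷ u`
    -- only. When neither left part is empty, `U` and `W` separate the shuffles that begin with `x`
    -- from those that begin with `y`.
    P Q U W : Carrier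
    P = sum (splits u) λ t → pieces fy ([] , x ∷ v) t
    Q = sum (splits v) λ s → pieces fx s ([] , y ∷ u)
    U = sum (splits v) λ s → sum (splits u) λ (u₁ , u₂) → pieces fx s (y ∷ u₁ , u₂)
    W = sum (splits v) λ (v₁ , v₂) → sum (splits u) λ t → pieces fy (x ∷ v₁ , v₂) t

    expand : ∀ z C → sum (map (z ∷_) C) (λ w → sum (splits w) (λ (w₁ , w₂) → f w₁ w₂)) ≈
             sum C (f [] ∘ (z ∷_)) + sum C (λ w → sum (splits w) (λ (w₁ , w₂) → f (z ∷ w₁) w₂))
    expand z C = trans (sum-map (z ∷_) C) (trans
      (sum-cong C λ w → sum-splits-∷ (λ (w₁ , w₂) → f w₁ w₂) z w) (sum-+ C _ _))

    rhs-x : sum (splits v) (λ s → sum (splits (y ∷ u)) (pieces fx s)) ≈ Q + U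
    rhs-x = trans (sum-cong (splits v) λ s → sum-splits-∷ (pieces fx s) y u) (sum-+ (splits v) _ _)

    rhs-y : sum (splits (x ∷ v)) (λ s → sum (splits u) (pieces fy s)) ≈ P + W
    rhs-y = sum-splits-∷ (λ s → sum (splits u) (pieces fy s)) x v

    rhs : sum (splits (x ∷ v)) (λ s → sum (splits (y ∷ u)) (pieces f s)) ≈
          ((sum A (f [] ∘ (x ∷_)) + sum B (f [] ∘ (y ∷_))) + P) + (Q + (U + W))
    rhs = begin
      sum (splits (x ∷ v)) (λ s → sum (splits (y ∷ u)) (pieces f s))
        ≈⟨ sum-splits-∷ (λ s → sum (splits (y ∷ u)) (pieces f s)) x v ⟩
      sum (splits (y ∷ u)) (pieces f ([] , x ∷ v)) +
        sum (splits v) (λ (v₁ , v₂) → sum (splits (y ∷ u)) (pieces f (x ∷ v₁ , v₂)))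
        ≈⟨ +-cong
             (trans (sum-splits-∷ (pieces f ([] , x ∷ v)) y u) (+-congʳ (trans (pieces-nil-nil f (x ∷ v) (y ∷ u))
               (trans (sum-++ (map (x ∷_) A) (map (y ∷_) B)) (+-cong (sum-map (x ∷_) A) (sum-map (y ∷_) B))))))
             (trans (sum-cong (splits v) λ (v₁ , v₂) → trans (sum-splits-∷ (pieces f (x ∷ v₁ , v₂)) y u)
               (+-cong (pieces-cons-nil f x v₁ v₂ (y ∷ u)) (trans
                 (sum-cong (splits u) λ (u₁ , u₂) → pieces-cons-cons f x y v₁ v₂ u₁ u₂) (sum-+ (splits u) _ _))))
               (trans (sum-+ (splits v) _ _) (+-congˡ (sum-+ (splits v) _ _)))) ⟩
      ((sum A (f [] ∘ (x ∷_)) + sum B (f [] ∘ (y ∷_))) + P) + (Q + (U + W))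
        ∎

  -- The only ascending shuffle of a word with a higher one is their concatenation.
  sum-ascending : ∀ (f : Word ℓ → Carrier) → (∀ {w} → ¬ Ascending w → f w ≈ 0#) →
                  ∀ v u → v ≺ u → sum (shuffles v u) f ≈ f (v ++ u)
  sum-ascending f f-0 []      u       v≺u = +-identityʳ _
  sum-ascending f f-0 (x ∷ v) []      v≺u =
    trans (+-identityʳ _) (reflexive (≡.cong f (≡.sym (Listₚ.++-identityʳ (x ∷ v)))))
  sum-ascending f f-0 (x ∷ v) (y ∷ u) v≺u = begin
    sum (map (x ∷_) A ++ map (y ∷_) B) f
      ≈⟨ sum-++ (map (x ∷_) A) (map (y ∷_) B) ⟩
    sum (map (x ∷_) A) f + sum (map (y ∷_) B) f
      ≈⟨ +-cong
           -- The induction applies to `f ∘ (x ∷_)`, which is why `f` is any function vanishing off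
           -- the ascending words.
           (trans (sum-map (x ∷_) A) (sum-ascending (f ∘ (x ∷_)) (λ ¬a → f-0 λ { (_ ∷ a) → ¬a a }) v (y ∷ u)
             (λ x∈ → v≺u (there x∈))))
           -- Here `y` comes first although the smaller letter `x` occurs later.
           (trans (sum-map (y ∷_) B) (sum-0-∈ B λ {w} w∈ → f-0 (descends w w∈))) ⟩
    f (x ∷ v ++ y ∷ u) + 0#
      ≈⟨ +-identityʳ _ ⟩
    f (x ∷ v ++ y ∷ u)
      ∎
    where
    A B : List (Word ℓ)
    A = shuffles v (y ∷ u)
    B = shuffles (x ∷ v) u
    descends : ∀ w → w ∈ B → ¬ Ascending (y ∷ w)
    descends w w∈ (y<w ∷ _) = ℕₚ.<-asym (v≺u (here ≡.refl) (here ≡.refl))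
      (All.lookup y<w (∈-map⁺ proj₁ (Permₚ.∈-resp-↭
        (Perm.↭-sym (toPermutation (∈-shuffles⁻ (x ∷ v) u w∈))) (here ≡.refl))))

  -- Since `v ≺ u`, the word `v ++ u` increases exactly when `v` and `u` do, and their contents
  -- single out the one decomposition of `n` that contributes.
  shuffles-S : ∀ n v u → v ≺ u → sum (shuffles v u) ⟦ S n ⟧ ≈
               sum (decompositions n) (λ (i , j) → ⟦ S i ⟧ v * ⟦ S j ⟧ u)
  shuffles-S n v u v≺u = begin
    sum (shuffles v u) ⟦ S n ⟧
      ≈⟨ sum-cong (shuffles v u) (⟦S⟧ n) ⟩
    sum (shuffles v u) (λ w → ind (row? n w))
      ≈⟨ sum-ascending (λ w → ind (row? n w)) (λ {w} ¬a → ind-no (row? n w) (¬a ∘ proj₁)) v u v≺u ⟩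
    ind (row? n (v ++ u))
      ≈⟨ case (row? n (v ++ u)) ⟨
    sum (decompositions n) (λ (i , j) → ind (row? i v) * ind (row? j u))
      ≈⟨ sum-cong (decompositions n) (λ (i , j) → *-cong (⟦S⟧ i v) (⟦S⟧ j u)) ⟨
    sum (decompositions n) (λ (i , j) → ⟦ S i ⟧ v * ⟦ S j ⟧ u)
      ∎
    where
    both : ∀ i j → Dec (Row i v × Row j u)
    both i j = row? i v ×-dec row? j u

    ind-both : ∀ i j → ind (row? i v) * ind (row? j u) ≈ ind (both i j)
    ind-both i j = ind-* (row? i v) (row? j u) (both i j) _,_ id

    case : (d : Dec (Row n (v ++ u))) →
           sum (decompositions n) (λ (i , j) → ind (row? i v) * ind (row? j u)) ≈ ind d
    case (yes r) with row-++⁻ v r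
    ... | rv , ru , ≡.refl = sum-once (once-decompositions (content (hues v)) (content (hues u)))
      (λ { _ ≡.refl → trans (ind-both (content (hues v)) (content (hues u)))
        (ind-yes (both (content (hues v)) (content (hues u))) (rv , ru)) })
      (λ { {i , j} _ ≢ → trans (ind-both i j)
        (ind-no (both i j) λ ((_ , p) , (_ , q)) → ≢ (≡.cong₂ _,_ p q)) })
    case (no ¬r) = sum-0-∈ (decompositions n) λ { {i , j} d∈ → trans (ind-both i j) (ind-no (both i j)
      λ (ri , rj) → ¬r (≡.subst (λ m → Row m (v ++ u)) (∈-decompositions⁻ n d∈) (row-++⁺ v≺u ri rj))) }

  -- `S^` without the restriction to nonzero columns, needed because the two tensor factors of a
  -- coproduct may contain zero columns.
  S* : Columns → FQSym
  S* = List.foldr (λ i x → S i · x) 𝟙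

  -- Induction on the columns. Compatibility of cuts and shuffles separates the first column from
  -- the rest, and the factors produced by the cuts inherit both distinctness and `≺`.
  shuffles-S* : ∀ I v u → v ≺ u → Distinct v → Distinct u → sum (shuffles v u) ⟦ S* I ⟧ ≈
                sum (columnDecompositions I) (λ (A , B) → ⟦ S* A ⟧ v * ⟦ S* B ⟧ u)
  shuffles-S* []      v u v≺u dv du = trans (one v u) (sym (+-identityʳ _))
    where
    one : ∀ v u → sum (shuffles v u) ⟦ 𝟙 ⟧ ≈ ⟦ 𝟙 ⟧ v * ⟦ 𝟙 ⟧ u
    one []      u       = trans (+-identityʳ _) (sym (trans (*-congʳ ⟦𝟙⟧-[]) (*-identityˡ _)))
    one (x ∷ v) []      = trans (+-identityʳ _) (sym (trans (*-congˡ ⟦𝟙⟧-[]) (*-identityʳ _)))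
    one (x ∷ v) (y ∷ u) = trans
      (sum-++ (map (x ∷_) (shuffles v (y ∷ u))) (map (y ∷_) (shuffles (x ∷ v) u)))
      (trans (+-cong
        (trans (sum-map (x ∷_) (shuffles v (y ∷ u))) (sum-0 (shuffles v (y ∷ u)) (⟦𝟙⟧-∷ x)))
        (trans (sum-map (y ∷_) (shuffles (x ∷ v) u)) (sum-0 (shuffles (x ∷ v) u) (⟦𝟙⟧-∷ y))))
      (trans (+-identityˡ _) (sym (trans (*-congʳ (⟦𝟙⟧-∷ x v)) (zeroˡ _)))))
  shuffles-S* (n ∷ I) v u v≺u dv du = begin
    sum (shuffles v u) ⟦ S n · S* I ⟧
      ≈⟨ sum-cong-∈ (shuffles v u) (λ w∈ → ⟦·⟧ (S n) (S* I) (distinct-shuffle v≺u dv du w∈)) ⟩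
    sum (shuffles v u) (λ w → sum (splits w) (λ (w₁ , w₂) → ⟦ S n ⟧ w₁ * ⟦ S* I ⟧ w₂))
      ≈⟨ splits-shuffles (λ w₁ w₂ → ⟦ S n ⟧ w₁ * ⟦ S* I ⟧ w₂) v u ⟩
    sum (splits v) (λ (v₁ , v₂) → sum (splits u) (λ (u₁ , u₂) →
      sum (shuffles v₁ u₁) (λ w₁ → sum (shuffles v₂ u₂) (λ w₂ → ⟦ S n ⟧ w₁ * ⟦ S* I ⟧ w₂))))
      ≈⟨ sum-cong-∈ (splits v) (λ {(v₁ , v₂)} s∈ → sum-cong-∈ (splits u) (λ {(u₁ , u₂)} t∈ →
           blocks s∈ t∈)) ⟩
    sum (splits v) (λ s → sum (splits u) (λ t → sum decs (λ d → term s t d)))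
      ≈⟨ sum-cartesianProductWith _,_ (splits v) (splits u) ⟨
    -- The two sums over cuts are bundled into one so that a single exchange moves the
    -- decompositions to the outside.
    sum (List.cartesianProduct (splits v) (splits u)) (λ (s , t) → sum decs (λ d → term s t d))
      ≈⟨ sum-swap (List.cartesianProduct (splits v) (splits u)) decs _ ⟩
    sum decs (λ d → sum (List.cartesianProduct (splits v) (splits u)) (λ (s , t) → term s t d))
      ≈⟨ sum-cong decs (λ d → sum-cartesianProductWith _,_ (splits v) (splits u)) ⟩
    sum decs (λ d → sum (splits v) (λ s → sum (splits u) (λ t → term s t d)))
      ≈⟨ sum-cartesianProductWith _,_ (decompositions n) (columnDecompositions I) ⟩
    sum (decompositions n) (λ d → sum (columnDecompositions I) (λ D →
      sum (splits v) (λ s → sum (splits u) (λ t → term s t (d , D)))))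
      ≈⟨ sum-cong (decompositions n) (λ (i , j) → sum-cong (columnDecompositions I) (λ (A , B) → collect i j A B)) ⟩
    sum (decompositions n) (λ (i , j) → sum (columnDecompositions I) (λ (A , B) →
      ⟦ S* (i ∷ A) ⟧ v * ⟦ S* (j ∷ B) ⟧ u))
      ≈⟨ sum-cartesianProductWith _ (decompositions n) (columnDecompositions I) ⟨
    sum (columnDecompositions (n ∷ I)) (λ (A , B) → ⟦ S* A ⟧ v * ⟦ S* B ⟧ u)
      ∎
    where
    decs : List ((Partite ℓ × Partite ℓ) × (Columns × Columns))
    decs = List.cartesianProduct (decompositions n) (columnDecompositions I)

    term : Word ℓ × Word ℓ → Word ℓ × Word ℓ → (Partite ℓ × Partite ℓ) × (Columns × Columns) → Carrier
    term (v₁ , v₂) (u₁ , u₂) ((i , j) , (A , B)) =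
      (⟦ S i ⟧ v₁ * ⟦ S* A ⟧ v₂) * (⟦ S j ⟧ u₁ * ⟦ S* B ⟧ u₂)

    blocks : ∀ {s t} → s ∈ splits v → t ∈ splits u →
      sum (shuffles (proj₁ s) (proj₁ t)) (λ w₁ → sum (shuffles (proj₂ s) (proj₂ t)) (λ w₂ →
        ⟦ S n ⟧ w₁ * ⟦ S* I ⟧ w₂)) ≈ sum decs (λ d → term s t d)
    blocks {v₁ , v₂} {u₁ , u₂} s∈ t∈ = begin
      sum (shuffles v₁ u₁) (λ w₁ → sum (shuffles v₂ u₂) (λ w₂ → ⟦ S n ⟧ w₁ * ⟦ S* I ⟧ w₂))
        ≈⟨ sum-product ⟦ S n ⟧ ⟦ S* I ⟧ (shuffles v₁ u₁) (shuffles v₂ u₂) ⟩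
      sum (shuffles v₁ u₁) ⟦ S n ⟧ * sum (shuffles v₂ u₂) ⟦ S* I ⟧
        ≈⟨ *-cong (shuffles-S n v₁ u₁ (proj₁ below)) (shuffles-S* I v₂ u₂ (proj₂ below)
             (proj₂ (distinct-splits v dv s∈)) (proj₂ (distinct-splits u du t∈))) ⟩
      sum (decompositions n) (λ (i , j) → ⟦ S i ⟧ v₁ * ⟦ S j ⟧ u₁) *
        sum (columnDecompositions I) (λ (A , B) → ⟦ S* A ⟧ v₂ * ⟦ S* B ⟧ u₂)
        ≈⟨ sum-product _ _ (decompositions n) (columnDecompositions I) ⟨
      sum (decompositions n) (λ (i , j) → sum (columnDecompositions I) (λ (A , B) →
        (⟦ S i ⟧ v₁ * ⟦ S j ⟧ u₁) * (⟦ S* A ⟧ v₂ * ⟦ S* B ⟧ u₂)))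
        ≈⟨ sum-cong (decompositions n) (λ _ → sum-cong (columnDecompositions I) (λ _ → interchange _ _ _ _)) ⟩
      sum (decompositions n) (λ d → sum (columnDecompositions I) (λ D → term (v₁ , v₂) (u₁ , u₂) (d , D)))
        ≈⟨ sum-cartesianProductWith _,_ (decompositions n) (columnDecompositions I) ⟨
      sum decs (λ d → term (v₁ , v₂) (u₁ , u₂) d)
        ∎
      where
      below : v₁ ≺ u₁ × v₂ ≺ u₂
      below = ≺-++⁻ v₁ u₁ (≡.subst₂ _≺_ (≡.sym (∈-splits⁻ v s∈)) (≡.sym (∈-splits⁻ u t∈)) v≺u)

    collect : ∀ i j A B → sum (splits v) (λ s → sum (splits u) (λ t → term s t ((i , j) , (A , B)))) ≈
              ⟦ S* (i ∷ A) ⟧ v * ⟦ S* (j ∷ B) ⟧ u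
    collect i j A B = trans (sum-product _ _ (splits v) (splits u))
      (sym (*-cong (⟦·⟧ (S i) (S* A) dv) (⟦·⟧ (S j) (S* B) du)))

  coeff-∑⊗ : ∀ {x} {X : Set x} (f g : X → FQSym) (xs : List (X × X)) b b′ →
    coeff 𝕊⊗𝕊 (∑ xs λ (i , j) → f i ⊗ g j) (b , b′) ≈
    sum xs (λ (i , j) → ⟦ f i ⟧ (biword b) * ⟦ g j ⟧ (biword b′))
  coeff-∑⊗ f g xs b b′ = begin
    coeff 𝕊⊗𝕊 (∑ xs λ (i , j) → f i ⊗ g j) (b , b′)
      ≈⟨ coeff-eval 𝕊⊗𝕊 (∑ xs λ (i , j) → f i ⊗ g j) (b , b′) ⟩
    eval (λ s → ind (DecSetoid._≟_ 𝕊⊗𝕊 s (b , b′))) (∑ xs λ (i , j) → f i ⊗ g j)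
      ≈⟨ eval-∑ _ xs (λ (i , j) → f i ⊗ g j) ⟩
    sum xs (λ (i , j) → eval (λ s → ind (DecSetoid._≟_ 𝕊⊗𝕊 s (b , b′))) (f i ⊗ g j))
      ≈⟨ sum-cong xs (λ (i , j) → trans (sym (coeff-eval 𝕊⊗𝕊 (f i ⊗ g j) (b , b′))) (trans
           (coeff-⊗ (f i) (g j) (b , b′)) (*-cong (coeff-⟦⟧ (f i) ≋-refl) (coeff-⟦⟧ (g j) ≋-refl)))) ⟩
    sum xs (λ (i , j) → ⟦ f i ⟧ (biword b) * ⟦ g j ⟧ (biword b′))
      ∎

  Δ-S : ∀ n → Δ (S n) ≈⊗ ∑ (decompositions n) λ (i , j) → S i ⊗ S j
  Δ-S n (b , b′) = begin
    coeff 𝕊⊗𝕊 (Δ (S n)) (b , b′)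
      ≈⟨ coeff-Δ (S n) b b′ ⟩
    sum (shuffles (biword b) (shift (size b) (biword b′))) ⟦ S n ⟧
      ≈⟨ shuffles-S n (biword b) (shift (size b) (biword b′)) (biword-≺ b b′) ⟩
    sum (decompositions n) (λ (i , j) → ⟦ S i ⟧ (biword b) * ⟦ S j ⟧ (shift (size b) (biword b′)))
      ≈⟨ sum-cong (decompositions n) (λ (i , j) → *-congˡ (⟦⟧-≋ (S j) (shift-≋ (size b) (biword b′)))) ⟩
    sum (decompositions n) (λ (i , j) → ⟦ S i ⟧ (biword b) * ⟦ S j ⟧ (biword b′))
      ≈⟨ coeff-∑⊗ S S (decompositions n) b b′ ⟨
    coeff 𝕊⊗𝕊 (∑ (decompositions n) λ (i , j) → S i ⊗ S j) (b , b′)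
      ∎

  coeff-Δ-S* : ∀ I b b′ → coeff 𝕊⊗𝕊 (Δ (S* I)) (b , b′) ≈
    sum (columnDecompositions I) (λ (A , B) → ⟦ S* A ⟧ (biword b) * ⟦ S* B ⟧ (biword b′))
  coeff-Δ-S* I b b′ = begin
    coeff 𝕊⊗𝕊 (Δ (S* I)) (b , b′)
      ≈⟨ coeff-Δ (S* I) b b′ ⟩
    sum (shuffles (biword b) (shift (size b) (biword b′))) ⟦ S* I ⟧
      ≈⟨ shuffles-S* I (biword b) (shift (size b) (biword b′)) (biword-≺ b b′)
           (distinct-biword b) (distinct-shift (size b) (biword b′) (distinct-biword b′)) ⟩
    sum (columnDecompositions I) (λ (A , B) → ⟦ S* A ⟧ (biword b) * ⟦ S* B ⟧ (shift (size b) (biword b′)))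
      ≈⟨ sum-cong (columnDecompositions I) (λ (A , B) → *-congˡ (⟦⟧-≋ (S* B) (shift-≋ (size b) (biword b′)))) ⟩
    sum (columnDecompositions I) (λ (A , B) → ⟦ S* A ⟧ (biword b) * ⟦ S* B ⟧ (biword b′))
      ∎

  Δ-S* : ∀ I → Δ (S* I) ≈⊗ ∑ (columnDecompositions I) λ (A , B) → S* A ⊗ S* B
  Δ-S* I (b , b′) = trans (coeff-Δ-S* I b b′) (sym (coeff-∑⊗ S* S* (columnDecompositions I) b b′))

  Δ-cong : ∀ x y → x ≈ᶠ y → Δ x ≈⊗ Δ y
  Δ-cong x y x≈y (b , b′) = trans (coeff-Δ x b b′) (trans
    (sum-cong-∈ (shuffles (biword b) (shift (size b) (biword b′))) λ w∈ → ⟦⟧-cong x y x≈y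
      (distinct-shuffle (biword-≺ b b′) (distinct-biword b)
        (distinct-shift (size b) (biword b′) (distinct-biword b′)) w∈))
    (sym (coeff-Δ y b b′)))

  coeff-Δ-extend : ∀ {i} {I : Set i} (f : I → FQSym) x b →
                   coeff 𝕊⊗𝕊 (Δ (extend f x)) b ≈ eval (λ i → coeff 𝕊⊗𝕊 (Δ (f i)) b) x
  coeff-Δ-extend f x (b , b′) = begin
    coeff 𝕊⊗𝕊 (Δ (extend f x)) (b , b′)
      ≈⟨ coeff-Δ (extend f x) b b′ ⟩
    sum sh ⟦ extend f x ⟧
      ≈⟨ sum-cong sh (λ w → ⟦⟧-extend f x) ⟩
    sum sh (λ w → eval (λ i → ⟦ f i ⟧ w) x)
      ≈⟨ eval-sum sh x ⟨
    eval (λ i → sum sh ⟦ f i ⟧) x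
      ≈⟨ eval-cong x (λ i → sym (coeff-Δ (f i) b b′)) ⟩
    eval (λ i → coeff 𝕊⊗𝕊 (Δ (f i)) (b , b′)) x
      ∎
    where
    sh = shuffles (biword b) (shift (size b) (biword b′))

  coeff-flip⊗ : ∀ x b b′ → coeff 𝕊⊗𝕊 (flip⊗ x) (b , b′) ≈ coeff 𝕊⊗𝕊 x (b′ , b)
  coeff-flip⊗ x b b′ = begin
    coeff 𝕊⊗𝕊 (flip⊗ x) (b , b′)
      ≈⟨ coeff-eval 𝕊⊗𝕊 (flip⊗ x) (b , b′) ⟩
    eval (λ s → ind (DecSetoid._≟_ 𝕊⊗𝕊 s (b , b′))) (flip⊗ x)
      ≈⟨ eval-extend _ (λ (a , a′) → basis (a′ , a)) x ⟩
    eval (λ (a , a′) → eval (λ s → ind (DecSetoid._≟_ 𝕊⊗𝕊 s (b , b′))) (basis (a′ , a))) x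
      ≈⟨ eval-cong x (λ (a , a′) → trans (eval-basis (λ s → ind (DecSetoid._≟_ 𝕊⊗𝕊 s (b , b′))) (a′ , a))
           (ind-cong (DecSetoid._≟_ 𝕊⊗𝕊 (a′ , a) (b , b′)) (DecSetoid._≟_ 𝕊⊗𝕊 (a , a′) (b′ , b))
             Product.swap Product.swap)) ⟩
    eval (λ s → ind (DecSetoid._≟_ 𝕊⊗𝕊 s (b′ , b))) x
      ≈⟨ coeff-eval 𝕊⊗𝕊 x (b′ , b) ⟨
    coeff 𝕊⊗𝕊 x (b′ , b)
      ∎

  -- Addition of columns is commutative, so exchanging the two components permutes the
  -- decompositions of `I`.
  Δ-S*-cocommutative : ∀ I b b′ → coeff 𝕊⊗𝕊 (Δ (S* I)) (b′ , b) ≈ coeff 𝕊⊗𝕊 (Δ (S* I)) (b , b′)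
  Δ-S*-cocommutative I b b′ = trans (coeff-Δ-S* I b′ b) (trans
    (sum-reindex (λ s t → Productₚ.≡-dec columns≟ columns≟ (Product.swap s) t) decs decs
      (λ s∈ → once-columnDecompositions (columnSum-comm (∈-columnDecompositions⁻ I s∈)))
      (λ t∈ → once-⇔ (λ eq → ≡.cong Product.swap (≡.sym eq)) (λ eq → ≡.cong Product.swap (≡.sym eq))
        (once-columnDecompositions (columnSum-comm (∈-columnDecompositions⁻ I t∈))))
      (λ { ≡.refl → *-comm _ _ }))
    (sym (coeff-Δ-S* I b b′)))
    where
    decs = columnDecompositions I
    columns≟ = Listₚ.≡-dec (Vecₚ.≡-dec ℕₚ._≟_)

-- Linear independence of the products of generators

module Freeness {c e} (K : CommutativeRing c e) (ℓ : ℕ) where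

  open CommutativeRing K
  open ColoredAlgebra K ℓ renaming (_≈_ to infix 4 _≈ᶠ_)
  open Coefficients K
  open WordFunctions K ℓ
  open Coproducts K ℓ
  open SetoidReasoning setoid
  open RingProperties ring using (-1*x≈-x; -‿involutive; -0#≈0#)

  private
    𝕊 = coloredPermutationDecSetoid ℓ
    𝕍 = vectorCompositionDecSetoid ℓ

    VC : Set
    VC = VectorComposition ℓ

  -- The length of a row is the weight of its column, so there is only one way to cut `w` into rows.
  -- The value is therefore 1 and not a multiplicity.
  ⟦S*⟧-rows : ∀ {I w} → Distinct w → Rows I w → ⟦ S* I ⟧ w ≈ 1#
  ⟦S*⟧-rows d []                                = ⟦𝟙⟧-[]
  ⟦S*⟧-rows d (cons {n} {I} {v} {w} r rs) = trans (⟦·⟧ (S n) (S* I) d) (sum-once (once-splits v w)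
    (λ { _ ≡.refl → trans (*-cong (trans (⟦S⟧ n v) (ind-yes (row? n v) r))
      (⟦S*⟧-rows (proj₂ (distinct-++⁻ v d)) rs)) (*-identityˡ 1#) })
    (λ { {v′ , w′} s∈ ≢ → trans (*-congʳ (trans (⟦S⟧ n v′) (ind-no (row? n v′) λ r′ →
      let eq = ++-injective v v′ (≡.trans (row-length v r) (≡.sym (row-length v′ r′)))
                 (≡.sym (∈-splits⁻ (v ++ w) s∈))
      in ≢ (≡.cong₂ _,_ (proj₁ eq) (proj₂ eq))))) (zeroˡ _) }))

  ⟦S*⟧-¬rows : ∀ I {w} → Distinct w → ¬ Rows I w → ⟦ S* I ⟧ w ≈ 0#
  ⟦S*⟧-¬rows []      {[]}    d ¬rs = contradiction [] ¬rs
  ⟦S*⟧-¬rows []      {l ∷ w} d ¬rs = ⟦𝟙⟧-∷ l w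
  ⟦S*⟧-¬rows (n ∷ I) {w}     d ¬rs = trans (⟦·⟧ (S n) (S* I) d)
    (sum-0-∈ (splits w) λ {s} s∈ → trans (*-congʳ (⟦S⟧ n (proj₁ s))) (case s s∈ (row? n (proj₁ s))))
    where
    case : ∀ s → s ∈ splits w → (r? : Dec (Row n (proj₁ s))) → ind r? * ⟦ S* I ⟧ (proj₂ s) ≈ 0#
    case s       s∈ (no _)  = zeroˡ _
    case (u , v) s∈ (yes r) = trans (*-congˡ (⟦S*⟧-¬rows I (proj₂ (distinct-splits w d s∈)) λ rs →
      ¬rs (≡.subst (Rows (n ∷ I)) (∈-splits⁻ w s∈) (cons r rs)))) (zeroʳ _)

  -- S^I, as a function of words, is unitriangular: for the word w attached to J it vanishes
  -- unless I = J or I has more columns than J, so coefficients vanish by descending induction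
  -- on the number of columns.
  S^-independent : ∀ x → extend S^ x ≈ᶠ [] → ∀ J → coeff 𝕍 x J ≈ 0#
  -- `N` bounds the number of columns occurring in `x`. The counter `d` reaches 0 only when `J` has
  -- more than `N` columns and hence does not occur in `x`.
  S^-independent x x≈0 J = go (suc N) J (s≤s (ℕₚ.m≤m+n N _))
    where
    bounded : ∀ (x : Lin VC) → ∃ λ N → All (λ (k , I) → length (columns I) ≤ N) x
    bounded []            = 0 , []
    bounded ((k , I) ∷ x) = let N , x≤N = bounded x in length (columns I) ℕ.+ N ,
      ℕₚ.m≤m+n _ N ∷ All.map (λ le → ℕₚ.≤-trans le (ℕₚ.m≤n+m N _)) x≤N

    N = proj₁ (bounded x)

    absent : ∀ J {x : Lin VC} {M} → All (λ (k , I) → length (columns I) ≤ M) x →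
             M < length (columns J) → coeff 𝕍 x J ≈ 0#
    absent J []                          M<J = refl
    absent J {(k , I) ∷ x} (I≤M ∷ x≤M) M<J with DecSetoid._≟_ 𝕍 I J
    ... | yes I≡J = contradiction (≡.cong length I≡J) (ℕₚ.<⇒≢ (ℕₚ.≤-<-trans I≤M M<J))
    ... | no  _   = trans (+-identityˡ _) (absent J x≤M M<J)

    go : ∀ d J → N < d ℕ.+ length (columns J) → coeff 𝕍 x J ≈ 0#
    go zero    J lt = absent J (proj₂ (bounded x)) lt
    go (suc d) J lt with descending-exists (columns J)
    ... | w , ds , dw , _ = begin
      coeff 𝕍 x J          ≈⟨ -‿involutive _ ⟨
      - - coeff 𝕍 x J      ≈⟨ -‿cong (trans (sym (-1*x≈-x _)) negated) ⟩
      - 0#                 ≈⟨ -0#≈0# ⟩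
      0#                   ∎
      where
      -- `row` and `δ` agree at every `I` with at most as many columns as `J`; at any other `I` the
      -- coefficient vanishes by induction. So `x` has the same value under both: 0 under `row` by
      -- assumption, and `coeff 𝕍 x J` under `δ`.
      row δ : VC → Carrier
      row I = ⟦ S^ I ⟧ w
      δ I = ind (DecSetoid._≟_ 𝕍 I J)

      difference-0 : ∀ I → length (columns I) ≤ length (columns J) → row I + (- 1#) * δ I ≈ 0#
      difference-0 I I≤J with DecSetoid._≟_ 𝕍 I J
      ... | yes I≡J = trans (+-cong
        (⟦S*⟧-rows dw (≡.subst (λ I → Rows I w) (≡.sym I≡J) (descending-rows ds))) (*-identityʳ _)) (-‿inverseʳ 1#)
      ... | no  I≢J = trans (+-cong
        (⟦S*⟧-¬rows (columns I) dw λ rs → I≢J (rows-descending-≡ rs ds (nonzero J) I≤J)) (zeroʳ _)) (+-identityʳ 0#)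

      vanishing : ∀ I → coeff 𝕍 x I * (row I + (- 1#) * δ I) ≈ 0#
      vanishing I with length (columns I) ℕₚ.≤? length (columns J)
      ... | yes I≤J = trans (*-congˡ (difference-0 I I≤J)) (zeroʳ _)
      ... | no  I≰J = trans (*-congʳ (go d I (ℕₚ.<-≤-trans lt (≡.subst (_≤ d ℕ.+ length (columns I))
        (ℕₚ.+-suc d _) (ℕₚ.+-monoʳ-≤ d (ℕₚ.≰⇒> I≰J)))))) (zeroˡ _)

      congruent : ∀ {I I′} → columns I ≡ columns I′ → row I + (- 1#) * δ I ≈ row I′ + (- 1#) * δ I′
      congruent {I} {I′} eq = +-cong (reflexive (≡.cong (λ C → ⟦ S* C ⟧ w) eq)) (*-congˡ
        (ind-cong (DecSetoid._≟_ 𝕍 I J) (DecSetoid._≟_ 𝕍 I′ J) (≡.trans (≡.sym eq)) (≡.trans eq)))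

      negated : (- 1#) * coeff 𝕍 x J ≈ 0#
      negated = begin
        (- 1#) * coeff 𝕍 x J                            ≈⟨ *-congˡ (coeff-eval 𝕍 x J) ⟩
        (- 1#) * eval δ x                               ≈⟨ eval-*ˡ (- 1#) x ⟩
        eval (λ I → (- 1#) * δ I) x                     ≈⟨ +-identityˡ _ ⟨
        0# + eval (λ I → (- 1#) * δ I) x                ≈⟨ +-congʳ (trans (sym (⟦⟧-extend S^ x)) (⟦⟧-cong (extend S^ x) [] x≈0 dw)) ⟨
        eval row x + eval (λ I → (- 1#) * δ I) x        ≈⟨ eval-+ row _ x ⟨
        eval (λ I → row I + (- 1#) * δ I) x             ≈⟨ eval-vanishes 𝕍 (λ {I} {I′} → congruent {I} {I′}) x vanishing ⟩
        0#                                              ∎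

  -- Products of basis elements, and spanning

  S*-++ : ∀ I J → S* I · S* J ≈ᶠ S* (I ++ J)
  S*-++ []      J = ·-identityˡ (S* J)
  S*-++ (n ∷ I) J b = trans (·-assoc (S n) (S* I) (S* J) b)
    (·-cong (S n) (S n) (S* I · S* J) (S* (I ++ J)) (λ _ → refl) (S*-++ I J) b)

  S-𝟎 : ∀ {n} → n ≡ 𝟎 → S n ≈ᶠ 𝟙
  S-𝟎 {n} n≡0 = ⟦⟧-ext (S n) 𝟙 λ {w} _ → trans (⟦S⟧ n w) (empty w)
    where
    empty : ∀ w → ind (row? n w) ≈ ⟦ 𝟙 ⟧ w
    empty []      = trans (ind-yes (row? n []) ([] , ≡.sym n≡0)) (sym ⟦𝟙⟧-[])
    empty (l ∷ w) = trans (ind-no (row? n (l ∷ w)) λ r → absurd (≡.trans (row-length (l ∷ w) r) zero!)) (sym (⟦𝟙⟧-∷ l w))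
      where
      zero! : ∣ n ∣ ≡ 0
      zero! = ≡.trans (≡.cong ∣_∣ n≡0) (∣𝟎∣ ℓ)
      absurd : suc (length w) ≢ 0
      absurd ()

  S*-𝟎 : ∀ (I : Columns {ℓ}) → S* (map (λ _ → 𝟎) I) ≈ᶠ 𝟙
  S*-𝟎 []      b = refl
  S*-𝟎 (n ∷ I) b = trans
    (·-cong (S 𝟎) 𝟙 (S* (map (λ _ → 𝟎) I)) 𝟙 (S-𝟎 ≡.refl) (S*-𝟎 I) b) (·-identityˡ 𝟙 b)

  ·-extend : ∀ {m n} {M : Set m} {N : Set n} (f : M → FQSym) (g : N → FQSym) x y {w} → Distinct w →
             ⟦ extend f x · extend g y ⟧ w ≈ eval (λ m → eval (λ n → ⟦ f m · g n ⟧ w) y) x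
  ·-extend f g x y {w} d = begin
    ⟦ extend f x · extend g y ⟧ w
      ≈⟨ ⟦·⟧ (extend f x) (extend g y) d ⟩
    sum (splits w) (λ (u , v) → ⟦ extend f x ⟧ u * ⟦ extend g y ⟧ v)
      ≈⟨ sum-cong (splits w) (λ (u , v) → trans (*-cong (⟦⟧-extend f x) (⟦⟧-extend g y)) (sym (eval-product _ _ x y))) ⟩
    sum (splits w) (λ (u , v) → eval (λ m → eval (λ n → ⟦ f m ⟧ u * ⟦ g n ⟧ v) y) x)
      ≈⟨ eval-sum (splits w) x ⟨
    eval (λ m → sum (splits w) (λ (u , v) → eval (λ n → ⟦ f m ⟧ u * ⟦ g n ⟧ v) y)) x
      ≈⟨ eval-cong x (λ m → trans (sym (eval-sum (splits w) y)) (eval-cong y λ n → sym (⟦·⟧ (f m) (g n) d))) ⟩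
    eval (λ m → eval (λ n → ⟦ f m · g n ⟧ w) y) x
      ∎

  infixr 5 _⧺_

  _⧺_ : VC → VC → VC
  I ⧺ J = record { columns = columns I ++ columns J ; nonzero = Allₚ.++⁺ (nonzero I) (nonzero J) }

  ∅ᵛ : VC
  ∅ᵛ = record { columns = [] ; nonzero = [] }

  [_]ᵛ : ∀ {n} → n ≢ 𝟎 → VC
  [_]ᵛ {n} n≢0 = record { columns = n ∷ [] ; nonzero = n≢0 ∷ [] }

  infixl 7 _⊛_

  -- The product of the monoid algebra of vector compositions under concatenation, that is, of the
  -- free associative algebra on the nonzero columns.
  _⊛_ : Lin VC → Lin VC → Lin VC
  _⊛_ = extend₂ λ I J → basis (I ⧺ J)

  extend-⊛ : ∀ x y → extend S^ (x ⊛ y) ≈ᶠ extend S^ x · extend S^ y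
  extend-⊛ x y = ⟦⟧-ext (extend S^ (x ⊛ y)) (extend S^ x · extend S^ y) λ {w} d → begin
    ⟦ extend S^ (x ⊛ y) ⟧ w
      ≈⟨ ⟦⟧-extend S^ (x ⊛ y) ⟩
    eval (λ I → ⟦ S^ I ⟧ w) (x ⊛ y)
      ≈⟨ eval-extend₂ (λ I → ⟦ S^ I ⟧ w) (λ I J → basis (I ⧺ J)) x y ⟩
    eval (λ I → eval (λ J → eval (λ I → ⟦ S^ I ⟧ w) (basis (I ⧺ J))) y) x
      ≈⟨ eval-cong x (λ I → eval-cong y λ J → trans (eval-basis (λ I → ⟦ S^ I ⟧ w) (I ⧺ J))
           (sym (⟦⟧-cong (S^ I · S^ J) (S^ (I ⧺ J)) (S*-++ (columns I) (columns J)) d))) ⟩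
    eval (λ I → eval (λ J → ⟦ S^ I · S^ J ⟧ w) y) x
      ≈⟨ ·-extend S^ S^ x y d ⟨
    ⟦ extend S^ x · extend S^ y ⟧ w
      ∎

  extend-basis : ∀ I → extend S^ (basis I) ≈ᶠ S^ I
  extend-basis I = ⟦⟧-ext (extend S^ (basis I)) (S^ I) λ {w} _ →
    trans (⟦⟧-extend S^ (basis I)) (eval-basis (λ I → ⟦ S^ I ⟧ w) I)

  extend-++ : ∀ x y → extend S^ (x ++ y) ≈ᶠ extend S^ x ++ extend S^ y
  extend-++ x y = ⟦⟧-ext (extend S^ (x ++ y)) (extend S^ x ++ extend S^ y) λ _ →
    trans (⟦⟧-extend S^ (x ++ y)) (trans (eval-++ x y)
      (trans (+-cong (sym (⟦⟧-extend S^ x)) (sym (⟦⟧-extend S^ y))) (sym (eval-++ (extend S^ x) (extend S^ y)))))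

  extend-• : ∀ k x → extend S^ (k • x) ≈ᶠ k • extend S^ x
  extend-• k x = ⟦⟧-ext (extend S^ (k • x)) (k • extend S^ x) λ _ →
    trans (⟦⟧-extend S^ (k • x)) (trans (eval-• k x)
      (trans (*-congˡ (sym (⟦⟧-extend S^ x))) (sym (eval-• k (extend S^ x)))))

  ++-congᶠ : ∀ {x x′ y y′} → x ≈ᶠ x′ → y ≈ᶠ y′ → x ++ y ≈ᶠ x′ ++ y′
  ++-congᶠ {x} {x′} {y} {y′} x≈ y≈ b =
    trans (coeff-++ 𝕊 x y b) (trans (+-cong (x≈ b) (y≈ b)) (sym (coeff-++ 𝕊 x′ y′ b)))

  •-congᶠ : ∀ k {x y} → x ≈ᶠ y → k • x ≈ᶠ k • y
  •-congᶠ k {x} {y} x≈y b = trans (coeff-• 𝕊 k x b) (trans (*-congˡ (x≈y b)) (sym (coeff-• 𝕊 k y b)))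

  -- The span of the S^I contains the generators and is closed under products, because concatenating
  -- vector compositions multiplies the corresponding elements.
  S^-span : ∀ y → y ∈Sym → ∃ λ x → y ≈ᶠ extend S^ x
  S^-span _ (S∈ n) with Vecₚ.≡-dec ℕₚ._≟_ n 𝟎
  -- A vector composition has no zero column, so the generator of weight 0, which is `𝟙`,
  -- corresponds to the empty one.
  ... | yes n≡0 = basis ∅ᵛ , λ b → trans (S-𝟎 n≡0 b) (sym (extend-basis ∅ᵛ b))
  ... | no  n≢0 = basis [ n≢0 ]ᵛ , λ b → trans (sym (·-identityʳ (S n) b)) (sym (extend-basis [ n≢0 ]ᵛ b))
  S^-span _ 𝟙∈  = basis ∅ᵛ , λ b → sym (extend-basis ∅ᵛ b)
  S^-span _ 0∈  = [] , λ b → refl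
  S^-span _ (+∈ {y} {y′} p q) with S^-span _ p | S^-span _ q
  ... | x , eq | x′ , eq′ = x ++ x′ , λ b →
    trans (++-congᶠ {y} {extend S^ x} {y′} {extend S^ x′} eq eq′ b) (sym (extend-++ x x′ b))
  S^-span _ (•∈ k {y} p) with S^-span _ p
  ... | x , eq = k • x , λ b → trans (•-congᶠ k {y} {extend S^ x} eq b) (sym (extend-• k x b))
  S^-span _ (·∈ {y} {y′} p q) with S^-span _ p | S^-span _ q
  ... | x , eq | x′ , eq′ = x ⊛ x′ , λ b →
    trans (·-cong y (extend S^ x) y′ (extend S^ x′) eq eq′ b) (sym (extend-⊛ x x′ b))
  S^-span _ (resp y≈z p) with S^-span _ p
  ... | x , eq = x , λ b → trans (sym (y≈z b)) (eq b)

  S*∈ : ∀ I → S* I ∈Sym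
  S*∈ []      = 𝟙∈
  S*∈ (n ∷ I) = ·∈ (S∈ n) (S*∈ I)

  S^-isLinearBasis : IsLinearBasisOfSym 𝕍 S^
  S^-isLinearBasis = record
    { member      = S*∈ ∘ columns
    ; independent = S^-independent
    ; spanning    = S^-span
    }

  -- The coproduct on Sym

  coeff-Δ-Sym : ∀ {x l} → x ≈ᶠ extend S^ l → ∀ b →
                coeff 𝕊⊗𝕊 (Δ x) b ≈ eval (λ I → coeff 𝕊⊗𝕊 (Δ (S^ I)) b) l
  coeff-Δ-Sym {x} {l} x≈ b = trans (Δ-cong x (extend S^ l) x≈ b) (coeff-Δ-extend S^ l b)

  Δ-cocommutative : ∀ x → x ∈Sym → flip⊗ (Δ x) ≈⊗ Δ x
  Δ-cocommutative x x∈ (b , b′) with S^-span x x∈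
  ... | l , x≈ = begin
    coeff 𝕊⊗𝕊 (flip⊗ (Δ x)) (b , b′)                    ≈⟨ coeff-flip⊗ (Δ x) b b′ ⟩
    coeff 𝕊⊗𝕊 (Δ x) (b′ , b)                            ≈⟨ coeff-Δ-Sym {x} {l} x≈ (b′ , b) ⟩
    eval (λ I → coeff 𝕊⊗𝕊 (Δ (S^ I)) (b′ , b)) l        ≈⟨ eval-cong l (λ I → Δ-S*-cocommutative (columns I) b b′) ⟩
    eval (λ I → coeff 𝕊⊗𝕊 (Δ (S^ I)) (b , b′)) l        ≈⟨ coeff-Δ-Sym {x} {l} x≈ (b , b′) ⟨
    coeff 𝕊⊗𝕊 (Δ x) (b , b′)                            ∎

  Δ-closed : ∀ x → x ∈Sym → ∃ λ (l : List (Sym × Sym)) → Δ x ≈⊗ ∑ l λ ((y , _) , (z , _)) → y ⊗ z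
  Δ-closed x x∈ with S^-span x x∈
  ... | l , x≈ = List.concatMap tensors l , λ (b , b′) → begin
    coeff 𝕊⊗𝕊 (Δ x) (b , b′)
      ≈⟨ coeff-Δ-Sym {x} {l} x≈ (b , b′) ⟩
    eval (λ I → coeff 𝕊⊗𝕊 (Δ (S^ I)) (b , b′)) l
      ≈⟨ sum-cong l (λ (k , I) → trans (*-congˡ (coeff-Δ-S* (columns I) b b′)) (trans
           (sum-*ˡ k (columnDecompositions (columns I)) _)
           (sum-cong (columnDecompositions (columns I)) λ (A , B) → trans (sym (*-assoc _ _ _))
             (*-congʳ (sym (eval-• k (S* A))))))) ⟩
    sum l (λ (k , I) → sum (columnDecompositions (columns I)) λ (A , B) →
      ⟦ k • S* A ⟧ (biword b) * ⟦ S* B ⟧ (biword b′))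
      ≈⟨ sum-cong l (λ (k , I) → sum-map (tensor k) (columnDecompositions (columns I))) ⟨
    sum l (λ t → sum (tensors t) (value b b′))
      ≈⟨ sum-concatMap tensors l ⟨
    sum (List.concatMap tensors l) (value b b′)
      ≈⟨ coeff-∑⊗ proj₁ proj₁ (List.concatMap tensors l) b b′ ⟨
    coeff 𝕊⊗𝕊 (∑ (List.concatMap tensors l) λ ((y , _) , (z , _)) → y ⊗ z) (b , b′)
      ∎
    where
    tensor : Carrier → Columns × Columns → Sym × Sym
    -- A list of tensors carries no scalars of its own, so `k` is absorbed into the left factor.
    tensor k (A , B) = (k • S* A , •∈ k (S*∈ A)) , (S* B , S*∈ B)

    tensors : Carrier × VC → List (Sym × Sym)
    tensors (k , I) = map (tensor k) (columnDecompositions (columns I))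

    value : ColoredPermutation ℓ → ColoredPermutation ℓ → Sym × Sym → Carrier
    value b b′ ((y , _) , (z , _)) = ⟦ y ⟧ (biword b) * ⟦ z ⟧ (biword b′)

  -- Stability under the antipode

  ∑∈ : ∀ {a} {A : Set a} (xs : List A) (f : A → FQSym) → (∀ {x} → x ∈ xs → f x ∈Sym) → ∑ xs f ∈Sym
  ∑∈ []       f h = 0∈
  ∑∈ (x ∷ xs) f h = +∈ (h (here ≡.refl)) (∑∈ xs f (h ∘ there))

  module _ {A : FQSym → FQSym} (isAntipode : IsAntipode A) where

    open IsAntipode isAntipode using (linear; inverseˡ)
    open LeftModuleMorphisms.IsLeftModuleHomomorphism linear
      using (+ᴹ-homo; 0ᴹ-homo; *ₗ-homo) renaming (⟦⟧-cong to A-cong)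

    private

      AG : Word ℓ → ColoredPermutation ℓ → Carrier
      AG w a = ⟦ A (G a) ⟧ w

      -- `A` is an arbitrary function on lists of terms that is linear up to `_≈ᶠ_`. Splitting off
      -- one term at a time shows that its values on the basis determine it.
      ⟦A⟧ : ∀ x {w} → Distinct w → ⟦ A x ⟧ w ≈ eval (AG w) x
      ⟦A⟧ []            d = ⟦⟧-cong (A []) [] 0ᴹ-homo d
      ⟦A⟧ ((k , a) ∷ x) {w} d = begin
        ⟦ A ((k , a) ∷ x) ⟧ w
          ≈⟨ ⟦⟧-cong (A ((k , a) ∷ x)) (A (k • G a ++ x)) (A-cong λ b → scale b) d ⟩
        ⟦ A (k • G a ++ x) ⟧ w
          ≈⟨ ⟦⟧-cong (A (k • G a ++ x)) (A (k • G a) ++ A x) (+ᴹ-homo (k • G a) x) d ⟩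
        ⟦ A (k • G a) ++ A x ⟧ w
          ≈⟨ eval-++ (A (k • G a)) (A x) ⟩
        ⟦ A (k • G a) ⟧ w + ⟦ A x ⟧ w
          ≈⟨ +-cong (trans (⟦⟧-cong (A (k • G a)) (k • A (G a)) (*ₗ-homo k (G a)) d) (eval-• k (A (G a)))) (⟦A⟧ x d) ⟩
        k * AG w a + eval (AG w) x
          ∎
        where
        -- The two lists differ only in the scalar, which is `k * 1#` on the right.
        scale : ((k , a) ∷ x) ≈ᶠ (k • G a ++ x)
        scale b = trans (coeff-eval 𝕊 ((k , a) ∷ x) b)
          (trans (+-congʳ (*-congʳ (sym (*-identityʳ k)))) (sym (coeff-eval 𝕊 (k • G a ++ x) b)))

      A-extend : ∀ {i} {I : Set i} (f : I → FQSym) x → A (extend f x) ≈ᶠ extend (A ∘ f) x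
      A-extend f x = ⟦⟧-ext (A (extend f x)) (extend (A ∘ f) x) λ {w} d → begin
        ⟦ A (extend f x) ⟧ w                  ≈⟨ ⟦A⟧ (extend f x) d ⟩
        eval (AG w) (extend f x)              ≈⟨ eval-extend (AG w) f x ⟩
        eval (λ i → eval (AG w) (f i)) x      ≈⟨ eval-cong x (λ i → ⟦A⟧ (f i) d) ⟨
        eval (λ i → ⟦ A (f i) ⟧ w) x          ≈⟨ ⟦⟧-extend (A ∘ f) x ⟨
        ⟦ extend (A ∘ f) x ⟧ w                ∎

      convolve : ColoredPermutation ℓ × ColoredPermutation ℓ → FQSym
      convolve (a , b) = A (G a) · G b

      ⟦convolve⟧ : ∀ x y {w} → Distinct w → eval (λ s → ⟦ convolve s ⟧ w) (x ⊗ y) ≈ ⟦ A x · y ⟧ w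
      ⟦convolve⟧ x y {w} d = begin
        eval (λ s → ⟦ convolve s ⟧ w) (x ⊗ y)
          ≈⟨ eval-extend₂ (λ s → ⟦ convolve s ⟧ w) (λ a b → basis (a , b)) x y ⟩
        eval (λ a → eval (λ b → eval (λ s → ⟦ convolve s ⟧ w) (basis (a , b))) y) x
          ≈⟨ eval-cong x (λ a → eval-cong y λ b → eval-basis (λ s → ⟦ convolve s ⟧ w) (a , b)) ⟩
        eval (λ a → eval (λ b → ⟦ A (G a) · G b ⟧ w) y) x
          ≈⟨ ·-extend (A ∘ G) G x y d ⟨
        ⟦ extend (A ∘ G) x · extend G y ⟧ w
          ≈⟨ ⟦⟧-cong (extend (A ∘ G) x · extend G y) (A x · y)
               (·-cong (extend (A ∘ G) x) (A x) (extend G y) y (extend-A) (extend-G y)) d ⟩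
        ⟦ A x · y ⟧ w
          ∎
        where
        extend-G : ∀ y → extend G y ≈ᶠ y
        extend-G y = ⟦⟧-ext (extend G y) y λ {w} _ → trans (⟦⟧-extend G y)
          (eval-cong y λ b → eval-basis (λ a → ind (biword a ≋? w)) b)
        extend-A : extend (A ∘ G) x ≈ᶠ A x
        extend-A = ⟦⟧-ext (extend (A ∘ G) x) (A x) λ d → trans (⟦⟧-extend (A ∘ G) x) (sym (⟦A⟧ x d))

      -- The left antipode equation at `S* I`, with the coproduct expanded. The expansion `Δ-S*` is
      -- an equality of coefficients, so `convolve` has to respect the equality of basis pairs.
      A-S* : ∀ I {w} → Distinct w →
        sum (columnDecompositions I) (λ (B , C) → ⟦ A (S* B) · S* C ⟧ w) ≈ ⟦ ε (S* I) • 𝟙 ⟧ w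
      A-S* I {w} d = begin
        sum (columnDecompositions I) (λ (B , C) → ⟦ A (S* B) · S* C ⟧ w)
          ≈⟨ sum-cong (columnDecompositions I) (λ (B , C) → ⟦convolve⟧ (S* B) (S* C) d) ⟨
        sum (columnDecompositions I) (λ (B , C) → eval (λ s → ⟦ convolve s ⟧ w) (S* B ⊗ S* C))
          ≈⟨ eval-∑ (λ s → ⟦ convolve s ⟧ w) (columnDecompositions I) (λ (B , C) → S* B ⊗ S* C) ⟨
        eval (λ s → ⟦ convolve s ⟧ w) (∑ (columnDecompositions I) λ (B , C) → S* B ⊗ S* C)
          ≈⟨ EvaluationCong.eval-respects K (selfAlgebra K) 𝕊⊗𝕊
               (λ {s} {t} → convolve-cong s t) (Δ (S* I))
               (∑ (columnDecompositions I) λ (B , C) → S* B ⊗ S* C) (Δ-S* I) ⟨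
        eval (λ s → ⟦ convolve s ⟧ w) (Δ (S* I))
          ≈⟨ ⟦⟧-extend convolve (Δ (S* I)) ⟨
        ⟦ extend convolve (Δ (S* I)) ⟧ w
          ≈⟨ ⟦⟧-cong (extend convolve (Δ (S* I))) (ε (S* I) • 𝟙) (inverseˡ (S* I)) d ⟩
        ⟦ ε (S* I) • 𝟙 ⟧ w
          ∎
        where
        G-cong : ∀ {a b} → biword a ≡ biword b → G a ≈ᶠ G b
        G-cong {a} {b} eq = ⟦⟧-ext (G a) (G b) λ {w} _ → +-congʳ (*-congˡ (ind-cong (biword a ≋? w) (biword b ≋? w)
          (≡.subst (_≋ w) eq) (≡.subst (_≋ w) (≡.sym eq))))
        convolve-cong : ∀ s t → DecSetoid._≈_ 𝕊⊗𝕊 s t → ⟦ convolve s ⟧ w ≈ ⟦ convolve t ⟧ w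
        convolve-cong (a , b) (a′ , b′) (p , q) = ⟦⟧-cong (A (G a) · G b) (A (G a′) · G b′)
          (·-cong (A (G a)) (A (G a′)) (G b) (G b′) (A-cong (G-cong {a} {a′} p)) (G-cong {b} {b′} q)) d

    -- Solves the antipode equation for its term of highest weight.
    A-S*∈ : ∀ m I → weight I < m → A (S* I) ∈Sym
    A-S*∈ (suc m) I (s≤s I≤m) = resp (⟦⟧-ext solution (A (S* I)) solved)
      (+∈ (•∈ (ε (S* I)) 𝟙∈) (•∈ (- 1#) (∑∈ rest term λ {s} s∈ → ·∈ (smaller s∈) (S*∈ (proj₂ s)))))
      where
      -- The right component multiplies to `𝟙`, so the term of `top` is `A (S* I)` itself. Every
      -- other pair has a left component of smaller weight, to which the induction applies.
      top : Columns × Columns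
      top = I , map (λ _ → 𝟎) I

      top? : ∀ (s : Columns × Columns) → Dec (top ≡ s)
      top? s = Productₚ.≡-dec (Listₚ.≡-dec (Vecₚ.≡-dec ℕₚ._≟_)) (Listₚ.≡-dec (Vecₚ.≡-dec ℕₚ._≟_)) top s

      rest : List (Columns × Columns)
      rest = List.filter (¬? ∘ top?) (columnDecompositions I)

      term : Columns × Columns → FQSym
      term (B , C) = A (S* B) · S* C

      solution : FQSym
      solution = ε (S* I) • 𝟙 ++ (- 1#) • ∑ rest term

      smaller : ∀ {s} → s ∈ rest → A (S* (proj₁ s)) ∈Sym
      smaller {B , C} s∈ with ∈-filter⁻ (¬? ∘ top?) {xs = columnDecompositions I} s∈
      ... | s∈′ , ≢top with weight-columnSum (∈-columnDecompositions⁻ I s∈′)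
      ...   | inj₁ lt        = A-S*∈ m B (ℕₚ.<-≤-trans lt I≤m)
      ...   | inj₂ (p , q) = contradiction (≡.sym (≡.cong₂ _,_ p q)) ≢top

      solved : ∀ {w} → Distinct w → ⟦ solution ⟧ w ≈ ⟦ A (S* I) ⟧ w
      solved {w} d = begin
        ⟦ solution ⟧ w
          ≈⟨ eval-++ (ε (S* I) • 𝟙) ((- 1#) • ∑ rest term) ⟩
        ⟦ ε (S* I) • 𝟙 ⟧ w + ⟦ (- 1#) • ∑ rest term ⟧ w
          ≈⟨ +-cong (sym (A-S* I d)) (trans (eval-• (- 1#) (∑ rest term)) (-1*x≈-x _)) ⟩
        sum (columnDecompositions I) (λ s → ⟦ term s ⟧ w) + - ⟦ ∑ rest term ⟧ w
          ≈⟨ +-cong (sum-peel top? (λ s → ⟦ term s ⟧ w) (once-columnDecompositions (columnSum-𝟎 I))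
               (λ { ≡.refl → ⟦⟧-cong (A (S* I) · S* (proj₂ top)) (A (S* I)) top-term d }))
               (-‿cong (⟦⟧-∑ term rest)) ⟩
        (⟦ A (S* I) ⟧ w + sum rest (λ s → ⟦ term s ⟧ w)) + - sum rest (λ s → ⟦ term s ⟧ w)
          ≈⟨ trans (+-assoc _ _ _) (trans (+-congˡ (-‿inverseʳ _)) (+-identityʳ _)) ⟩
        ⟦ A (S* I) ⟧ w
          ∎
        where
        top-term : A (S* I) · S* (proj₂ top) ≈ᶠ A (S* I)
        top-term b = trans
          (·-cong (A (S* I)) (A (S* I)) (S* (proj₂ top)) 𝟙 (λ _ → refl) (S*-𝟎 I) b) (·-identityʳ (A (S* I)) b)

    antipode-closed : ∀ x → x ∈Sym → A x ∈Sym
    antipode-closed x x∈ with S^-span x x∈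
    ... | l , x≈ = resp (λ b → sym (trans (A-cong x≈ b) (A-extend S^ l b)))
      (∑∈ l (λ (k , I) → k • A (S^ I)) λ { {k , I} _ → •∈ k (A-S*∈ (suc (weight (columns I))) (columns I) ℕₚ.≤-refl) })

  Sym-isHopfSubalgebra : SymIsHopfSubalgebra
  Sym-isHopfSubalgebra = record
    { Δ-closed        = Δ-closed
    ; antipode-closed = λ A isAntipode → antipode-closed isAntipode
    }

  -- The universal property

  module _ {a b} (A : AssociativeAlgebra K a b)
           (f : (n : Partite ℓ) → 0 < ∣ n ∣ → AssociativeAlgebra.Carrier A) where

    private
      module A = AssociativeAlgebra A
      module E = Evaluation K A

    -- `f` is given for positive weight only; the value at weight 0 follows `S-𝟎`.
    letter : ∀ n → Dec (0 < ∣ n ∣) → A.Carrier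
    letter n (yes p) = f n p
    letter n (no _)  = A.1#

    monomial : Columns → A.Carrier
    monomial = List.foldr (λ n u → letter n (0 ℕₚ.<? ∣ n ∣) A.* u) A.1#

    monomial-++ : ∀ I J → monomial (I ++ J) A.≈ monomial I A.* monomial J
    monomial-++ []      J = A.sym (A.*-identityˡ _)
    monomial-++ (n ∷ I) J = A.trans (A.*-congˡ (monomial-++ I J)) (A.sym (A.*-assoc _ _ _))

    evaluate : Lin VC → A.Carrier
    evaluate = E.eval (monomial ∘ columns)

    -- Linear independence enters here: two expansions of one element have equal coefficients, hence
    -- equal values in `A`.
    evaluate-cong : ∀ l m → extend S^ l ≈ᶠ extend S^ m → evaluate l A.≈ evaluate m
    evaluate-cong l m l≈m = EvaluationCong.eval-difference K A 𝕍 l m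
      (E.eval-vanishes 𝕍 (λ eq → A.reflexive (≡.cong monomial eq)) (difference 𝕍 l m) λ I →
        A.trans (A.*-congʳ (A.trans (E.ι.⟦⟧-cong (S^-independent (difference 𝕍 l m) vanishes I)) E.ι.0#-homo))
          (A.zeroˡ _))
      where
      vanishes : extend S^ (difference 𝕍 l m) ≈ᶠ []
      vanishes b = trans (extend-++ l ((- 1#) • m) b) (trans
        (++-congᶠ {extend S^ l} {extend S^ m} {extend S^ ((- 1#) • m)} {(- 1#) • extend S^ m} l≈m (extend-• (- 1#) m) b)
        (coeff-difference 𝕊 (extend S^ m) (extend S^ m) b refl))

    evaluate-⊛ : ∀ l m → evaluate (l ⊛ m) A.≈ evaluate l A.* evaluate m
    evaluate-⊛ l m = A.trans (E.eval-extend₂ (monomial ∘ columns) (λ I J → basis (I ⧺ J)) l m) (A.trans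
      (E.eval-cong l λ I → E.eval-cong m λ J → A.trans (E.eval-basis (monomial ∘ columns) (I ⧺ J))
        (monomial-++ (columns I) (columns J)))
      (E.eval-product (monomial ∘ columns) (monomial ∘ columns) l m))

    -- The expansion is computed from the derivation of `x ∈Sym`, so the value seems to depend on
    -- that derivation. `lift-unique` shows that any expansion of `x` may be used instead, and each
    -- homomorphism law is proved by choosing a convenient one.
    lift : Sym → A.Carrier
    lift (x , x∈) = evaluate (proj₁ (S^-span x x∈))

    lift-unique : ∀ (x : Sym) l → extend S^ l ≈ᶠ proj₁ x → lift x A.≈ evaluate l
    lift-unique (x , x∈) l eq with S^-span x x∈
    ... | m , x≈ = evaluate-cong m l λ b → trans (sym (x≈ b)) (sym (eq b))

    lift-extends : IsAlgebraHomomorphism A lift × (∀ n (n>0 : 0 < ∣ n ∣) → lift (S n , S∈ n) A.≈ f n n>0)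
    lift-extends = record
      { isRingHomomorphism = record
        { isSemiringHomomorphism = record
          { isNearSemiringHomomorphism = record
            { +-isMonoidHomomorphism = record
              { isMagmaHomomorphism = record
                { isRelHomomorphism = record
                  { cong = λ {x} {y} x≈y → lift-unique x (span y) λ b → trans (sym (spans y b)) (sym (x≈y b)) }
                ; homo = λ x y → A.trans
                    (lift-unique (proj₁ x ++ proj₁ y , +∈ (proj₂ x) (proj₂ y)) (span x ++ span y) λ b → trans
                      (extend-++ (span x) (span y) b)
                      (sym (++-congᶠ {proj₁ x} {extend S^ (span x)} {proj₁ y} {extend S^ (span y)} (spans x) (spans y) b)))
                    (E.eval-++ (span x) (span y))
                }
              ; ε-homo = lift-unique ([] , 0∈) [] (λ _ → refl)
              }
            ; *-homo = λ x y → A.trans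
                (lift-unique (proj₁ x · proj₁ y , ·∈ (proj₂ x) (proj₂ y)) (span x ⊛ span y) λ b → trans
                  (extend-⊛ (span x) (span y) b)
                  (sym (·-cong (proj₁ x) (extend S^ (span x)) (proj₁ y) (extend S^ (span y)) (spans x) (spans y) b)))
                (evaluate-⊛ (span x) (span y))
            }
          ; 1#-homo = A.trans (lift-unique (𝟙 , 𝟙∈) (basis ∅ᵛ) (extend-basis ∅ᵛ))
              (E.eval-basis (monomial ∘ columns) ∅ᵛ)
          }
        ; -‿homo = λ x → A.trans (scaled (- 1#) x) (A.trans
            (A.*-congʳ (A.trans (E.ι.-‿homo 1#) (A.-‿cong E.ι.1#-homo)))
            (RingProperties.-1*x≈-x A.ring _))
        }
      ; •-homo = λ k x x∈ → scaled k (x , x∈)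
      } , generator
      where
      span : Sym → Lin VC
      span (x , x∈) = proj₁ (S^-span x x∈)

      spans : ∀ x → proj₁ x ≈ᶠ extend S^ (span x)
      spans (x , x∈) = proj₂ (S^-span x x∈)

      scaled : ∀ k x → lift (k • proj₁ x , •∈ k (proj₂ x)) A.≈ A.ι k A.* lift x
      scaled k x = A.trans
        (lift-unique (k • proj₁ x , •∈ k (proj₂ x)) (k • span x) λ b → trans (extend-• k (span x) b)
          (sym (•-congᶠ k {proj₁ x} {extend S^ (span x)} (spans x) b)))
        (E.eval-• k (span x))

      generator : ∀ n (n>0 : 0 < ∣ n ∣) → lift (S n , S∈ n) A.≈ f n n>0
      generator n n>0 = A.trans
        (lift-unique (S n , S∈ n) (basis [ n≢0 ]ᵛ) λ b → trans (extend-basis [ n≢0 ]ᵛ b) (·-identityʳ (S n) b))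
        (A.trans (E.eval-basis (monomial ∘ columns) [ n≢0 ]ᵛ)
          (A.trans (A.*-identityʳ _) (letter-f (0 ℕₚ.<? ∣ n ∣))))
        where
        n≢0 : n ≢ 𝟎
        n≢0 ≡.refl = ℕₚ.<⇒≢ n>0 (≡.sym (∣𝟎∣ ℓ))
        letter-f : ∀ d → letter n d A.≈ f n n>0
        letter-f (yes p)  = A.reflexive (≡.cong (f n) (ℕₚ.<-irrelevant p n>0))
        letter-f (no ¬p) = contradiction n>0 ¬p

    -- Induction on the derivation of membership. A generator of weight 0 equals `𝟙`, so agreement
    -- in positive weight is enough.
    extension-unique : ∀ {φ ψ : Sym → A.Carrier} → IsAlgebraHomomorphism A φ → IsAlgebraHomomorphism A ψ →
      (∀ n → 0 < ∣ n ∣ → φ (S n , S∈ n) A.≈ ψ (S n , S∈ n)) → ∀ x (x∈ : x ∈Sym) → φ (x , x∈) A.≈ ψ (x , x∈)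
    extension-unique {φ} {ψ} hφ hψ agree = go
      where
      module φ = IsAlgebraHomomorphism hφ
      module ψ = IsAlgebraHomomorphism hψ
      module φʳ = RingMorphisms.IsRingHomomorphism φ.isRingHomomorphism
      module ψʳ = RingMorphisms.IsRingHomomorphism ψ.isRingHomomorphism

      go : ∀ x (x∈ : x ∈Sym) → φ (x , x∈) A.≈ ψ (x , x∈)
      go _ (S∈ n) with 0 ℕₚ.<? ∣ n ∣
      ... | yes n>0 = agree n n>0
      ... | no  n≯0 = A.trans (φʳ.⟦⟧-cong {S n , S∈ n} {𝟙 , 𝟙∈} S≈𝟙) (A.trans (A.trans φʳ.1#-homo (A.sym ψʳ.1#-homo))
        (A.sym (ψʳ.⟦⟧-cong {S n , S∈ n} {𝟙 , 𝟙∈} S≈𝟙)))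
        where
        S≈𝟙 : S n ≈ᶠ 𝟙
        S≈𝟙 = S-𝟎 (∣n∣≡0⇒𝟎 n (ℕₚ.n≤0⇒n≡0 (ℕₚ.≮⇒≥ n≯0)))
      go _ 𝟙∈ = A.trans φʳ.1#-homo (A.sym ψʳ.1#-homo)
      go _ 0∈ = A.trans φʳ.0#-homo (A.sym ψʳ.0#-homo)
      go _ (+∈ {x} {y} p q) = A.trans (φʳ.+-homo (x , p) (y , q))
        (A.trans (A.+-cong (go x p) (go y q)) (A.sym (ψʳ.+-homo (x , p) (y , q))))
      go _ (•∈ k {x} p) = A.trans (φ.•-homo k x p) (A.trans (A.*-congˡ (go x p)) (A.sym (ψ.•-homo k x p)))
      go _ (·∈ {x} {y} p q) = A.trans (φʳ.*-homo (x , p) (y , q))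
        (A.trans (A.*-cong (go x p) (go y q)) (A.sym (ψʳ.*-homo (x , p) (y , q))))
      go _ (resp {x} {y} x≈y p) = A.trans (A.sym (φʳ.⟦⟧-cong {x , p} {y , resp x≈y p} x≈y))
        (A.trans (go x p) (ψʳ.⟦⟧-cong {x , p} {y , resp x≈y p} x≈y))

  Sym-isFree : ∀ a b → SymIsFree a b
  Sym-isFree a b A f = lift A f , lift-extends A f , λ ψ (hψ , ψ-S) (x , x∈) →
    extension-unique A f hψ (proj₁ (lift-extends A f))
      (λ n n>0 → A.trans (ψ-S n n>0) (A.sym (proj₂ (lift-extends A f) n n>0))) x x∈
    where module A = AssociativeAlgebra A

theorem4p1 : ∀ {c e a b} (K : CommutativeRing c e) (ℓ : ℕ) →
    let open ColoredAlgebra K ℓ in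
    SymIsFree a b ×
    IsLinearBasisOfSym (vectorCompositionDecSetoid ℓ) S^ ×
    SymIsHopfSubalgebra ×
    (∀ n → Δ (S n) ≈⊗ ∑ (decompositions n) λ (i , j) → S i ⊗ S j) ×
    (∀ x → x ∈Sym → flip⊗ (Δ x) ≈⊗ Δ x)
theorem4p1 {a = a} {b} K ℓ =
  Sym-isFree a b , S^-isLinearBasis , Sym-isHopfSubalgebra , Coproducts.Δ-S K ℓ , Δ-cocommutative
  where open Freeness K ℓ
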